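{- Let $k$ be a constant. Let $G=(B\uplus W,E)$ be a twin-free bipartite graph on $n$ vertices of bimodularwidth at most $k$, and let $T_G$ be its canonical bimodular decomposition tree. Given $G$ and $T_G$, the maxbisize set $MBS_G$ can be computed in $O(n^2)$ time. Furthermore, for a given maxbisize $(b,w)\in MBS_G$, a biclique of $G$ of size $(b,w)$ can be exhibited in $O(n^2)$ time.
   Context: $G=(B\uplus W,E)$ is a finite bipartite graph whose partition of the vertex set $V=B\cup W$ into black vertices $B$ and white vertices $W$ is given (induced subgraphs inherit the coloring); $n=|V|$. Running times are in the usual unit-cost RAM model. $G$ is twin-free if no two distinct vertices have the same neighborhood. Bicliques and maxbisizes. A biclique of $G$ is a set $C\subseteq V$ such that every black vertex of $C$ is adjacent to every white vertex of $C$ (one of the two colors may be absent); its size is $(|C\cap B|,|C\cap W|)$. A pair $(b,w)\in\mathbb{N}^2$ is a bisize of $G$ if $G$ contains a biclique of size $(b,w)$. A pair $(x,y)$ dominates $(x',y')$ if $x'\le x$ and $y'\le y$, strictly if moreover the pairs differ. A maxbisize of $G$ is a bisize not strictly dominated by another bisize of $G$; $MBS_G$ is the set of all maxbisizes. Adjacency of sets. For disjoint $X,Y\subset V$: $X$ is nonadjacent to $Y$ if there is no edge between them; $X$ is fully adjacent to $Y$ if every black (resp. white) vertex of $X$ is adjacent to every white (resp. black) vertex of $Y$; $X$ is left adjacent to $Y$ if every black vertex of $X$ is adjacent to every white vertex of $Y$ and no white vertex of $X$ has a black neighbor in $Y$. Decompositions. Let $V$ be partitioned into nonempty $V_1,\dots,V_p$,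 $p\ge2$, and $G_i=G[V_i]$. If $V_i$ is nonadjacent (resp. fully adjacent) to $V_j$ for all $i\ne j$, with $p$ maximum for this property, then $G$ admits a Parallel (resp. Series) decomposition into $G_1,\dots,G_p$. If $V_i$ is left adjacent to $V_j$ for all $i<j$, with $p$ maximum for this property, then $G$ admits a K+S decomposition into $G_1,\dots,G_p$. If $G$ would admit both a K+S decomposition and a Parallel or Series one, then by convention it admits only the K+S decomposition. Prime decomposition. A bimodule of $G$ is a set $M\subseteq V$ such that each vertex $v$ of $V\setminus M$ is such that $\{v\}$ is nonadjacent or fully adjacent to $M$. It is trivial if it has at most one black and at most one white vertex; $V$ itself is also not counted among the nontrivial bimodules. If $G$ has at least two vertices and no Parallel, Series or K+S decomposition, it is known that two distinct inclusion-maximal nontrivial bimodules are either disjoint or share exactly one vertex, called an augmenting vertex. Removing the augmenting vertices (at most 2) from each maximal nontrivial bimodule gives pairwise disjoint sets; those that are nontrivial are the maximal canonical bimodules. The Prime decomposition of $G$ is the partition of $V$ into the maximal canonical bimodules and singletons (one for each remaining vertex). Canonical decomposition tree. Every twin-free bipartite graph with at least two vertices admits exactly one of the Parallel, Series, K+S or Prime decompositions (known theorem). The canonical bimodular decomposition tree $T_G$ has a root labeled by the decomposition that applies, whose children are the roots of the canonical trees of the subgraphs induced by the parts; one-vertex graphs are leaves. The bimodularwidth of $G$ is the largest number of children (counting leaves) of a Prime node of $T_G$, or $2$ if $T_G$ has no Prime node. -}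

module Defs where

open import Data.Bool using (Bool; true; false)
open import Data.Fin using (Fin; toℕ)
open import Data.Fin.Subset
  using (Subset; _∈_; _∉_; _⊆_; _∩_; ∁; ⊤; ⁅_⁆; ⋃; ∣_∣; Nonempty; Empty)
open import Data.List as List using (List; []; _∷_; _++_; _∷ʳ_; length; foldr)
open import Data.List.Membership.Propositional using () renaming (_∈_ to _∈ˡ_)
open import Data.List.Relation.Binary.Pointwise using (Pointwise)
open import Data.List.Relation.Unary.All using (All)
open import Data.List.Relation.Unary.AllPairs using (AllPairs)
open import Data.Maybe using (Maybe; just; nothing)
open import Data.Nat using (ℕ; zero; suc; _+_; _∸_; _⊔_; _≤_; _≡ᵇ_)
open import Data.Product using (_×_; _,_; ∃; ∃-syntax)
open import Data.Sum using (_⊎_)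
open import Data.Vec as Vec using (Vec)
open import Function.Bundles using (_⇔_)
open import Relation.Binary.PropositionalEquality using (_≡_; _≢_)
open import Relation.Nullary using (¬_)

------------------------------------------------------------------------
-- Bipartite graphs with a given colouring

record BipartiteGraph (n : ℕ) : Set where
  field
    B         : Subset n
    N         : Fin n → Subset n
    symmetric : ∀ {u v} → v ∈ N u → u ∈ N v
    bipartite : ∀ {u v} → v ∈ N u → (u ∈ B × v ∈ ∁ B) ⊎ (u ∈ ∁ B × v ∈ B)

  W : Subset n
  W = ∁ B

  Adjacent : Fin n → Fin n → Set
  Adjacent u v = v ∈ N u

TwinFree : ∀ {n} → BipartiteGraph n → Set
TwinFree G = ∀ u v → N u ≡ N v → u ≡ v
  where open BipartiteGraph G

------------------------------------------------------------------------
-- Bicliques and maxbisizes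

module _ {n : ℕ} (G : BipartiteGraph n) where
  open BipartiteGraph G

  Biclique : Subset n → Set
  Biclique C = ∀ {u v} → u ∈ C ∩ B → v ∈ C ∩ W → Adjacent u v

  size : Subset n → ℕ × ℕ
  size C = ∣ C ∩ B ∣ , ∣ C ∩ W ∣

  Bisize : ℕ × ℕ → Set
  Bisize p = ∃[ C ] Biclique C × size C ≡ p

Dominates : ℕ × ℕ → ℕ × ℕ → Set
Dominates (x , y) (x′ , y′) = x′ ≤ x × y′ ≤ y

StrictlyDominates : ℕ × ℕ → ℕ × ℕ → Set
StrictlyDominates p q = Dominates p q × p ≢ q

MaxBisize : ∀ {n} → BipartiteGraph n → ℕ × ℕ → Set
MaxBisize G p = Bisize G p × (∀ q → Bisize G q → ¬ StrictlyDominates q p)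

------------------------------------------------------------------------
-- Decompositions.  The induced subgraph G[S] is represented by its vertex
-- set S, with the adjacency and the colours of G.

module _ {n : ℕ} (G : BipartiteGraph n) where
  open BipartiteGraph G

  Nonadjacent : Subset n → Subset n → Set
  Nonadjacent X Y = ∀ {u v} → u ∈ X → v ∈ Y → ¬ Adjacent u v

  FullyAdjacent : Subset n → Subset n → Set
  FullyAdjacent X Y =
    (∀ {u v} → u ∈ X ∩ B → v ∈ Y ∩ W → Adjacent u v) ×
    (∀ {u v} → u ∈ X ∩ W → v ∈ Y ∩ B → Adjacent u v)

  LeftAdjacent : Subset n → Subset n → Set
  LeftAdjacent X Y =
    (∀ {u v} → u ∈ X ∩ B → v ∈ Y ∩ W → Adjacent u v) ×
    (∀ {u v} → u ∈ X ∩ W → v ∈ Y ∩ B → ¬ Adjacent u v)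

Partition : ∀ {n} → Subset n → List (Subset n) → Set
Partition S Vs =
  All Nonempty Vs × AllPairs (λ X Y → Empty (X ∩ Y)) Vs × ⋃ Vs ≡ S

-- AllPairs ranges over pairs i < j.  For the two symmetric relations
-- Nonadjacent and FullyAdjacent this is the same as all i ≠ j.
Splits : ∀ {n} → (Subset n → Subset n → Set) →
         Subset n → List (Subset n) → Set
Splits R S Vs = Partition S Vs × 2 ≤ length Vs × AllPairs R Vs

MaxSplits : ∀ {n} → (Subset n → Subset n → Set) →
            Subset n → List (Subset n) → Set
MaxSplits R S Vs =
  Splits R S Vs × (∀ Vs′ → Splits R S Vs′ → length Vs′ ≤ length Vs)

module _ {n : ℕ} (G : BipartiteGraph n) (S : Subset n) where
  open BipartiteGraph G

  K+SDecomposition : List (Subset n) → Set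
  K+SDecomposition = MaxSplits (LeftAdjacent G) S

  ParallelDecomposition : List (Subset n) → Set
  ParallelDecomposition Vs =
    MaxSplits (Nonadjacent G) S Vs × ¬ ∃ K+SDecomposition

  SeriesDecomposition : List (Subset n) → Set
  SeriesDecomposition Vs =
    MaxSplits (FullyAdjacent G) S Vs × ¬ ∃ K+SDecomposition

  Bimodule : Subset n → Set
  Bimodule M = M ⊆ S ×
    (∀ {v} → v ∈ S → v ∉ M → Nonadjacent G ⁅ v ⁆ M ⊎ FullyAdjacent G ⁅ v ⁆ M)

  Trivial : Subset n → Set
  Trivial M = ∣ M ∩ B ∣ ≤ 1 × ∣ M ∩ W ∣ ≤ 1

  NontrivialBimodule : Subset n → Set
  NontrivialBimodule M = Bimodule M × ¬ Trivial M × M ≢ S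

  MaximalBimodule : Subset n → Set
  MaximalBimodule M = NontrivialBimodule M ×
    (∀ M′ → NontrivialBimodule M′ → M ⊆ M′ → M′ ≡ M)

  Augmenting : Fin n → Set
  Augmenting v = ∃[ M ] ∃[ M′ ]
    MaximalBimodule M × MaximalBimodule M′ × M ≢ M′ × M ∩ M′ ≡ ⁅ v ⁆

  -- What is left of M is required to be a nontrivial bimodule, not merely to
  -- have two vertices of one colour: if M consists of an augmenting vertex v
  -- and two vertices differing only in their adjacency to v, then these two
  -- do not form a bimodule, and they become singletons.
  CanonicalBimodule : Subset n → Set
  CanonicalBimodule X = NontrivialBimodule X ×
    (∃[ M ] MaximalBimodule M × (∀ v → v ∈ X ⇔ (v ∈ M × ¬ Augmenting v)))

  RemainingSingleton : Subset n → Set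
  RemainingSingleton X = ∃[ v ]
    v ∈ S × (∀ Y → CanonicalBimodule Y → v ∉ Y) × X ≡ ⁅ v ⁆

  PrimeDecomposition : List (Subset n) → Set
  PrimeDecomposition Vs =
    2 ≤ ∣ S ∣ ×
    ¬ ∃ ParallelDecomposition × ¬ ∃ SeriesDecomposition × ¬ ∃ K+SDecomposition ×
    Partition S Vs ×
    (∀ X → X ∈ˡ Vs ⇔ (CanonicalBimodule X ⊎ RemainingSingleton X))

------------------------------------------------------------------------
-- Canonical decomposition trees

data Label : Set where
  parallel series k+s prime : Label

data Tree (n : ℕ) : Set where
  leaf : Fin n → Tree n
  node : Label → List (Tree n) → Tree n

Decomposition : ∀ {n} → BipartiteGraph n → Label →
                Subset n → List (Subset n) → Set
Decomposition G parallel = ParallelDecomposition G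
Decomposition G series   = SeriesDecomposition G
Decomposition G k+s      = K+SDecomposition G
Decomposition G prime    = PrimeDecomposition G

-- The children of a K+S node come in the order of the left adjacency; those
-- of the other nodes come in an arbitrary order.
data CanonicalOn {n} (G : BipartiteGraph n) : Subset n → Tree n → Set where
  leaf : ∀ v → CanonicalOn G ⁅ v ⁆ (leaf v)
  node : ∀ {ℓ S Vs Ts} → Decomposition G ℓ S Vs →
         Pointwise (CanonicalOn G) Vs Ts → CanonicalOn G S (node ℓ Ts)

CanonicalTree : ∀ {n} → BipartiteGraph n → Tree n → Set
CanonicalTree G T = CanonicalOn G ⊤ T

primeArities : ∀ {n} → Tree n → List ℕ
primeAritiesForest : ∀ {n} → List (Tree n) → List ℕ

primeArities (leaf _)        = []
primeArities (node prime Ts) = length Ts ∷ primeAritiesForest Ts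
primeArities (node _     Ts) = primeAritiesForest Ts

primeAritiesForest []       = []
primeAritiesForest (T ∷ Ts) = primeArities T ++ primeAritiesForest Ts

bimodularwidth : ∀ {n} → Tree n → ℕ
bimodularwidth T with primeArities T
... | []     = 2
... | a ∷ as = foldr _⊔_ a as

------------------------------------------------------------------------
-- Unit-cost random access machines in the style of Cook and Reckhow: the
-- registers hold natural numbers, there is indirect addressing, and addition
-- and truncated subtraction are the only arithmetic operations.

data Instr : Set where
  const : (i c : ℕ) → Instr        -- Xᵢ ← c
  add   : (i j k : ℕ) → Instr      -- Xᵢ ← Xⱼ + Xₖ
  sub   : (i j k : ℕ) → Instr      -- Xᵢ ← Xⱼ ∸ Xₖ
  load  : (i j : ℕ) → Instr        -- Xᵢ ← X at address Xⱼ
  store : (i j : ℕ) → Instr        -- X at address Xᵢ ← Xⱼ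
  jpos  : (i l : ℕ) → Instr        -- go to instruction l if Xᵢ > 0
  read  : (i : ℕ) → Instr          -- Xᵢ ← next input (0 if there is none)
  print : (i : ℕ) → Instr          -- output Xᵢ
  halt  : Instr

Program : Set
Program = List Instr

record Config : Set where
  constructor ⟨_,_,_,_⟩
  field
    pc     : ℕ
    mem    : ℕ → ℕ
    input  : List ℕ
    output : List ℕ

fetch : Program → ℕ → Instr
fetch []      _       = halt
fetch (i ∷ P) zero    = i
fetch (i ∷ P) (suc l) = fetch P l

_[_↦_] : (ℕ → ℕ) → ℕ → ℕ → (ℕ → ℕ)
(m [ a ↦ x ]) b with a ≡ᵇ b
... | true  = x
... | false = m b

jump : (test next target : ℕ) → ℕ
jump zero    next target = next
jump (suc _) next target = target

execute : Instr → Config → Maybe Config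
execute (const i c) ⟨ p , m , is , os ⟩ = just ⟨ suc p , m [ i ↦ c ] , is , os ⟩
execute (add i j k) ⟨ p , m , is , os ⟩ = just ⟨ suc p , m [ i ↦ m j + m k ] , is , os ⟩
execute (sub i j k) ⟨ p , m , is , os ⟩ = just ⟨ suc p , m [ i ↦ m j ∸ m k ] , is , os ⟩
execute (load i j)  ⟨ p , m , is , os ⟩ = just ⟨ suc p , m [ i ↦ m (m j) ] , is , os ⟩
execute (store i j) ⟨ p , m , is , os ⟩ = just ⟨ suc p , m [ m i ↦ m j ] , is , os ⟩
execute (jpos i l)  ⟨ p , m , is , os ⟩ = just ⟨ jump (m i) (suc p) l , m , is , os ⟩
execute (read i)    ⟨ p , m , [] , os ⟩ = just ⟨ suc p , m [ i ↦ 0 ] , [] , os ⟩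
execute (read i)    ⟨ p , m , x ∷ is , os ⟩ = just ⟨ suc p , m [ i ↦ x ] , is , os ⟩
execute (print i)   ⟨ p , m , is , os ⟩ = just ⟨ suc p , m , is , os ∷ʳ m i ⟩
execute halt        _ = nothing

step : Program → Config → Maybe Config
step P c = execute (fetch P (Config.pc c)) c

data HaltsIn (P : Program) : ℕ → Config → Config → Set where
  stop : ∀ {c} → step P c ≡ nothing → HaltsIn P 0 c c
  next : ∀ {t c c′ d} → step P c ≡ just c′ → HaltsIn P t c′ d →
         HaltsIn P (suc t) c d

initial : List ℕ → Config
initial xs = ⟨ 0 , (λ _ → 0) , xs , [] ⟩

Computes : Program → (time : ℕ) → (input output : List ℕ) → Set
Computes P time xs ys =
  ∃[ t ] ∃[ c ] t ≤ time × HaltsIn P t (initial xs) c × Config.output c ≡ ys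

------------------------------------------------------------------------
-- Encodings of inputs and outputs

encodeSubset : ∀ {n} → Subset n → List ℕ
encodeSubset S = List.map bit (Vec.toList S)
  where
  bit : Bool → ℕ
  bit true  = 1
  bit false = 0

encodeGraph : ∀ {n} → BipartiteGraph n → List ℕ
encodeGraph {n} G =
  n ∷ encodeSubset B ++ List.concatMap (λ v → encodeSubset (N v)) (List.allFin n)
  where open BipartiteGraph G

labelCode : Label → ℕ
labelCode parallel = 1
labelCode series   = 2
labelCode k+s      = 3
labelCode prime    = 4

-- Postfix notation; every node takes two numbers.
postfix : ∀ {n} → Tree n → List ℕ
postfixForest : ∀ {n} → List (Tree n) → List ℕ

postfix (leaf v)    = 0 ∷ toℕ v ∷ []
postfix (node ℓ Ts) = postfixForest Ts ++ labelCode ℓ ∷ length Ts ∷ []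

postfixForest []       = []
postfixForest (T ∷ Ts) = postfix T ++ postfixForest Ts

encodeTree : ∀ {n} → Tree n → List ℕ
encodeTree T = length (postfix T) ∷ postfix T

encodePair : ℕ × ℕ → List ℕ
encodePair (b , w) = b ∷ w ∷ []

{-# OPTIONS --safe #-}

-- For a set S of vertices and every b, let f(b) be the largest weight of a biclique
-- of G[S] with exactly b black vertices, and g(b) the same for the bicliques
-- without white vertices.  Here a vertex v weighs 2^(n-1-v), plus 2^n if it is white:
-- the weight is additive on disjoint unions, its quotient by 2^n counts the white
-- vertices, and its remainder encodes the whole biclique, so that unit-cost addition
-- makes the values carry their witnesses.
--
-- In each of the four decompositions the black vertices of a part are either all
-- adjacent or all nonadjacent to the white vertices of another part, which can be
-- tested on one representative of each.  Once the set X of the parts contributing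
-- black vertices is fixed, part i may contribute white vertices just when they are
-- adjacent to the black vertices of all j ≠ i in X, and the choices in the parts are
-- then independent: f is the maximum over X of the max-plus convolutions of the
-- values f or g of the parts.  Parallel, Series and K+S nodes are split into nodes
-- with two children; a Prime node has at most k children and hence 2^k sets X.
-- Convolving blocks of S and S′ takes time O(|S||S′|), and these products sum up to
-- O(n²) over the tree.

module Submission where

open import Defs
open import Data.Bool using (Bool; true; false; if_then_else_; _∧_; _∨_; T; not)
open import Data.Bool.Properties using (T-∧)
open import Data.Empty using (⊥-elim)
open import Data.Fin using (Fin; zero; suc; toℕ)
open import Data.Fin.Properties using (toℕ<n)
open import Data.Fin.Subset using (Subset; _∉_; _⊆_; _∪_; _∩_; ⊤; ⁅_⁆; ⋃; ∣_∣; Nonempty; Empty)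
  renaming (_∈_ to _∈ₛ_; ⊥ to ∅)
open import Data.Fin.Subset.Properties
open import Data.List using (List; []; _∷_; _++_; _∷ʳ_; _ʳ++_; length; concatMap; map; drop; take; allFin; tabulate)
open import Data.List.Membership.Propositional using (_∈_)
open import Data.List.Membership.Propositional.Properties using (∈-++⁺ˡ; ∈-++⁺ʳ; ∈-++⁻)
open import Data.List.Properties using (length-++; ++-assoc; ++-identityʳ; length-map; length-ʳ++; concatMap-++)
open import Data.List.Relation.Binary.Pointwise using (Pointwise; []; _∷_; Pointwise-length)
open import Data.List.Relation.Unary.All as All using (All; []; _∷_)
open import Data.List.Relation.Unary.All.Properties using (++⁻)
open import Data.List.Relation.Unary.AllPairs using (AllPairs; []; _∷_)
open import Data.List.Relation.Unary.Any using (here; there)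
open import Data.List.Relation.Unary.Unique.Propositional using (Unique)
open import Data.List.Relation.Unary.Unique.Propositional.Properties using (++⁺)
open import Data.Maybe using (just; nothing)
open import Data.Nat using (ℕ; zero; suc; _+_; _*_; _∸_; _^_; _≤_; _<_; _≡ᵇ_; _<ᵇ_; z≤n; s≤s)
open import Data.Nat.DivMod using (_%_; [m+kn]%n≡m%n; m<n⇒m%n≡m)
open import Data.Nat.ListAction using (sum)
open import Data.Nat.Properties hiding (_≟_)
import Data.Nat.Properties as ℕ
open import Data.Nat.Solver using (module +-*-Solver)
open import Data.Product using (_×_; _,_; proj₁; proj₂; ∃-syntax)
open import Data.Sum using (_⊎_; inj₁; inj₂; [_,_]′)
open import Data.Unit using (tt)
open import Data.Vec using ([]; _∷_; lookup; here; there; toList)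
open import Data.Vec.Properties using (lookup⇒[]=; []=⇒lookup)
open import Function.Base using (_∘_; id; case_of_)
open import Function.Bundles using (_⇔_; Equivalence; mk⇔)
open import Relation.Binary.PropositionalEquality hiding ([_])
open import Relation.Nullary using (yes; no)

-- A structured language with arrays and bounded loops

-- The machine can only add, subtract, copy through addresses and test for positivity, so the
-- algorithm is written in a small structured language whose compiler is verified once; the effect
-- of a program and a bound on its running time are then functions of its source.
--
-- The set X only permits black vertices, and white vertices are restricted as though every part in
-- X used this permission. So every X yields bicliques only, and a given biclique is found at the X
-- of those parts in which it really has black vertices.
--
-- The quadratic bound rests on the square of a sum of cardinalities: it consists of the squares,
-- which pay for the subtrees, and of twice the mixed products, which pay for the node. A block has
-- one cell more than black vertices, so convolving costs (a + 1)(b + 1), which may exceed ab. The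
-- excess is absorbed because a node has at least two parts and all are nonempty: then the sum of
-- the cardinalities is at most one more than the sum of the mixed products.

infixl 7 _at_
infixl 6 _⊞_ _⊟_
infixr 4 _⨟_

data Expr : Set where
  lit     : ℕ → Expr
  var     : ℕ → Expr
  _⊞_ _⊟_ : Expr → Expr → Expr
  _at_    : ℕ → Expr → Expr

-- bind and loop introduce a read-only variable; the scoping condition below
-- forces its name to be the number of enclosing binders, so that no variable
-- is ever shadowed and the meaning of a command may treat the environment as
-- a parameter.
data Cmd : Set where
  skip   : Cmd
  _⨟_    : Cmd → Cmd → Cmd
  assign : (a : ℕ) (i e : Expr) → Cmd
  get    : (a : ℕ) (i : Expr) → Cmd
  put    : (e : Expr) → Cmd
  when   : (e : Expr) (c₁ c₀ : Cmd) → Cmd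
  bind   : (x : ℕ) (e : Expr) → Cmd → Cmd
  loop   : (x : ℕ) (e : Expr) → Cmd → Cmd

Env Arrays : Set
Env    = ℕ → ℕ
Arrays = ℕ → ℕ → ℕ

record State : Set where
  no-eta-equality
  constructor state
  field
    arr : Arrays
    inp : List ℕ
    out : List ℕ
open State public

_[_·_↦_] : Arrays → ℕ → ℕ → ℕ → Arrays
(m [ a · i ↦ x ]) b = if a ≡ᵇ b then m b [ i ↦ x ] else m b

hd : List ℕ → ℕ
hd []      = 0
hd (x ∷ _) = x

tl : List ℕ → List ℕ
tl []       = []
tl (_ ∷ xs) = xs

eval : Expr → Env → Arrays → ℕ
eval (lit c)  ρ m = c
eval (var x)  ρ m = ρ x
eval (e ⊞ f)  ρ m = eval e ρ m + eval f ρ m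
eval (e ⊟ f)  ρ m = eval e ρ m ∸ eval f ρ m
eval (a at e) ρ m = m a (eval e ρ m)

branch : {A : Set} → ℕ → A → A → A
branch zero    x₁ x₀ = x₀
branch (suc _) x₁ x₀ = x₁

iter : ℕ → (ℕ → State → State) → State → State
iter zero    f s = s
iter (suc n) f s = f n (iter n f s)

run : Cmd → Env → State → State
run skip           ρ s = s
run (c ⨟ d)        ρ s = run d ρ (run c ρ s)
run (assign a i e) ρ s = state (arr s [ a · eval i ρ (arr s) ↦ eval e ρ (arr s) ]) (inp s) (out s)
run (get a i)      ρ s = state (arr s [ a · eval i ρ (arr s) ↦ hd (inp s) ]) (tl (inp s)) (out s)
run (put e)        ρ s = state (arr s) (inp s) (out s ∷ʳ eval e ρ (arr s))
run (when e c d)   ρ s = branch (eval e ρ (arr s)) (run c ρ s) (run d ρ s)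
run (bind x e c)   ρ s = run c (ρ [ x ↦ eval e ρ (arr s) ]) s
run (loop x e c)   ρ s = iter (eval e ρ (arr s)) (λ i → run c (ρ [ x ↦ i ])) s

-- Code for expressions has no jumps, so this is at once its length and the number of steps it
-- takes. For commands the two are separated into `codeSize` and `cost`.
costE : Expr → ℕ
costE (lit c)  = 1
costE (var x)  = 2
costE (e ⊞ f)  = costE e + costE f + 1
costE (e ⊟ f)  = costE e + costE f + 1
costE (a at e) = costE e + 7

iterCost : ℕ → (ℕ → State → ℕ) → (ℕ → State → State) → State → ℕ
iterCost zero    g f s = 0
iterCost (suc n) g f s = iterCost n g f s + (g n (iter n f s) + 4)

-- An upper bound: both branches of `when` are charged the three extra steps of the one that has to
-- jump over the other. A loop pays five steps of preparation and its last test, and three updates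
-- and a test per round.
cost : Cmd → Env → State → ℕ
cost skip           ρ s = 0
cost (c ⨟ d)        ρ s = cost c ρ s + cost d ρ (run c ρ s)
cost (assign a i e) ρ s = costE i + costE e + 7
cost (get a i)      ρ s = costE i + 8
cost (put e)        ρ s = costE e + 1
cost (when e c d)   ρ s = costE e + 3 + branch (eval e ρ (arr s)) (cost c ρ s) (cost d ρ s)
cost (bind x e c)   ρ s = costE e + 2 + cost c (ρ [ x ↦ eval e ρ (arr s) ]) s
cost (loop x e c)   ρ s = costE e + 6 +
  iterCost (eval e ρ (arr s)) (λ i → cost c (ρ [ x ↦ i ])) (λ i → run c (ρ [ x ↦ i ])) s

scopedE : ℕ → Expr → Bool
scopedE d (lit c)  = true
scopedE d (var x)  = x <ᵇ d
scopedE d (e ⊞ f)  = scopedE d e ∧ scopedE d f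
scopedE d (e ⊟ f)  = scopedE d e ∧ scopedE d f
scopedE d (a at e) = (a <ᵇ 13) ∧ scopedE d e

scoped : ℕ → Cmd → Bool
scoped d skip           = true
scoped d (c ⨟ c′)       = scoped d c ∧ scoped d c′
scoped d (assign a i e) = (a <ᵇ 13) ∧ scopedE d i ∧ scopedE d e
scoped d (get a i)      = (a <ᵇ 13) ∧ scopedE d i
scoped d (put e)        = scopedE d e
scoped d (when e c c′)  = scopedE d e ∧ scoped d c ∧ scoped d c′
scoped d (bind x e c)   = (x ≡ᵇ d) ∧ scopedE d e ∧ scoped (suc d) c
scoped d (loop x e c)   = (x ≡ᵇ d) ∧ scopedE d e ∧ scoped (suc d) c

-- Compilation.  The memory is divided into sixteen interleaved regions:
-- temporaries, variables, loop counters and thirteen arrays.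

dbl : ℕ → ℕ
dbl i = i + i

opaque
  -- Interleaving keeps every region unbounded, so no array size is fixed in the program. The number
  -- of regions is a power of two because an address is then computed by doublings alone.
  addr : ℕ → ℕ → ℕ
  addr r i = dbl (dbl (dbl (dbl i))) + r

tmp loc cnt : ℕ → ℕ
tmp = addr 0
loc = addr 1
cnt = addr 2

cell : ℕ → ℕ → ℕ
cell a = addr (3 + a)

index : (a t : ℕ) → Program
index a t =
  add (tmp t) (tmp t) (tmp t) ∷ add (tmp t) (tmp t) (tmp t) ∷
  add (tmp t) (tmp t) (tmp t) ∷ add (tmp t) (tmp t) (tmp t) ∷
  const (tmp (suc t)) (3 + a) ∷ add (tmp t) (tmp t) (tmp (suc t)) ∷ []

-- Temporaries form a stack: the result is left in number t, and only numbers from t on are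
-- overwritten. Copying a register is done by adding it to zero.
compileE : Expr → ℕ → Program
compileE (lit c)  t = const (tmp t) c ∷ []
compileE (var x)  t = const (tmp t) 0 ∷ add (tmp t) (tmp t) (loc x) ∷ []
compileE (e ⊞ f)  t = compileE e t ++ compileE f (suc t) ++ add (tmp t) (tmp t) (tmp (suc t)) ∷ []
compileE (e ⊟ f)  t = compileE e t ++ compileE f (suc t) ++ sub (tmp t) (tmp t) (tmp (suc t)) ∷ []
compileE (a at e) t = compileE e t ++ index a t ++ load (tmp t) (tmp t) ∷ []

codeSize : Cmd → ℕ
codeSize skip           = 0
codeSize (c ⨟ d)        = codeSize c + codeSize d
codeSize (assign a i e) = costE i + (6 + (costE e + 1))
codeSize (get a i)      = costE i + (6 + 2)
codeSize (put e)        = costE e + 1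
codeSize (when e c d)   = costE e + (1 + (codeSize d + (2 + codeSize c)))
codeSize (bind x e c)   = costE e + (2 + codeSize c)
codeSize (loop x e c)   = costE e + (5 + (codeSize c + (3 + 1)))

-- The second argument is the address of the first instruction.
compile : Cmd → ℕ → Program
compile skip           o = []
compile (c ⨟ d)        o = compile c o ++ compile d (o + codeSize c)
compile (assign a i e) o = compileE i 0 ++ index a 0 ++ compileE e 1 ++ store (tmp 0) (tmp 1) ∷ []
compile (get a i)      o = compileE i 0 ++ index a 0 ++ read (tmp 1) ∷ store (tmp 0) (tmp 1) ∷ []
compile (put e)        o = compileE e 0 ++ print (tmp 0) ∷ []
compile (when e c d)   o =
  compileE e 0 ++ (jpos (tmp 0) (o + costE e + 1 + codeSize d + 2) ∷ []) ++
  compile d (o + costE e + 1) ++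
  -- A jump on a register just set to 1 serves as an unconditional jump.
  (const (tmp 0) 1 ∷ jpos (tmp 0) (o + costE e + 1 + codeSize d + 2 + codeSize c) ∷ []) ++
  compile c (o + costE e + 1 + codeSize d + 2)
compile (bind x e c)   o =
  compileE e 0 ++ (const (loc x) 0 ∷ add (loc x) (loc x) (tmp 0) ∷ []) ++
  compile c (o + costE e + 2)
compile (loop x e c)   o =
  compileE e 0 ++
  -- `cnt x` counts down because `jpos` can only test for positivity, while `loc x` counts up for
  -- the body. The test stands at the end and is entered first, so that a loop of zero rounds skips
  -- its body.
  (const (cnt x) 0 ∷ add (cnt x) (cnt x) (tmp 0) ∷ const (loc x) 0 ∷
   const (tmp 0) 1 ∷ jpos (tmp 0) (o + costE e + 5 + codeSize c + 3) ∷ []) ++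
  compile c (o + costE e + 5) ++
  (const (tmp 0) 1 ∷ add (loc x) (loc x) (tmp 0) ∷ sub (cnt x) (cnt x) (tmp 0) ∷ []) ++
  (jpos (cnt x) (o + costE e + 5) ∷ [])

length-compileE : ∀ e t → length (compileE e t) ≡ costE e
length-compileE (lit c)  t = refl
length-compileE (var x)  t = refl
length-compileE (e ⊞ f)  t
  rewrite length-++ (compileE e t) {compileE f (suc t) ++ add (tmp t) (tmp t) (tmp (suc t)) ∷ []}
        | length-++ (compileE f (suc t)) {add (tmp t) (tmp t) (tmp (suc t)) ∷ []}
        | length-compileE e t | length-compileE f (suc t) = sym (+-assoc (costE e) _ 1)
length-compileE (e ⊟ f)  t
  rewrite length-++ (compileE e t) {compileE f (suc t) ++ sub (tmp t) (tmp t) (tmp (suc t)) ∷ []}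
        | length-++ (compileE f (suc t)) {sub (tmp t) (tmp t) (tmp (suc t)) ∷ []}
        | length-compileE e t | length-compileE f (suc t) = sym (+-assoc (costE e) _ 1)
length-compileE (a at e) t
  rewrite length-++ (compileE e t) {index a t ++ load (tmp t) (tmp t) ∷ []}
        | length-compileE e t = refl

length-append : ∀ (xs : Program) {ys m n} → length xs ≡ m → length ys ≡ n → length (xs ++ ys) ≡ m + n
length-append xs refl refl = length-++ xs

length-compile : ∀ c o → length (compile c o) ≡ codeSize c
length-compile skip           o = refl
length-compile (c ⨟ d)        o =
  length-append (compile c o) (length-compile c o) (length-compile d _)
length-compile (assign a i e) o =
  length-append (compileE i 0) (length-compileE i 0) (cong (6 +_)
    (length-append (compileE e 1) (length-compileE e 1) refl))
length-compile (get a i)      o = length-append (compileE i 0) (length-compileE i 0) refl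
length-compile (put e)        o = length-append (compileE e 0) (length-compileE e 0) refl
length-compile (when e c d)   o =
  length-append (compileE e 0) (length-compileE e 0) (cong suc
    (length-append (compile d _) (length-compile d _) (cong (2 +_) (length-compile c _))))
length-compile (bind x e c)   o =
  length-append (compileE e 0) (length-compileE e 0) (cong (2 +_) (length-compile c _))
length-compile (loop x e c)   o =
  length-append (compileE e 0) (length-compileE e 0) (cong (5 +_)
    (length-append (compile c _) (length-compile c _) refl))

-- Execution of machine code

data At (P : Program) : ℕ → Program → Set where
  []  : ∀ {o} → At P o []
  _∷_ : ∀ {o i is} → fetch P o ≡ i → At P (suc o) is → At P o (i ∷ is)

move : ∀ {P o o′ is} → o ≡ o′ → At P o is → At P o′ is
move refl as = as

move-fetch : ∀ {P o o′ i} → o ≡ o′ → fetch P o ≡ i → fetch P o′ ≡ i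
move-fetch refl p = p

at-++ : ∀ {P o} xs {ys n} → length xs ≡ n → At P o (xs ++ ys) → At P o xs × At P (o + n) ys
at-++ {P} {o} [] {ys} refl as = [] , move (sym (+-identityʳ o)) as
at-++ {P} {o} (x ∷ xs) {ys} refl (p ∷ as) with at-++ xs refl as
... | q , r = p ∷ q , move (sym (+-suc o (length xs))) r

-- Generalized over a preceding program Q, to which the induction moves the instructions of P one by
-- one.
at-whole : ∀ Q P → At (Q ++ P) (length Q) P
at-whole Q []      = []
at-whole Q (i ∷ P) =
  fetched Q ∷ subst₂ (λ R o → At R o P) (++-assoc Q (i ∷ []) P)
    (trans (length-++ Q) (+-comm (length Q) 1)) (at-whole (Q ++ i ∷ []) P)
  where
  fetched : ∀ Q → fetch (Q ++ i ∷ P) (length Q) ≡ i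
  fetched []      = refl
  fetched (j ∷ Q) = fetched Q

-- Compiled code contains no `halt`; it stops by running past its last instruction.
fetch-end : ∀ P → fetch P (length P) ≡ halt
fetch-end []      = refl
fetch-end (i ∷ P) = fetch-end P

data Steps (P : Program) : ℕ → Config → Config → Set where
  done : ∀ {c} → Steps P 0 c c
  more : ∀ {t c c′ d} → step P c ≡ just c′ → Steps P t c′ d → Steps P (suc t) c d

_▷_ : ∀ {P t u c d e} → Steps P t c d → Steps P u d e → Steps P (t + u) c e
done     ▷ r = r
more p q ▷ r = more p (q ▷ r)

steps-halt : ∀ {P t c d} → Steps P t c d → step P d ≡ nothing → HaltsIn P t c d
steps-halt done       h = stop h
steps-halt (more p q) h = next p (steps-halt q h)

Mem : Set
Mem = ℕ → ℕ

-- Reach P t c d: from c, the program P gets to d in at most t steps.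
Reach : Program → ℕ → Config → Config → Set
Reach P t c d = ∃[ u ] u ≤ t × Steps P u c d

infixr 5 _⟫_
_⟫_ : ∀ {P t u c d e} → Reach P t c d → Reach P u d e → Reach P (t + u) c e
(_ , p , q) ⟫ (_ , r , s) = _ , +-mono-≤ p r , q ▷ s

within : ∀ {P t u c d} → t ≤ u → Reach P t c d → Reach P u c d
within t≤u (_ , p , q) = _ , ≤-trans p t≤u , q

at-pc : ∀ {P t c p q m is os} → p ≡ q → Reach P t c ⟨ p , m , is , os ⟩ → Reach P t c ⟨ q , m , is , os ⟩
at-pc refl r = r

one : ∀ {P i o m is os c} → fetch P o ≡ i → execute i ⟨ o , m , is , os ⟩ ≡ just c →
      Reach P 1 ⟨ o , m , is , os ⟩ c
one {m = m} {is} {os} refl q = 1 , ≤-refl , more q done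

↦-same : ∀ (m : Mem) a {x} → (m [ a ↦ x ]) a ≡ x
↦-same m a with a ≡ᵇ a in eq
... | true  = refl
... | false = ⊥-elim (subst T eq (≡⇒≡ᵇ a a refl))

↦-other : ∀ (m : Mem) {a b x} → a ≢ b → (m [ a ↦ x ]) b ≡ m b
↦-other m {a} {b} a≢b with a ≡ᵇ b in eq
... | true  = ⊥-elim (a≢b (≡ᵇ⇒≡ a b (subst T (sym eq) tt)))
... | false = refl

dbl-injective : ∀ {i j} → dbl i ≡ dbl j → i ≡ j
dbl-injective {zero}  {zero}  _ = refl
dbl-injective {suc i} {suc j} p =
  cong suc (dbl-injective (suc-injective (trans (sym (+-suc i i)) (trans (suc-injective p) (+-suc j j)))))

opaque
  unfolding addr

  addr-mod : ∀ {r} i → r < 16 → addr r i % 16 ≡ r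
  addr-mod {r} i r<16 = trans (cong (_% 16) (solve 2 (λ i r → (((i :+ i) :+ (i :+ i)) :+ ((i :+ i) :+ (i :+ i)) :+
      (((i :+ i) :+ (i :+ i)) :+ ((i :+ i) :+ (i :+ i))) :+ r) := r :+ i :* con 16) refl i r))
    (trans ([m+kn]%n≡m%n r i 16) (m<n⇒m%n≡m r<16))
    where open +-*-Solver

  addr-injective : ∀ {r i j} → addr r i ≡ addr r j → i ≡ j
  addr-injective {r} p =
    dbl-injective (dbl-injective (dbl-injective (dbl-injective (+-cancelʳ-≡ r _ _ p))))

  addr-≡ : ∀ r i → dbl (dbl (dbl (dbl i))) + r ≡ addr r i
  addr-≡ r i = refl

regions-disjoint : ∀ {r r′ i j} → r < 16 → r′ < 16 → r ≢ r′ → addr r i ≢ addr r′ j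
regions-disjoint {i = i} {j} p q r≢r′ eq =
  r≢r′ (trans (sym (addr-mod i p)) (trans (cong (_% 16) eq) (addr-mod j q)))

-- Correctness of the compiler

lt : ∀ {m n} → T (m <ᵇ n) → m < n
lt {m} {n} = <ᵇ⇒< m n

∧⁻ : ∀ {x y} → T (x ∧ y) → T x × T y
∧⁻ = Equivalence.to T-∧

-- The contract of compiled expressions: variables, loop counters, arrays and pending intermediate
-- results all survive.
OffTemps : ℕ → Mem → Mem → Set
OffTemps t m m′ = ∀ b → (∀ u → t ≤ u → tmp u ≢ b) → m′ b ≡ m b

off-trans : ∀ {t m m′ m″} → OffTemps t m m′ → OffTemps t m′ m″ → OffTemps t m m″
off-trans p q b r = trans (q b r) (p b r)

off-suc : ∀ {t m m′} → OffTemps (suc t) m m′ → OffTemps t m m′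
off-suc p b r = p b (λ u t<u → r u (<⇒≤ t<u))

off-write : ∀ {t} m {x} u → t ≤ u → OffTemps t m (m [ tmp u ↦ x ])
off-write m u t≤u b r = ↦-other m (r u t≤u)

tmp≢ : ∀ {t u} → t < u → tmp t ≢ tmp u
tmp≢ t<u p = <-irrefl (addr-injective {0} p) t<u

off-below : ∀ {t m m′} → OffTemps (suc t) m m′ → m′ (tmp t) ≡ m (tmp t)
off-below {t} p = p (tmp t) (λ u t<u q → tmp≢ t<u (sym q))

record Represents (d : ℕ) (ρ : Env) (f : Arrays) (m : Mem) : Set where
  field
    vars  : ∀ {x} → x < d → m (loc x) ≡ ρ x
    cells : ∀ {a} i → a < 13 → m (cell a i) ≡ f a i
open Represents

tmp≢loc : ∀ {u x} → tmp u ≢ loc x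
tmp≢loc = regions-disjoint (lt tt) (lt tt) λ ()

tmp≢cnt : ∀ {u x} → tmp u ≢ cnt x
tmp≢cnt = regions-disjoint (lt tt) (lt tt) λ ()

loc≢cnt : ∀ {u x} → loc u ≢ cnt x
loc≢cnt = regions-disjoint (lt tt) (lt tt) λ ()

3+-< : ∀ {a} → a < 13 → 3 + a < 16
3+-< p = s≤s (s≤s (s≤s p))

tmp≢cell : ∀ {a u x} → a < 13 → tmp u ≢ cell a x
tmp≢cell p = regions-disjoint (lt tt) (3+-< p) λ ()

loc≢cell : ∀ {a u x} → a < 13 → loc u ≢ cell a x
loc≢cell p = regions-disjoint (lt tt) (3+-< p) λ ()

cnt≢cell : ∀ {a u x} → a < 13 → cnt u ≢ cell a x
cnt≢cell p = regions-disjoint (lt tt) (3+-< p) λ ()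

rep-off : ∀ {d ρ f m m′ t} → OffTemps t m m′ → Represents d ρ f m → Represents d ρ f m′
rep-off p r .vars x<d   = trans (p _ λ _ _ → tmp≢loc) (vars r x<d)
rep-off p r .cells i a< = trans (p _ λ _ _ → tmp≢cell a<) (cells r i a<)

record Evaluates (P : Program) (o n : ℕ) (is os : List ℕ) (t v : ℕ) (m : Mem) : Set where
  constructor evaluates
  field
    mem′   : Mem
    reach  : Reach P n ⟨ o , m , is , os ⟩ ⟨ o + n , mem′ , is , os ⟩
    value  : mem′ (tmp t) ≡ v
    others : OffTemps t m mem′

+1 : ∀ o → suc o ≡ o + 1
+1 o = +-comm 1 o

advance : ∀ o m n → suc (o + m + n) ≡ o + (m + n + 1)
advance o m n = trans (cong suc (+-assoc o m n)) (trans (sym (+-suc o _)) (cong (o +_) (+1 _)))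

index-correct : ∀ a {P o is os} t m → At P o (index a t) →
  Evaluates P o 6 is os t (cell a (m (tmp t))) m
index-correct a {P} {o} {is} {os} t m (p₁ ∷ p₂ ∷ p₃ ∷ p₄ ∷ p₅ ∷ p₆ ∷ []) = evaluates m₆
  (at-pc (+-comm 6 o) (one p₁ refl ⟫ one p₂ refl ⟫ one p₃ refl ⟫ one p₄ refl ⟫ one p₅ refl ⟫ one p₆ refl))
  (trans (↦-same m₅ (tmp t)) (trans (cong₂ _+_
     (trans (↦-other m₄ (λ p → tmp≢ (n<1+n t) (sym p))) (trans (doubled m₃)
       (cong dbl (trans (doubled m₂) (cong dbl (trans (doubled m₁) (cong dbl (doubled m))))))))
     (↦-same m₄ (tmp (suc t)))) (addr-≡ (3 + a) _)))
  λ b r → trans (↦-other m₅ (r t ≤-refl)) (trans (↦-other m₄ (r _ (n≤1+n t)))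
    (trans (↦-other m₃ (r t ≤-refl)) (trans (↦-other m₂ (r t ≤-refl))
      (trans (↦-other m₁ (r t ≤-refl)) (↦-other m (r t ≤-refl))))))
  where
  twice : Mem → Mem
  twice m = m [ tmp t ↦ m (tmp t) + m (tmp t) ]
  m₁ = twice m
  m₂ = twice m₁
  m₃ = twice m₂
  m₄ = twice m₃
  m₅ = m₄ [ tmp (suc t) ↦ 3 + a ]
  m₆ = m₅ [ tmp t ↦ m₅ (tmp t) + m₅ (tmp (suc t)) ]
  doubled : ∀ m → twice m (tmp t) ≡ dbl (m (tmp t))
  doubled m = ↦-same m (tmp t)

compileE-correct : ∀ e {P o is os d ρ f} t m → T (scopedE d e) → Represents d ρ f m →
  At P o (compileE e t) → Evaluates P o (costE e) is os t (eval e ρ f) m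

-- The left value waits in temporary t while the right one is computed from t + 1 on. The
-- instruction is a parameter so that addition and subtraction share the argument.
binary-correct : ∀ e g {P o is os d ρ f} (ins : ℕ → ℕ → ℕ → Instr) (_⊕_ : ℕ → ℕ → ℕ) →
  (∀ {i j k o m is os} → execute (ins i j k) ⟨ o , m , is , os ⟩ ≡ just ⟨ suc o , m [ i ↦ m j ⊕ m k ] , is , os ⟩) →
  ∀ t m → T (scopedE d e ∧ scopedE d g) → Represents d ρ f m →
  At P o (compileE e t ++ compileE g (suc t) ++ ins (tmp t) (tmp t) (tmp (suc t)) ∷ []) →
  Evaluates P o (costE e + costE g + 1) is os t (eval e ρ f ⊕ eval g ρ f) m
binary-correct e g {P} {o} ins _⊕_ ex t m sc r as
  with at-++ (compileE e t) (length-compileE e t) as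
... | a₁ , as′ with at-++ (compileE g (suc t)) (length-compileE g (suc t)) as′
... | a₂ , (p ∷ [])
  with compileE-correct e t m (proj₁ (∧⁻ sc)) r a₁
... | evaluates m₁ r₁ v₁ o₁
  with compileE-correct g (suc t) m₁ (proj₂ (∧⁻ sc)) (rep-off o₁ r) a₂
... | evaluates m₂ r₂ v₂ o₂ = evaluates (m₂ [ tmp t ↦ m₂ (tmp t) ⊕ m₂ (tmp (suc t)) ])
  (at-pc (advance o (costE e) (costE g))
    (within (≤-reflexive (sym (+-assoc (costE e) _ 1))) (r₁ ⟫ r₂ ⟫ one p ex)))
  (trans (↦-same m₂ (tmp t)) (cong₂ _⊕_ (trans (off-below o₂) v₁) v₂))
  (off-trans (off-trans o₁ (off-suc o₂)) (off-write m₂ t ≤-refl))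

compileE-correct (lit c) {o = o} t m sc r (p ∷ []) = evaluates (m [ tmp t ↦ c ])
  (at-pc (+1 o) (one p refl)) (↦-same m (tmp t)) (off-write m t ≤-refl)
compileE-correct (var x) {o = o} t m sc r (p ∷ q ∷ []) = evaluates (m₁ [ tmp t ↦ m₁ (tmp t) + m₁ (loc x) ])
  (at-pc (+-comm 2 o) (one p refl ⟫ one q refl))
  (trans (↦-same m₁ (tmp t)) (cong₂ _+_ (↦-same m (tmp t)) (trans (↦-other m tmp≢loc) (vars r (lt sc)))))
  (off-trans (off-write m t ≤-refl) (off-write m₁ t ≤-refl))
  where m₁ = m [ tmp t ↦ 0 ]
compileE-correct (e ⊞ f) t m sc r as = binary-correct e f add _+_ refl t m sc r as
compileE-correct (e ⊟ f) t m sc r as = binary-correct e f sub _∸_ refl t m sc r as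
compileE-correct (a at e) {P} {o} {f = f} t m sc r as
  with at-++ (compileE e t) (length-compileE e t) as
... | a₁ , as′ with at-++ (index a t) refl as′
... | a₂ , (p ∷ [])
  with compileE-correct e t m (proj₂ (∧⁻ {a <ᵇ 13} sc)) r a₁
... | evaluates m₁ r₁ v₁ o₁ with index-correct a t m₁ a₂
... | evaluates m₂ r₂ v₂ o₂ = evaluates (m₂ [ tmp t ↦ m₂ (m₂ (tmp t)) ])
  (at-pc (trans (+1 _) (trans (+-assoc (o + costE e) 6 1) (+-assoc o _ _))) (r₁ ⟫ r₂ ⟫ one p refl))
  (trans (↦-same m₂ (tmp t)) (trans (cong m₂ (trans v₂ (cong (cell a) v₁)))
    (cells (rep-off o₂ (rep-off o₁ r)) _ (lt (proj₁ (∧⁻ {a <ᵇ 13} sc))))))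
  (off-trans (off-trans o₁ o₂) (off-write m₂ t ≤-refl))

-- The field `counters` makes loops nest: a body is compiled one level deeper than its loop and
-- therefore preserves the counter of that loop.
record Runs (P : Program) (o n t d : ℕ) (ρ : Env) (s s′ : State) (m : Mem) : Set where
  constructor runs
  field
    mem″       : Mem
    reaches    : Reach P t ⟨ o , m , inp s , out s ⟩ ⟨ o + n , mem″ , inp s′ , out s′ ⟩
    represents : Represents d ρ (arr s′) mem″
    counters   : ∀ {x} → x < d → mem″ (cnt x) ≡ m (cnt x)

rep-cell : ∀ {d ρ f m a i x} → a < 13 → Represents d ρ f m →
           Represents d ρ (f [ a · i ↦ x ]) (m [ cell a i ↦ x ])
rep-cell {m = m} a< r .vars x<d = trans (↦-other m (λ p → loc≢cell a< (sym p))) (vars r x<d)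
rep-cell {f = f} {m} {a} {i} {x} a< r .cells {b} j b< with a ≡ᵇ b in eq
... | false = trans (↦-other m (regions-disjoint (3+-< a<) (3+-< b<)
                (λ p → subst T eq (≡⇒≡ᵇ a b (+-cancelˡ-≡ 3 a b p))))) (cells r j b<)
... | true with ≡ᵇ⇒≡ a b (subst T (sym eq) tt)
... | refl with i ≡ᵇ j in eq′
... | true  with ≡ᵇ⇒≡ i j (subst T (sym eq′) tt)
... | refl = ↦-same m (cell a i)
rep-cell {f = f} {m} {a} {i} {x} a< r .cells {b} j b< | true | refl | false =
  trans (↦-other m (λ p → subst T eq′ (≡⇒≡ᵇ i j (addr-injective {3 + a} p)))) (cells r j b<)

rep-extend : ∀ {d ρ f m v} → m (loc d) ≡ v → Represents d ρ f m → Represents (suc d) (ρ [ d ↦ v ]) f m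
rep-extend {d} {ρ} p r .vars {x} (s≤s x≤d) with m≤n⇒m<n∨m≡n x≤d
... | inj₁ x<d  = trans (vars r x<d) (sym (↦-other ρ (λ q → <-irrefl (sym q) x<d)))
... | inj₂ refl = trans p (sym (↦-same ρ d))
rep-extend p r .cells = cells r

rep-restrict : ∀ {d ρ f m v} → Represents (suc d) (ρ [ d ↦ v ]) f m → Represents d ρ f m
rep-restrict {d} {ρ} r .vars x<d =
  trans (vars r (m<n⇒m<1+n x<d)) (↦-other ρ (λ q → <-irrefl (sym q) x<d))
rep-restrict r .cells = cells r

rep-loc : ∀ {d ρ f m v} → Represents d ρ f m → Represents d ρ f (m [ loc d ↦ v ])
rep-loc {d} {m = m} r .vars x<d =
  trans (↦-other m (λ p → <-irrefl (sym (addr-injective {1} p)) x<d)) (vars r x<d)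
rep-loc {m = m} r .cells i a< = trans (↦-other m (loc≢cell a<)) (cells r i a<)

rep-cnt : ∀ {d ρ f m x v} → Represents d ρ f m → Represents d ρ f (m [ cnt x ↦ v ])
rep-cnt {m = m} r .vars x<d   = trans (↦-other m (λ p → loc≢cnt (sym p))) (vars r x<d)
rep-cnt {m = m} r .cells i a< = trans (↦-other m (cnt≢cell a<)) (cells r i a<)

rep-tmp : ∀ {d ρ f m u v} → Represents d ρ f m → Represents d ρ f (m [ tmp u ↦ v ])
rep-tmp {m = m} {u} = rep-off (off-write m u z≤n)

off-cnt : ∀ {t m m′ x} → OffTemps t m m′ → m′ (cnt x) ≡ m (cnt x)
off-cnt p = p _ λ _ _ → tmp≢cnt

Correct : Cmd → Set
Correct c = ∀ {P o d ρ} s m → T (scoped d c) → Represents d ρ (arr s) m → At P o (compile c o) →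
            Runs P o (codeSize c) (cost c ρ s) d ρ s (run c ρ s) m

sequence-correct : ∀ c e → Correct c → Correct e → Correct (c ⨟ e)
sequence-correct c e C E {o = o} s m sc r as
  with at-++ (compile c o) (length-compile c o) as
... | a₁ , a₂ with C s m (proj₁ (∧⁻ sc)) r a₁
... | runs m₁ r₁ p₁ q₁ with E _ m₁ (proj₂ (∧⁻ {scoped _ c} sc)) p₁ a₂
... | runs m₂ r₂ p₂ q₂ =
  runs m₂ (at-pc (+-assoc o _ _) (r₁ ⟫ r₂)) p₂ (λ x<d → trans (q₂ x<d) (q₁ x<d))

assign-correct : ∀ a i e → Correct (assign a i e)
assign-correct a i e {o = o} s m sc r as
  with ∧⁻ {a <ᵇ 13} sc
... | sa , sc′ with ∧⁻ {scopedE _ i} sc′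
... | si , se with at-++ (compileE i 0) (length-compileE i 0) as
... | a₁ , as₁ with at-++ (index a 0) refl as₁
... | a₂ , as₂ with at-++ (compileE e 1) (length-compileE e 1) as₂
... | a₃ , (p ∷ [])
  with compileE-correct i 0 m si r a₁
... | evaluates m₁ r₁ v₁ o₁ with index-correct a 0 m₁ a₂
... | evaluates m₂ r₂ v₂ o₂
  with compileE-correct e 1 m₂ se (rep-off o₂ (rep-off o₁ r)) a₃
... | evaluates m₃ r₃ v₃ o₃
  with trans (off-below o₃) (trans v₂ (cong (cell a) v₁)) | v₃
... | w | w′ = runs (m₃ [ m₃ (tmp 0) ↦ m₃ (tmp 1) ])
  (at-pc (trans (advance (o + costE i) 6 (costE e)) (+-assoc o (costE i) _))
    (within (≤-reflexive cost-≡) (r₁ ⟫ r₂ ⟫ r₃ ⟫ one p refl)))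
  (subst₂ (λ b v → Represents _ _ _ (m₃ [ b ↦ v ])) (sym w) (sym w′)
    (rep-cell (lt sa) (rep-off o₃ (rep-off o₂ (rep-off o₁ r)))))
  λ x<d → trans (trans (↦-other m₃ (λ q → cnt≢cell (lt sa) (trans (sym q) w))) (off-cnt o₃))
    (trans (off-cnt o₂) (off-cnt o₁))
  where
  cost-≡ : costE i + (6 + (costE e + 1)) ≡ costE i + costE e + 7
  cost-≡ = solve 2 (λ i e → i :+ (con 6 :+ (e :+ con 1)) := i :+ e :+ con 7) refl (costE i) (costE e)
    where open +-*-Solver

get-step : ∀ {P o i m} is {os} → fetch P o ≡ read i →
  Reach P 1 ⟨ o , m , is , os ⟩ ⟨ suc o , m [ i ↦ hd is ] , tl is , os ⟩
get-step []       p = one p refl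
get-step (x ∷ is) p = one p refl

get-correct : ∀ a i → Correct (get a i)
get-correct a i {o = o} s m sc r as
  with ∧⁻ {a <ᵇ 13} sc
... | sa , si with at-++ (compileE i 0) (length-compileE i 0) as
... | a₁ , as₁ with at-++ (index a 0) refl as₁
... | a₂ , (p ∷ q ∷ [])
  with compileE-correct i 0 m si r a₁
... | evaluates m₁ r₁ v₁ o₁ with index-correct a 0 m₁ a₂
... | evaluates m₂ r₂ v₂ o₂ = runs (m₃ [ m₃ (tmp 0) ↦ m₃ (tmp 1) ])
  (at-pc (trans (cong suc (sym (+-suc (o + costE i) 6))) (trans (sym (+-suc (o + costE i) 7)) (+-assoc o (costE i) 8)))
    (r₁ ⟫ r₂ ⟫ get-step (inp s) p ⟫ one q refl))
  (subst₂ (λ b v → Represents _ _ _ (m₃ [ b ↦ v ])) (sym w) (sym (↦-same m₂ (tmp 1)))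
    (rep-cell (lt sa) (rep-tmp (rep-off o₂ (rep-off o₁ r)))))
  λ x<d → trans (trans (↦-other m₃ (λ q → cnt≢cell (lt sa) (trans (sym q) w))) (↦-other m₂ tmp≢cnt))
    (trans (off-cnt o₂) (off-cnt o₁))
  where
  m₃ = m₂ [ tmp 1 ↦ hd (inp s) ]
  w : m₃ (tmp 0) ≡ cell a (eval i _ (arr s))
  w = trans (↦-other m₂ (λ q → tmp≢ {0} {1} (lt tt) (sym q))) (trans v₂ (cong (cell a) v₁))

put-correct : ∀ e → Correct (put e)
put-correct e {o = o} s m sc r as
  with at-++ (compileE e 0) (length-compileE e 0) as
... | a₁ , (p ∷ []) with compileE-correct e 0 m sc r a₁
... | evaluates m₁ r₁ v₁ o₁ =
  runs m₁ (subst (λ v → Reach _ _ _ ⟨ _ , m₁ , inp s , out s ∷ʳ v ⟩) v₁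
    (at-pc (trans (+1 _) (+-assoc o _ 1)) (r₁ ⟫ one p refl))) (rep-off o₁ r) (λ _ → off-cnt o₁)

bind-correct : ∀ x e c → Correct c → Correct (bind x e c)
bind-correct x e c C {o = o} {d} {ρ} s m sc r as
  with ∧⁻ {x ≡ᵇ d} sc
... | sx , sc′ with ≡ᵇ⇒≡ x d sx
... | refl with at-++ (compileE e 0) (length-compileE e 0) as
... | a₁ , (p ∷ q ∷ a₂) with compileE-correct e 0 m (proj₁ (∧⁻ {scopedE d e} sc′)) r a₁
... | evaluates m₁ r₁ v₁ o₁
  with C s m₃ (proj₂ (∧⁻ {scopedE d e} sc′)) (rep-extend w (rep-loc (rep-loc (rep-off o₁ r))))
         (move (+-comm 2 _) a₂)
  where
  m₂ = m₁ [ loc x ↦ 0 ]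
  m₃ = m₂ [ loc x ↦ m₂ (loc x) + m₂ (tmp 0) ]
  w : m₃ (loc x) ≡ eval e ρ (arr s)
  w = trans (↦-same m₂ (loc x)) (cong₂ _+_ (↦-same m₁ (loc x))
        (trans (↦-other m₁ (λ q → tmp≢loc (sym q))) v₁))
... | runs m₄ r₄ p₄ q₄ = runs m₄
  (at-pc (trans (+-assoc (o + costE e) 2 _) (+-assoc o _ _))
    (within (≤-reflexive (sym (+-assoc (costE e) 2 _)))
      (r₁ ⟫ at-pc (+-comm 2 _) (one p refl ⟫ one q refl) ⟫ r₄)))
  (rep-restrict p₄)
  λ x<d → trans (q₄ (m<n⇒m<1+n x<d)) (trans (↦-other _ loc≢cnt) (trans (↦-other _ loc≢cnt) (off-cnt o₁)))

jpos-step : ∀ {P o i l m is os} → fetch P o ≡ jpos i l → ∀ {v} → m i ≡ v →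
  Reach P 1 ⟨ o , m , is , os ⟩ ⟨ jump v (suc o) l , m , is , os ⟩
jpos-step p refl = one p refl

when-correct : ∀ e c d → Correct c → Correct d → Correct (when e c d)
when-correct e c b C B {P} {o} {d} {ρ} s m sc r as
  with ∧⁻ {scopedE d e} sc
... | se , sc′ with ∧⁻ {scoped d c} sc′
... | sc₁ , sc₀ with at-++ (compileE e 0) (length-compileE e 0) as
... | a₁ , (p ∷ as₁)
  with at-++ (compile b (o + costE e + 1)) (length-compile b _) (move (+1 _) as₁)
... | a₂ , (q ∷ q′ ∷ as₂) with move (+-comm 2 _) as₂
... | a₃ with compileE-correct e 0 m se r a₁
... | evaluates m₁ r₁ v₁ o₁ with eval e ρ (arr s)
... | suc v with C s m₁ sc₁ (rep-off o₁ r) a₃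
... | runs m₂ r₂ p₂ q₂ = runs m₂
  (at-pc pc-≡ (within (≤-trans (≤-reflexive (sym (+-assoc (costE e) 1 _)))
     (+-monoˡ-≤ _ (+-monoʳ-≤ (costE e) (s≤s z≤n)))) (r₁ ⟫ jpos-step p v₁ ⟫ r₂)))
  p₂ (λ x<d → trans (q₂ x<d) (off-cnt o₁))
  where
  pc-≡ : o + costE e + 1 + codeSize b + 2 + codeSize c ≡ o + (costE e + (1 + (codeSize b + (2 + codeSize c))))
  pc-≡ = solve 4 (λ o e b c → o :+ e :+ con 1 :+ b :+ con 2 :+ c := o :+ (e :+ (con 1 :+ (b :+ (con 2 :+ c)))))
    refl o (costE e) (codeSize b) (codeSize c)
    where open +-*-Solver
when-correct e c b C B {P} {o} {d} {ρ} s m sc r as | se , _ | sc₁ , sc₀ | a₁ , (p ∷ as₁) | a₂ , (q ∷ q′ ∷ as₂) | a₃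
    | evaluates m₁ r₁ v₁ o₁ | zero with B s m₁ sc₀ (rep-off o₁ r) a₂
... | runs m₂ r₂ p₂ q₂ = runs (m₂ [ tmp 0 ↦ 1 ])
  (at-pc pc-≡ (within cost-≤ (r₁ ⟫ at-pc (+1 _) (jpos-step p v₁) ⟫ r₂ ⟫ one q refl ⟫ jpos-step q′ (↦-same m₂ (tmp 0)))))
  (rep-tmp p₂) (λ x<d → trans (↦-other m₂ tmp≢cnt) (trans (q₂ x<d) (off-cnt o₁)))
  where
  pc-≡ : o + costE e + 1 + codeSize b + 2 + codeSize c ≡ o + (costE e + (1 + (codeSize b + (2 + codeSize c))))
  pc-≡ = solve 4 (λ o e b c → o :+ e :+ con 1 :+ b :+ con 2 :+ c := o :+ (e :+ (con 1 :+ (b :+ (con 2 :+ c)))))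
    refl o (costE e) (codeSize b) (codeSize c)
    where open +-*-Solver
  cost-≤ : costE e + (1 + (cost b ρ s + 2)) ≤ costE e + 3 + cost b ρ s
  cost-≤ = ≤-reflexive (solve 2 (λ e b → e :+ (con 1 :+ (b :+ con 2)) := e :+ con 3 :+ b) refl (costE e) (cost b ρ s))
    where open +-*-Solver

-- The invariant `AtTest` is placed at the test, where the initial jump and all rounds meet. After
-- the body, the variable is known to have kept its value because the environment is a parameter
-- that no command changes.
loop-correct : ∀ x e c → Correct c → Correct (loop x e c)
loop-correct x e c C {P} {o} {d} {ρ} s m sc r as
  with ∧⁻ {x ≡ᵇ d} sc
... | sx , sc′ with ≡ᵇ⇒≡ x d sx
... | refl with at-++ (compileE e 0) (length-compileE e 0) as
... | a₁ , (p₁ ∷ p₂ ∷ p₃ ∷ p₄ ∷ p₅ ∷ as₁)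
  with at-++ (compile c (o + costE e + 5)) (length-compile c _) (move (+-comm 5 _) as₁)
... | a₂ , (p₆ ∷ p₇ ∷ p₈ ∷ p₉ ∷ [])
  with compileE-correct e 0 m (proj₁ (∧⁻ {scopedE d e} sc′)) r a₁
... | evaluates m₁ r₁ v₁ o₁ = finish (rounds n ≤-refl)
  where
  n body test : ℕ
  n    = eval e ρ (arr s)
  body = o + costE e + 5
  test = o + costE e + 5 + codeSize c + 3

  states : ℕ → State
  states i = iter i (λ i → run c (ρ [ x ↦ i ])) s

  costs : ℕ → ℕ
  costs i = iterCost i (λ i → cost c (ρ [ x ↦ i ])) (λ i → run c (ρ [ x ↦ i ])) s

  record AtTest (i : ℕ) : Set where
    field
      memory    : Mem
      path      : Reach P (costE e + (5 + costs i)) ⟨ o , m , inp s , out s ⟩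
                    ⟨ test , memory , inp (states i) , out (states i) ⟩
      current   : Represents d ρ (arr (states i)) memory
      remaining : memory (cnt d) ≡ n ∸ i
      variable-value : memory (loc d) ≡ i
      outer     : ∀ {y} → y < d → memory (cnt y) ≡ m (cnt y)
  open AtTest

  cnt≢ : ∀ {y} → y < d → cnt d ≢ cnt y
  cnt≢ y<d q = <-irrefl (sym (addr-injective {2} q)) y<d

  rounds : ∀ i → i ≤ n → AtTest i
  rounds zero _ = record
    { memory = m₅
    ; path = within (+-monoʳ-≤ (costE e) (≤-reflexive (sym (+-identityʳ 5))))
        (r₁ ⟫ one p₁ refl ⟫ one p₂ refl ⟫ one p₃ refl ⟫ one p₄ refl ⟫ jpos-step p₅ (↦-same m₄ (tmp 0)))
    ; current = rep-tmp (rep-loc (rep-cnt (rep-cnt (rep-off o₁ r))))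
    ; remaining = trans (↦-other m₄ tmp≢cnt) (trans (↦-other m₃ loc≢cnt) (trans (↦-same m₂ (cnt d))
        (cong₂ _+_ (↦-same m₁ (cnt d)) (trans (↦-other m₁ (λ q → tmp≢cnt (sym q))) v₁))))
    ; variable-value = trans (↦-other m₄ tmp≢loc) (↦-same m₃ (loc d))
    ; outer = λ y<d → trans (↦-other m₄ tmp≢cnt) (trans (↦-other m₃ loc≢cnt)
        (trans (↦-other m₂ (cnt≢ y<d)) (trans (↦-other m₁ (cnt≢ y<d)) (off-cnt o₁))))
    }
    where
    m₂ = m₁ [ cnt d ↦ 0 ]
    m₃ = m₂ [ cnt d ↦ m₂ (cnt d) + m₂ (tmp 0) ]
    m₄ = m₃ [ loc d ↦ 0 ]
    m₅ = m₄ [ tmp 0 ↦ 1 ]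
  rounds (suc i) i<n with rounds i (<⇒≤ i<n)
  ... | a with C (states i) (memory a) (proj₂ (∧⁻ {scopedE d e} sc′))
                 (rep-extend (variable-value a) (current a)) a₂
  ... | runs m₂ r₂ q₂ c₂ = record
    { memory = m₅
    ; path = within (≤-reflexive cost-≡) (path a ⟫
        jpos-step p₉′ (trans (remaining a) (m<n⇒0<n∸m′ i<n)) ⟫ r₂ ⟫
        one p₆ refl ⟫ one p₇ refl ⟫ at-pc (+-comm 3 _) (one p₈ refl))
    ; current = rep-cnt (rep-loc (rep-tmp (rep-restrict q₂)))
    ; remaining = trans (↦-same m₄ (cnt d)) (trans (cong₂ _∸_
        (trans (↦-other m₃ loc≢cnt) (trans (↦-other m₂ tmp≢cnt) (trans (c₂ (n<1+n d)) (remaining a))))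
        (trans (↦-other m₃ (λ q → tmp≢loc (sym q))) (↦-same m₂ (tmp 0))))
        (trans (∸-+-assoc n i 1) (cong (n ∸_) (+-comm i 1))))
    ; variable-value = trans (↦-other m₄ (λ q → loc≢cnt (sym q))) (trans (↦-same m₃ (loc d))
        (trans (cong₂ _+_ (trans (↦-other m₂ tmp≢loc) (trans (vars q₂ (n<1+n d)) (↦-same ρ d))) (↦-same m₂ (tmp 0)))
          (+-comm i 1)))
    ; outer = λ y<d → trans (↦-other m₄ (cnt≢ y<d)) (trans (↦-other m₃ loc≢cnt)
        (trans (↦-other m₂ tmp≢cnt) (trans (c₂ (m<n⇒m<1+n y<d)) (outer a y<d))))
    }
    where
    m₃ = m₂ [ tmp 0 ↦ 1 ]
    m₄ = m₃ [ loc d ↦ m₃ (loc d) + m₃ (tmp 0) ]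
    m₅ = m₄ [ cnt d ↦ m₄ (cnt d) ∸ m₄ (tmp 0) ]
    p₉′ = move-fetch {P} (+-comm 3 (o + costE e + 5 + codeSize c)) p₉
    m<n⇒0<n∸m′ : i < n → n ∸ i ≡ suc (n ∸ suc i)
    m<n⇒0<n∸m′ i<n = +-∸-assoc 1 i<n
    k = cost c (ρ [ x ↦ i ]) (states i)
    cost-≡ : costE e + (5 + costs i) + (1 + (k + 3)) ≡ costE e + (5 + (costs i + (k + 4)))
    cost-≡ = solve 3 (λ e s k → e :+ (con 5 :+ s) :+ (con 1 :+ (k :+ con 3)) := e :+ (con 5 :+ (s :+ (k :+ con 4))))
      refl (costE e) (costs i) k
      where open +-*-Solver

  finish : AtTest n → Runs P o (codeSize (loop x e c)) (cost (loop x e c) ρ s) d ρ s (states n) m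
  finish a = runs (memory a)
    (at-pc pc-≡ (within (≤-reflexive cost-≡) (path a ⟫ jpos-step p₉′ (trans (remaining a) (n∸n≡0 n)))))
    (current a) (outer a)
    where
    p₉′ = move-fetch {P} (+-comm 3 (o + costE e + 5 + codeSize c)) p₉
    cost-≡ : costE e + (5 + costs n) + 1 ≡ costE e + 6 + costs n
    cost-≡ = solve 2 (λ e s → e :+ (con 5 :+ s) :+ con 1 := e :+ con 6 :+ s) refl (costE e) (costs n)
      where open +-*-Solver
    pc-≡ : suc test ≡ o + (costE e + (5 + (codeSize c + (3 + 1))))
    pc-≡ = solve 3 (λ o e c → con 1 :+ (o :+ e :+ con 5 :+ c :+ con 3) := o :+ (e :+ (con 5 :+ (c :+ con 4))))
      refl o (costE e) (codeSize c)
      where open +-*-Solver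

compile-correct : ∀ c → Correct c
compile-correct skip {o = o} s m sc r as =
  runs m (at-pc (sym (+-identityʳ o)) (0 , z≤n , done)) r (λ _ → refl)
compile-correct (c ⨟ d)        = sequence-correct c d (compile-correct c) (compile-correct d)
compile-correct (assign a i e) = assign-correct a i e
compile-correct (get a i)      = get-correct a i
compile-correct (put e)        = put-correct e
compile-correct (when e c d)   = when-correct e c d (compile-correct c) (compile-correct d)
compile-correct (bind x e c)   = bind-correct x e c (compile-correct c)
compile-correct (loop x e c)   = loop-correct x e c (compile-correct c)

start : List ℕ → State
start xs = state (λ _ _ → 0) xs []

halts-at-end : ∀ P {p m is os} → length P ≡ p → step P ⟨ p , m , is , os ⟩ ≡ nothing
halts-at-end P {m = m} {is} {os} refl = cong (λ i → execute i ⟨ length P , m , is , os ⟩) (fetch-end P)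

noVars : Env
noVars _ = 0

compiled-computes : ∀ c xs {t ys} → T (scoped 0 c) → cost c noVars (start xs) ≤ t →
  out (run c noVars (start xs)) ≡ ys → Computes (compile c 0) t xs ys
compiled-computes c xs sc t≥ refl
  with compile-correct c {ρ = noVars} (start xs) (λ _ → 0) sc
         (record { vars = λ () ; cells = λ _ _ → refl }) (at-whole [] (compile c 0))
... | runs m (u , u≤ , steps) _ _ =
  u , _ , ≤-trans u≤ t≥ , steps-halt steps (halts-at-end (compile c 0) (length-compile c 0)) , refl

-- Reasoning about commands

-- Invariant and cost go together, since the bound on the cost of a round usually depends on the
-- invariant.
loop-rule : ∀ (I : ℕ → State → Set) x e c ρ s n b → eval e ρ (arr s) ≡ n → I 0 s →
  (∀ i s → i < n → I i s → I (suc i) (run c (ρ [ x ↦ i ]) s) × cost c (ρ [ x ↦ i ]) s ≤ b) →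
  I n (run (loop x e c) ρ s) × cost (loop x e c) ρ s ≤ costE e + 6 + n * (b + 4)
loop-rule I x e c ρ s n b refl base step with rounds n ≤-refl
  where
  f = λ i → run c (ρ [ x ↦ i ])
  rounds : ∀ k → k ≤ n → I k (iter k f s) × iterCost k (λ i → cost c (ρ [ x ↦ i ])) f s ≤ k * (b + 4)
  rounds zero    _   = base , z≤n
  rounds (suc k) k<n with rounds k (<⇒≤ k<n)
  ... | p , q with step k (iter k f s) k<n p
  ... | p′ , q′ = p′ , ≤-trans (+-mono-≤ q (+-monoˡ-≤ 4 q′)) (≤-reflexive (+-comm (k * (b + 4)) (b + 4)))
... | p , q = p , +-monoʳ-≤ (costE e + 6) q

-- The named registers are cells of a single array at literal indices. Telling literals apart is
-- what makes distinct registers independent of each other.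
mayHit : Expr → ℕ → Bool
mayHit (lit j) i = j ≡ᵇ i
mayHit _       i = true

mayWrite : Cmd → ℕ → ℕ → Bool
mayWrite skip           a i = false
mayWrite (c ⨟ d)        a i = mayWrite c a i ∨ mayWrite d a i
mayWrite (assign b e _) a i = (b ≡ᵇ a) ∧ mayHit e i
mayWrite (get b e)      a i = (b ≡ᵇ a) ∧ mayHit e i
mayWrite (put e)        a i = false
mayWrite (when e c d)   a i = mayWrite c a i ∨ mayWrite d a i
mayWrite (bind x e c)   a i = mayWrite c a i
mayWrite (loop x e c)   a i = mayWrite c a i

∨⁻ : ∀ {x y} → x ∨ y ≡ false → x ≡ false × y ≡ false
∨⁻ {false} p = refl , p

write-frame : ∀ e {a b i ρ x} m → (b ≡ᵇ a) ∧ mayHit e i ≡ false → (m [ b · eval e ρ m ↦ x ]) a i ≡ m a i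
write-frame e {a} {b} m p with b ≡ᵇ a
write-frame e m p | false = refl
write-frame (lit j) {i = i} m p | true with j ≡ᵇ i
... | false = refl

-- `mayWrite` is a syntactic overapproximation that computes, so for a concrete command and register
-- the hypothesis is `refl`.
frame : ∀ c a i → mayWrite c a i ≡ false → ∀ ρ s → arr (run c ρ s) a i ≡ arr s a i
frame skip           a i p ρ s = refl
frame (c ⨟ d)        a i p ρ s =
  trans (frame d a i (proj₂ (∨⁻ {mayWrite c a i} p)) ρ _) (frame c a i (proj₁ (∨⁻ p)) ρ s)
frame (assign b e _) a i p ρ s = write-frame e {b = b} (arr s) p
frame (get b e)      a i p ρ s = write-frame e {b = b} (arr s) p
frame (put e)        a i p ρ s = refl
frame (when e c d)   a i p ρ s with eval e ρ (arr s)
... | zero  = frame d a i (proj₂ (∨⁻ {mayWrite c a i} p)) ρ s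
... | suc _ = frame c a i (proj₁ (∨⁻ p)) ρ s
frame (bind x e c)   a i p ρ s = frame c a i p _ s
frame (loop x e c)   a i p ρ s = rounds (eval e ρ (arr s))
  where
  rounds : ∀ k → arr (iter k (λ i → run c (ρ [ x ↦ i ])) s) a i ≡ arr s a i
  rounds zero    = refl
  rounds (suc k) = trans (frame c a i p _ _) (rounds k)

silent : Cmd → Bool
silent skip           = true
silent (c ⨟ d)        = silent c ∧ silent d
silent (assign b e _) = true
silent (get b e)      = false
silent (put e)        = false
silent (when e c d)   = silent c ∧ silent d
silent (bind x e c)   = silent c
silent (loop x e c)   = silent c

SameIO : State → State → Set
SameIO s s′ = inp s′ ≡ inp s × out s′ ≡ out s

silent-io : ∀ c → T (silent c) → ∀ ρ s → SameIO s (run c ρ s)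
silent-io skip           p ρ s = refl , refl
silent-io (c ⨟ d)        p ρ s with silent-io c (proj₁ (∧⁻ p)) ρ s | silent-io d (proj₂ (∧⁻ {silent c} p)) ρ (run c ρ s)
... | q , q′ | r , r′ = trans r q , trans r′ q′
silent-io (assign b e _) p ρ s = refl , refl
silent-io (when e c d)   p ρ s with eval e ρ (arr s)
... | zero  = silent-io d (proj₂ (∧⁻ {silent c} p)) ρ s
... | suc _ = silent-io c (proj₁ (∧⁻ p)) ρ s
silent-io (bind x e c)   p ρ s = silent-io c p _ s
silent-io (loop x e c)   p ρ s = rounds (eval e ρ (arr s))
  where
  rounds : ∀ k → SameIO s (iter k (λ i → run c (ρ [ x ↦ i ])) s)
  rounds zero    = refl , refl
  rounds (suc k) with rounds k | silent-io c p (ρ [ x ↦ k ]) (iter k (λ i → run c (ρ [ x ↦ i ])) s)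
  ... | q , q′ | r , r′ = trans r q , trans r′ q′

-- The dynamic program

-- `heap` holds the blocks and `reg` the named registers. The graph is given by `adj`, its adjacency
-- matrix row by row, the colours `blk`, the row offsets `row` and the bit weights `pow`. An item on
-- the stack is described by its two blocks in `ptr`, its number of black vertices in `len`, the row
-- offset of a black representative in `brep` and a white representative in `wrep`; adding entries
-- of the last two gives an index into `adj` without a multiplication. `pat` is the set X, and
-- `dest` the pair of blocks under construction.
heap reg adj blk row pow ptr len brep wrep pat dest : ℕ
heap = 0
reg  = 1
adj  = 2
blk  = 3
row  = 4
pow  = 5
ptr  = 6
len  = 7
brep = 8
wrep = 9
pat  = 10
dest = 11

-- `rFP` is the first free heap cell; `rACC` and `rLA` give the start and the last index of the
-- accumulated block, `rAL` the permission for white vertices, `rSP` the height of the stack. `rPH`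
-- tells whether a label code or its argument comes next, and `rCD` keeps the code. `rBR`, `rWR` and
-- `rBS` collect the representatives and the number of black vertices of a new item; `rBIG` is the
-- `n`-th power of 2. `rLB` holds in turn an argument, the length of a second block and the record
-- of the listing.
pattern rFP  = 0
pattern rACC = 1
pattern rLA  = 2
pattern rAL  = 3
pattern rSP  = 4
pattern rPH  = 5
pattern rCD  = 6
pattern rN   = 7
pattern rBR  = 8
pattern rWR  = 9
pattern rBS  = 10
pattern rBIG = 11
pattern rLB  = 12

get-reg : ℕ → Expr
get-reg r = reg at lit r

set-reg : ℕ → Expr → Cmd
set-reg r = assign reg (lit r)

-- In the convolution, variables 8 to 12 are the target, the first block and
-- its length, and the second block and its length.
convolveCell convolveRow convolve : Cmd
convolveCell = bind 15 (var 8 ⊞ var 13 ⊞ var 14)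
  -- With truncated subtraction, x + (y - x) is the maximum of x and y.
  (assign heap (var 15) (heap at var 15 ⊞
    (heap at (var 9 ⊞ var 13) ⊞ heap at (var 11 ⊞ var 14) ⊟ heap at var 15)))
convolveRow = loop 14 (var 12 ⊞ lit 1) convolveCell
convolve    = loop 13 (var 10 ⊞ lit 1) convolveRow

-- A pattern tells which parts contribute black vertices.  A part may contribute
-- white vertices if these are adjacent to the black vertices of all other parts
-- of the pattern.  Variables 3 to 7: number of parts, stack position of the first part, whether
-- white vertices are permitted, target block, and the current part.
allow : Cmd
allow = set-reg rAL (var 5) ⨟
  loop 8 (var 3)
    (when (pat at var 8)
      -- The absolute difference, which is positive exactly for two different parts.
      (when ((var 7 ⊟ var 8) ⊞ (var 8 ⊟ var 7))
        (when (adj at (brep at (var 4 ⊞ var 8) ⊞ wrep at (var 4 ⊞ var 7)))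
          skip
          (set-reg rAL (lit 0)))
        skip)
      skip)

-- A part outside the pattern is cut down to cell 0 of its block, the bicliques without black
-- vertices. Of the two blocks of an item, at even and odd positions of `ptr`, the allowance 0 or 1
-- selects the one without or with white vertices.
extend : Cmd
extend = allow ⨟
  when (pat at var 7) (set-reg rLB (len at (var 4 ⊞ var 7))) (set-reg rLB (lit 0)) ⨟
  bind 8 (get-reg rFP) (bind 9 (get-reg rACC) (bind 10 (get-reg rLA)
    (bind 11 (ptr at ((var 4 ⊞ var 7) ⊞ (var 4 ⊞ var 7) ⊞ get-reg rAL)) (bind 12 (get-reg rLB)
      (convolve ⨟
       set-reg rACC (var 8) ⨟
       set-reg rLA (var 10 ⊞ var 12) ⨟
       set-reg rFP (var 8 ⊞ (var 10 ⊞ var 12) ⊞ lit 1))))))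

-- Heap cell 0 forever contains 0 and serves as the block of the empty set. The accumulation starts
-- from it, and the last convolution uses it as second operand: this merges the result into the
-- target by cellwise maximum.
tryPattern : Cmd
tryPattern = set-reg rACC (lit 0) ⨟ set-reg rLA (lit 0) ⨟
  loop 7 (var 3) extend ⨟
  bind 7 (lit 0) (bind 8 (var 6) (bind 9 (get-reg rACC) (bind 10 (get-reg rLA)
    (bind 11 (lit 0) (bind 12 (lit 0) convolve)))))

-- The enumeration is unrolled in the program text, whose length is exponential in the constant k
-- only. At a node with fewer than k parts it merely repeats patterns.
tryPatterns : ℕ → Cmd
tryPatterns zero    = tryPattern
tryPatterns (suc k) =
  assign pat (lit k) (lit 0) ⨟ tryPatterns k ⨟ assign pat (lit k) (lit 1) ⨟ tryPatterns k

-- Cell 0 of the odd block is nonzero exactly if the part has a white vertex, because its white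
-- vertices alone form a biclique and weights are positive. For black vertices the length decides.
summarizeStep summarize : Cmd
summarizeStep =
  set-reg rBS (get-reg rBS ⊞ len at (var 4 ⊞ var 5)) ⨟
  when (len at (var 4 ⊞ var 5)) (set-reg rBR (brep at (var 4 ⊞ var 5))) skip ⨟
  when (heap at (ptr at ((var 4 ⊞ var 5) ⊞ (var 4 ⊞ var 5) ⊞ lit 1)))
    (set-reg rWR (wrep at (var 4 ⊞ var 5))) skip
summarize = set-reg rBS (lit 0) ⨟ loop 5 (var 3) summarizeStep

-- Variable 5 is 0 or 1 and tells whether the bicliques to be optimized may contain white vertices
-- at all. The old free pointer becomes the target block.
optimize : ℕ → Cmd
optimize k = bind 6 (get-reg rFP)
  (set-reg rFP (var 6 ⊞ get-reg rBS ⊞ lit 1) ⨟ assign dest (var 5) (var 6) ⨟ tryPatterns k)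

finalize : Cmd
finalize =
  assign ptr (var 4 ⊞ var 4) (dest at lit 0) ⨟
  assign ptr (var 4 ⊞ var 4 ⊞ lit 1) (dest at lit 1) ⨟
  assign len (var 4) (get-reg rBS) ⨟
  assign brep (var 4) (get-reg rBR) ⨟
  assign wrep (var 4) (get-reg rWR) ⨟
  set-reg rSP (var 4 ⊞ lit 1)

-- Variable 3 is the number of items to be combined.
combine : ℕ → Cmd
combine k = bind 4 (get-reg rSP ⊟ var 3)
  (summarize ⨟ loop 5 (lit 2) (optimize k) ⨟ finalize)

-- Variable 1 is a vertex v.  Its blocks are 0, 2 ^ (n ∸ 1 ∸ v) if it is black, and
-- 0 and 2 ^ n + 2 ^ (n ∸ 1 ∸ v) if it is white; all three cells are written in
-- either case.
pushLeaf : Cmd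
pushLeaf = bind 2 (get-reg rSP) (bind 3 (get-reg rFP) (
  assign heap (var 3 ⊞ lit 1) (pow at var 1) ⨟
  assign heap (var 3 ⊞ lit 2) (get-reg rBIG ⊞ pow at var 1) ⨟
  assign len (var 2) (blk at var 1) ⨟
  assign brep (var 2) (row at var 1) ⨟
  assign wrep (var 2) (var 1) ⨟
  assign ptr (var 2 ⊞ var 2) (var 3) ⨟
  assign ptr (var 2 ⊞ var 2 ⊞ lit 1) (var 3 ⊞ (lit 2 ⊟ (blk at var 1 ⊞ blk at var 1))) ⨟
  set-reg rFP (var 3 ⊞ lit 3) ⨟
  set-reg rSP (var 2 ⊞ lit 1)))

readCode readArgument : Cmd
readCode     = set-reg rPH (lit 1) ⨟ get reg (lit rCD)
readArgument = set-reg rPH (lit 0) ⨟ get reg (lit rLB)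

-- Each round of the main loop consumes one number, and a node is processed when its second number
-- arrives. Of the labels of inner nodes only `prime` has a code above 3. The loop of one round in
-- `combineAll` binds variable 2, so that `combine` occurs at the same depth in both cases.
combineAll combinePairs process token : ℕ → Cmd
combineAll   k = loop 2 (lit 1) (bind 3 (var 1) (combine k))
combinePairs k = loop 2 (var 1 ⊟ lit 1) (bind 3 (lit 2) (combine k))
process      k = when (get-reg rCD) (when (get-reg rCD ⊟ lit 3) (combineAll k) (combinePairs k)) pushLeaf
token        k = when (get-reg rPH) (readArgument ⨟ bind 1 (get-reg rLB) (process k)) readCode

readBlack readRow readRows powers readGraph : Cmd
readBlack = loop 0 (get-reg rN) (get blk (var 0))
readRow   =
  assign row (var 0) (get-reg rACC) ⨟
  loop 1 (get-reg rN) (get adj (row at var 0 ⊞ var 1)) ⨟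
  set-reg rACC (get-reg rACC ⊞ get-reg rN)
readRows  = set-reg rACC (lit 0) ⨟ loop 0 (get-reg rN) readRow
powers    = set-reg rBIG (lit 1) ⨟
  loop 0 (get-reg rN) (
    -- Vertex 0 gets the largest power, so that reading bits from the top lists the vertices in
    -- order.
    assign pow (get-reg rN ⊟ lit 1 ⊟ var 0) (get-reg rBIG) ⨟
    set-reg rBIG (get-reg rBIG ⊞ get-reg rBIG))
readGraph = get reg (lit rN) ⨟ readBlack ⨟ readRows ⨟ powers ⨟ set-reg rFP (lit 1)

readTree : ℕ → Cmd
readTree k = get reg (lit rLB) ⨟ loop 0 (get-reg rLB) (token k)

prepare : ℕ → Cmd
prepare k = readGraph ⨟ readTree k

-- Divides register rACC by 2 ^ n, leaving the quotient in register rLA.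
divideStep : Cmd
-- In a truncated subtraction, x + 1 - y is positive exactly if y is at most x. The same test recurs
-- in `emit` and `showVertex`.
divideStep = when (get-reg rACC ⊞ lit 1 ⊟ get-reg rBIG)
  (set-reg rACC (get-reg rACC ⊟ get-reg rBIG) ⨟ set-reg rLA (get-reg rLA ⊞ lit 1))
  skip

divide : ℕ → Cmd
divide d = set-reg rLA (lit 0) ⨟ loop d (get-reg rN) divideStep

-- Going down from the largest number of black vertices, a size is maximal exactly if it has more
-- white vertices than all before it. `rLB` is one more than the record so far and starts with 0, so
-- that the first size is printed even if it has no white vertex.
emit listStep listSizes : Cmd
emit      = when (get-reg rLA ⊞ lit 1 ⊟ get-reg rLB)
  (put (var 1) ⨟ put (get-reg rLA) ⨟ set-reg rLB (get-reg rLA ⊞ lit 1))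
  skip
listStep  = bind 1 (len at lit 0 ⊟ var 0)
  (set-reg rACC (heap at (ptr at lit 1 ⊞ var 1)) ⨟ divide 2 ⨟ emit)
listSizes = set-reg rLB (lit 0) ⨟ loop 0 (len at lit 0 ⊞ lit 1) listStep

showVertex showBiclique : Cmd
showVertex   = when (get-reg rACC ⊞ lit 1 ⊟ pow at var 0)
  (put (lit 1) ⨟ set-reg rACC (get-reg rACC ⊟ pow at var 0))
  (put (lit 0))
showBiclique = get reg (lit rLB) ⨟
  set-reg rACC (heap at (ptr at lit 1 ⊞ get-reg rLB)) ⨟
  divide 0 ⨟
  loop 0 (get-reg rN) showVertex

scoped-tryPatterns : ∀ k → T (scoped 7 (tryPatterns k))
scoped-tryPatterns zero    = tt
scoped-tryPatterns (suc k) = ∧⁺ {scoped 7 (tryPatterns k)} p p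
  where
  p = scoped-tryPatterns k
  ∧⁺ : ∀ {x y} → T x → T y → T (x ∧ y)
  ∧⁺ {true} _ q = q

-- Convolution

-- A maximum in the making, described by its two halves: `bound` covers the pairs already treated
-- and `attained` names the origin of each value. The operands are read in the original heap, which
-- is justified by their lying apart from the target.
record Convolved (H : ℕ → ℕ) (d p lp q lq : ℕ) (Done : ℕ → ℕ → Set) (H′ : ℕ → ℕ) : Set where
  field
    outside  : ∀ a → a < d ⊎ d + (lp + lq) < a → H′ a ≡ H a
    grows    : ∀ a → H a ≤ H′ a
    bound    : ∀ {i j} → i ≤ lp → j ≤ lq → Done i j → H (p + i) + H (q + j) ≤ H′ (d + i + j)
    attained : ∀ a → H′ a ≡ H a ⊎
      ∃[ i ] ∃[ j ] i ≤ lp × j ≤ lq × a ≡ d + i + j × H′ a ≡ H (p + i) + H (q + j)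
open Convolved public

relax : ∀ {H d p lp q lq D E H′} → (∀ {i j} → i ≤ lp → j ≤ lq → E i j → D i j) →
  Convolved H d p lp q lq D H′ → Convolved H d p lp q lq E H′
relax f c = record
  { outside = outside c ; grows = grows c ; attained = attained c
  ; bound = λ i≤ j≤ e → bound c i≤ j≤ (f i≤ j≤ e) }

Apart : (p lp d l : ℕ) → Set
Apart p lp d l = ∀ {i} → i ≤ lp → p + i < d ⊎ d + l < p + i

max-cases : ∀ x y → (x + (y ∸ x) ≡ x) ⊎ (x + (y ∸ x) ≡ y)
max-cases x y with ≤-total y x
... | inj₁ y≤x = inj₁ (trans (cong (x +_) (m≤n⇒m∸n≡0 y≤x)) (+-identityʳ x))
... | inj₂ x≤y = inj₂ (m+[n∸m]≡n x≤y)

convolved-step : ∀ {H d p lp q lq D H′ i j} → Apart p lp d (lp + lq) → Apart q lq d (lp + lq) →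
  i ≤ lp → j ≤ lq → Convolved H d p lp q lq D H′ →
  Convolved H d p lp q lq (λ i′ j′ → D i′ j′ ⊎ (i′ ≡ i × j′ ≡ j))
    (H′ [ d + i + j ↦ H′ (d + i + j) + ((H′ (p + i) + H′ (q + j)) ∸ H′ (d + i + j)) ])
convolved-step {H} {d} {p} {lp} {q} {lq} {D} {H′} {i} {j} ap aq i≤ j≤ c = record
  { outside  = out′
  ; grows    = λ a → ≤-trans (grows c a) (larger a)
  ; bound    = bound′
  ; attained = attained′
  }
  where
  t = d + i + j
  v = H′ t + ((H′ (p + i) + H′ (q + j)) ∸ H′ t)
  H″ = H′ [ t ↦ v ]

  sum-≡ : H′ (p + i) + H′ (q + j) ≡ H (p + i) + H (q + j)
  sum-≡ = cong₂ _+_ (outside c _ (ap i≤)) (outside c _ (aq j≤))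

  d≤t : d ≤ t
  d≤t = ≤-trans (m≤m+n d i) (m≤m+n (d + i) j)

  t≤ : t ≤ d + (lp + lq)
  t≤ = ≤-trans (≤-reflexive (+-assoc d i j)) (+-monoʳ-≤ d (+-mono-≤ i≤ j≤))

  out′ : ∀ a → a < d ⊎ d + (lp + lq) < a → H″ a ≡ H a
  out′ a (inj₁ a<d) = trans (↦-other H′ {t} (λ { refl → <-irrefl refl (<-≤-trans a<d d≤t) })) (outside c a (inj₁ a<d))
  out′ a (inj₂ a>)  = trans (↦-other H′ {t} (λ { refl → <-irrefl refl (<-≤-trans a> t≤) })) (outside c a (inj₂ a>))

  larger : ∀ a → H′ a ≤ H″ a
  larger a with t ℕ.≟ a
  ... | yes refl = subst (H′ t ≤_) (sym (↦-same H′ t)) (m≤m+n (H′ t) _)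
  ... | no  t≢a  = ≤-reflexive (sym (↦-other H′ t≢a))

  bound′ : ∀ {i′ j′} → i′ ≤ lp → j′ ≤ lq → D i′ j′ ⊎ (i′ ≡ i × j′ ≡ j) → H (p + i′) + H (q + j′) ≤ H″ (d + i′ + j′)
  bound′ i≤ j≤ (inj₁ e)             = ≤-trans (bound c i≤ j≤ e) (larger _)
  bound′ i≤ j≤ (inj₂ (refl , refl)) =
    subst (_ ≤_) (sym (↦-same H′ t)) (subst (_≤ v) sum-≡ (m≤n+m∸n _ (H′ t)))

  attained′ : ∀ a → H″ a ≡ H a ⊎
    ∃[ i ] ∃[ j ] i ≤ lp × j ≤ lq × a ≡ d + i + j × H″ a ≡ H (p + i) + H (q + j)
  attained′ a with t ℕ.≟ a
  ... | no t≢a with attained c a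
  ...   | inj₁ e = inj₁ (trans (↦-other H′ t≢a) e)
  ...   | inj₂ (i , j , i≤ , j≤ , a≡ , e) = inj₂ (i , j , i≤ , j≤ , a≡ , trans (↦-other H′ t≢a) e)
  attained′ a | yes refl with max-cases (H′ t) (H′ (p + i) + H′ (q + j))
  ...   | inj₂ e = inj₂ (i , j , i≤ , j≤ , refl , trans (↦-same H′ t) (trans e sum-≡))
  ...   | inj₁ e with attained c t
  ...     | inj₁ e′ = inj₁ (trans (↦-same H′ t) (trans e e′))
  ...     | inj₂ (i , j , i≤ , j≤ , a≡ , e′) =
    inj₂ (i , j , i≤ , j≤ , a≡ , trans (↦-same H′ t) (trans e e′))

Everywhere : ℕ → ℕ → Set
Everywhere _ _ = ⊤′
  where open import Data.Unit using () renaming (⊤ to ⊤′)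

convolve-correct : ∀ ρ s →
  Apart (ρ 9) (ρ 10) (ρ 8) (ρ 10 + ρ 12) → Apart (ρ 11) (ρ 12) (ρ 8) (ρ 10 + ρ 12) →
  Convolved (arr s heap) (ρ 8) (ρ 9) (ρ 10) (ρ 11) (ρ 12) Everywhere (arr (run convolve ρ s) heap) ×
  cost convolve ρ s ≤ 100 * (suc (ρ 10) * suc (ρ 12))
convolve-correct ρ s ap aq with
  loop-rule (λ i s′ → Inv (λ i′ j′ → i′ < i) s′) 13 (var 10 ⊞ lit 1) convolveRow ρ s (ρ 10 + 1)
    (10 + (ρ 12 + 1) * 68) refl
    (record { outside = λ _ _ → refl ; grows = λ _ → ≤-refl ; bound = λ _ _ () ; attained = λ _ → inj₁ refl })
    outer
  where
  Inv : (ℕ → ℕ → Set) → State → Set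
  Inv D s′ = Convolved (arr s heap) (ρ 8) (ρ 9) (ρ 10) (ρ 11) (ρ 12) D (arr s′ heap)

  in-range : ∀ {i l} → i < l + 1 → i ≤ l
  in-range {i} {l} p = ≤-pred (subst (suc i ≤_) (+-comm l 1) p)

  outer : ∀ i s′ → i < ρ 10 + 1 → Inv (λ i′ j′ → i′ < i) s′ →
    Inv (λ i′ j′ → i′ < suc i) (run convolveRow (ρ [ 13 ↦ i ]) s′) ×
    cost convolveRow (ρ [ 13 ↦ i ]) s′ ≤ 10 + (ρ 12 + 1) * 68
  outer i s′ i< inv with
    loop-rule (λ j s″ → Inv (λ i′ j′ → i′ < i ⊎ (i′ ≡ i × j′ < j)) s″) 14 (var 12 ⊞ lit 1) convolveCell (ρ [ 13 ↦ i ]) s′ (ρ 12 + 1)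
      64 refl (relax (λ { _ _ (inj₁ e) → e ; _ _ (inj₂ ()) }) inv)
      (λ j s″ j< inv → relax (λ { _ _ (inj₁ e) → inj₁ (inj₁ e)
                                ; _ _ (inj₂ (refl , s≤s j′≤)) → case m≤n⇒m<n∨m≡n j′≤ of λ
                                    { (inj₁ j′<) → inj₁ (inj₂ (refl , j′<)) ; (inj₂ e) → inj₂ (refl , e) } })
        (convolved-step ap aq (in-range i<) (in-range j<) inv) , ≤ᵇ⇒≤ _ _ tt)
  ... | inv′ , c = relax (λ { _ j≤ (s≤s i′≤) → case m≤n⇒m<n∨m≡n i′≤ of λ
            { (inj₁ i′<) → inj₁ i′< ; (inj₂ e) → inj₂ (e , ≤-trans (s≤s j≤) (≤-reflexive (+-comm 1 _))) } }) inv′ , c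
... | inv , c = relax (λ i≤ _ _ → ≤-trans (s≤s i≤) (≤-reflexive (+-comm 1 _))) inv ,
  ≤-trans c (begin
    10 + (ρ 10 + 1) * (10 + (ρ 12 + 1) * 68 + 4)
      ≤⟨ m≤m+n _ (8 + 18 * ρ 10 + 32 * ρ 12 + 32 * (ρ 10 * ρ 12)) ⟩
    10 + (ρ 10 + 1) * (10 + (ρ 12 + 1) * 68 + 4) + (8 + 18 * ρ 10 + 32 * ρ 12 + 32 * (ρ 10 * ρ 12))
      ≡⟨ solve 2 (λ a b → con 10 :+ (a :+ con 1) :* (con 10 :+ (b :+ con 1) :* con 68 :+ con 4) :+
            (con 8 :+ con 18 :* a :+ con 32 :* b :+ con 32 :* (a :* b)) :=
            con 100 :* ((con 1 :+ a) :* (con 1 :+ b))) refl (ρ 10) (ρ 12) ⟩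
    100 * (suc (ρ 10) * suc (ρ 12)) ∎)
  where
  open ≤-Reasoning
  open +-*-Solver

convolve-values : ∀ ρ s {d p lp q lq} → ρ 8 ≡ d → ρ 9 ≡ p → ρ 10 ≡ lp → ρ 11 ≡ q → ρ 12 ≡ lq →
  Apart p lp d (lp + lq) → Apart q lq d (lp + lq) →
  Convolved (arr s heap) d p lp q lq Everywhere (arr (run convolve ρ s) heap) ×
  cost convolve ρ s ≤ 100 * (suc lp * suc lq)
convolve-values ρ s refl refl refl refl refl = convolve-correct ρ s

-- Blocks of optimal values

Family : Set₁
Family = ℕ → ℕ → Set

-- `complete` also bounds the index, so that the block has a cell for every b occurring in the
-- family; `sound` demands that each of its cells be attained, so no cell is a placeholder.
record Optimal (H : ℕ → ℕ) (p l : ℕ) (Φ : Family) : Set where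
  field
    sound    : ∀ {b} → b ≤ l → Φ b (H (p + b))
    complete : ∀ {b x} → Φ b x → b ≤ l × x ≤ H (p + b)
open Optimal public

optimal-cong : ∀ {H p l Φ Ψ} → (∀ {b x} → Φ b x → Ψ b x) → (∀ {b x} → Ψ b x → Φ b x) →
  Optimal H p l Φ → Optimal H p l Ψ
optimal-cong f g o .sound b≤   = f (sound o b≤)
optimal-cong f g o .complete φ = complete o (g φ)

optimal-heap : ∀ {H H′ p l Φ} → (∀ {b} → b ≤ l → H′ (p + b) ≡ H (p + b)) → Optimal H p l Φ → Optimal H′ p l Φ
optimal-heap {Φ = Φ} e o .sound {b} b≤ = subst (Φ b) (sym (e b≤)) (sound o b≤)
optimal-heap e o .complete φ with complete o φ
... | b≤ , x≤ = b≤ , subst (_ ≤_) (sym (e b≤)) x≤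

truncate : ∀ {H p l l′ Φ} → l′ ≤ l → Optimal H p l Φ → Optimal H p l′ (λ b x → b ≤ l′ × Φ b x)
truncate l≤ o .sound b≤          = b≤ , sound o (≤-trans b≤ l≤)
truncate l≤ o .complete (b≤ , φ) = b≤ , proj₂ (complete o φ)

_⊕_ : Family → Family → Family
(Φ ⊕ Ψ) b x = ∃[ b₁ ] ∃[ x₁ ] ∃[ b₂ ] ∃[ x₂ ] Φ b₁ x₁ × Ψ b₂ x₂ × b ≡ b₁ + b₂ × x ≡ x₁ + x₂

split-sum : ∀ {t} a b → t ≤ a + b → ∃[ i ] ∃[ j ] i ≤ a × j ≤ b × t ≡ i + j
split-sum {t} a b t≤ with ≤-total t a
... | inj₁ t≤a = t , 0 , t≤a , z≤n , sym (+-identityʳ t)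
... | inj₂ a≤t = a , t ∸ a , ≤-refl , ≤-trans (∸-monoˡ-≤ a t≤) (≤-reflexive (m+n∸m≡n a b)) , sym (m+[n∸m]≡n a≤t)

-- A cell that kept its initial 0 is a sum as well: split its index in any way; the corresponding
-- sum is at most 0, hence equal to it.
convolution-value : ∀ {H d p lp q lq H′} → Convolved H d p lp q lq Everywhere H′ →
  (∀ {t} → t ≤ lp + lq → H (d + t) ≡ 0) → ∀ {t} → t ≤ lp + lq →
  ∃[ i ] ∃[ j ] i ≤ lp × j ≤ lq × t ≡ i + j × H′ (d + t) ≡ H (p + i) + H (q + j)
convolution-value {H} {d} {p} {lp} {q} {lq} {H′} c fresh {t} t≤ with attained c (d + t)
... | inj₂ (i , j , i≤ , j≤ , e , v) =
  i , j , i≤ , j≤ , +-cancelˡ-≡ d t (i + j) (trans e (+-assoc d i j)) , v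
... | inj₁ v with split-sum lp lq t≤
...   | i , j , i≤ , j≤ , refl = i , j , i≤ , j≤ , refl , ≤-antisym
  (≤-trans (≤-reflexive (trans v (fresh t≤))) z≤n)
  (subst (λ a → H (p + i) + H (q + j) ≤ H′ a) (+-assoc d i j) (bound c i≤ j≤ tt))

optimal-convolution : ∀ {H d p lp q lq H′ Φ Ψ} → Optimal H p lp Φ → Optimal H q lq Ψ →
  (∀ {t} → t ≤ lp + lq → H (d + t) ≡ 0) → Convolved H d p lp q lq Everywhere H′ →
  Optimal H′ d (lp + lq) (Φ ⊕ Ψ)
optimal-convolution o o′ fresh c .sound t≤ with convolution-value c fresh t≤
... | i , j , i≤ , j≤ , e , v = i , _ , j , _ , sound o i≤ , sound o′ j≤ , e , v
optimal-convolution {d = d} {H′ = H′} o o′ fresh c .complete (b₁ , _ , b₂ , _ , φ , ψ , refl , refl)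
  with complete o φ | complete o′ ψ
... | b₁≤ , x₁≤ | b₂≤ , x₂≤ = +-mono-≤ b₁≤ b₂≤ ,
  ≤-trans (+-mono-≤ x₁≤ x₂≤) (≤-trans (bound c b₁≤ b₂≤ tt) (≤-reflexive (cong H′ (+-assoc d b₁ b₂))))

-- Weights of sets of vertices

weigh : ∀ {n} → (Fin n → ℕ) → Subset n → ℕ
weigh w []          = 0
weigh w (true ∷ C)  = w zero + weigh (w ∘ suc) C
weigh w (false ∷ C) = weigh (w ∘ suc) C

weigh-∅ : ∀ {n} (w : Fin n → ℕ) → weigh w ∅ ≡ 0
weigh-∅ {zero}  w = refl
weigh-∅ {suc n} w = weigh-∅ (w ∘ suc)

weigh-⁅⁆ : ∀ {n} (w : Fin n → ℕ) v → weigh w ⁅ v ⁆ ≡ w v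
weigh-⁅⁆ w zero    = trans (cong (w zero +_) (weigh-∅ (w ∘ suc))) (+-identityʳ _)
weigh-⁅⁆ w (suc v) = weigh-⁅⁆ (w ∘ suc) v

empty-tail : ∀ {n} x y {C D : Subset n} → Empty ((x ∷ C) ∩ (y ∷ D)) → Empty (C ∩ D)
empty-tail x y e (v , v∈) = e (suc v , there v∈)

weigh-∪ : ∀ {n} (w : Fin n → ℕ) C D → Empty (C ∩ D) → weigh w (C ∪ D) ≡ weigh w C + weigh w D
weigh-∪ w []          []          e = refl
weigh-∪ w (true ∷ C)  (true ∷ D)  e = ⊥-elim (e (zero , here))
weigh-∪ w (true ∷ C)  (false ∷ D) e =
  trans (cong (w zero +_) (weigh-∪ (w ∘ suc) C D (empty-tail true false e))) (sym (+-assoc (w zero) _ _))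
weigh-∪ w (false ∷ C) (true ∷ D)  e =
  trans (cong (w zero +_) (weigh-∪ (w ∘ suc) C D (empty-tail false true e)))
    (solve 3 (λ a b c → a :+ (b :+ c) := b :+ (a :+ c)) refl (w zero) (weigh (w ∘ suc) C) (weigh (w ∘ suc) D))
  where open +-*-Solver
weigh-∪ w (false ∷ C) (false ∷ D) e = weigh-∪ (w ∘ suc) C D (empty-tail false false e)

weigh-∈ : ∀ {n} (w : Fin n → ℕ) C {v} → v ∈ₛ C → w v ≤ weigh w C
weigh-∈ w (true ∷ C)  here       = m≤m+n _ _
weigh-∈ w (true ∷ C)  (there v∈) = ≤-trans (weigh-∈ (w ∘ suc) C v∈) (m≤n+m _ (w zero))
weigh-∈ w (false ∷ C) (there v∈) = weigh-∈ (w ∘ suc) C v∈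

weigh-mono : ∀ {n} (w : Fin n → ℕ) C D → C ⊆ D → weigh w C ≤ weigh w D
weigh-mono w []          []          s = z≤n
weigh-mono w (true ∷ C)  (true ∷ D)  s = +-monoʳ-≤ (w zero) (weigh-mono (w ∘ suc) C D (drop-∷-⊆ s))
weigh-mono w (true ∷ C)  (false ∷ D) s with s here
... | ()
weigh-mono w (false ∷ C) (true ∷ D)  s = ≤-trans (weigh-mono (w ∘ suc) C D (drop-∷-⊆ s)) (m≤n+m _ (w zero))
weigh-mono w (false ∷ C) (false ∷ D) s = weigh-mono (w ∘ suc) C D (drop-∷-⊆ s)

weigh-positive : ∀ {n} (w : Fin n → ℕ) C → weigh w C ≢ 0 → ∃[ v ] v ∈ₛ C × w v ≢ 0
weigh-positive w []          p = ⊥-elim (p refl)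
weigh-positive w (false ∷ C) p with weigh-positive (w ∘ suc) C p
... | v , v∈ , q = suc v , there v∈ , q
weigh-positive w (true ∷ C)  p with w zero in eq
... | suc _ = zero , here , λ q → case trans (sym eq) q of λ ()
... | zero with weigh-positive (w ∘ suc) C p
... | v , v∈ , q = suc v , there v∈ , q

weigh-+ : ∀ {n} (w w′ : Fin n → ℕ) C → weigh (λ v → w v + w′ v) C ≡ weigh w C + weigh w′ C
weigh-+ w w′ []          = refl
weigh-+ w w′ (false ∷ C) = weigh-+ (w ∘ suc) (w′ ∘ suc) C
weigh-+ w w′ (true ∷ C)  = trans (cong (w zero + w′ zero +_) (weigh-+ (w ∘ suc) (w′ ∘ suc) C))
  (solve 4 (λ a b c d → a :+ b :+ (c :+ d) := a :+ c :+ (b :+ d)) refl (w zero) (w′ zero) (weigh (w ∘ suc) C) (weigh (w′ ∘ suc) C))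
  where open +-*-Solver

weigh-* : ∀ {n} (w : Fin n → ℕ) k C → weigh (λ v → w v * k) C ≡ weigh w C * k
weigh-* w k []          = refl
weigh-* w k (false ∷ C) = weigh-* (w ∘ suc) k C
weigh-* w k (true ∷ C)  =
  trans (cong (w zero * k +_) (weigh-* (w ∘ suc) k C)) (sym (*-distribʳ-+ k (w zero) (weigh (w ∘ suc) C)))

weigh-cong : ∀ {n} {w w′ : Fin n → ℕ} C → (∀ {v} → v ∈ₛ C → w v ≡ w′ v) → weigh w C ≡ weigh w′ C
weigh-cong []          e = refl
weigh-cong (true ∷ C)  e = cong₂ _+_ (e here) (weigh-cong C (e ∘ there))
weigh-cong (false ∷ C) e = weigh-cong C (e ∘ there)

weigh-1 : ∀ {n} (C : Subset n) → weigh (λ _ → 1) C ≡ ∣ C ∣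
weigh-1 []          = refl
weigh-1 (true ∷ C)  = cong suc (weigh-1 C)
weigh-1 (false ∷ C) = weigh-1 C

indicator : ∀ {n} → Subset n → Fin n → ℕ
indicator P v = if lookup P v then 1 else 0

indicator-∈ : ∀ {n} {P : Subset n} {v} → v ∈ₛ P → indicator P v ≡ 1
indicator-∈ v∈ = cong (if_then 1 else 0) ([]=⇒lookup v∈)

indicator-∉ : ∀ {n} {P : Subset n} {v} → v ∉ P → indicator P v ≡ 0
indicator-∉ {P = P} {v} v∉ with lookup P v in eq
... | false = refl
... | true  = ⊥-elim (v∉ (lookup⇒[]= v P eq))

indicator⇒∈ : ∀ {n} {P : Subset n} {v} → indicator P v ≢ 0 → v ∈ₛ P
indicator⇒∈ {P = P} {v} p with lookup P v in eq
... | true  = lookup⇒[]= v P eq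
... | false = ⊥-elim (p refl)

weigh-indicator : ∀ {n} (P C : Subset n) → weigh (indicator P) C ≡ ∣ C ∩ P ∣
weigh-indicator []          []          = refl
weigh-indicator (true ∷ P)  (true ∷ C)  = cong suc (weigh-indicator P C)
weigh-indicator (false ∷ P) (true ∷ C)  = weigh-indicator P C
weigh-indicator (p ∷ P)     (false ∷ C) = weigh-indicator P C

choose : ∀ {n} (P S : Subset n) b → b ≤ weigh (indicator P) S →
  ∃[ C ] C ⊆ S × C ⊆ P × weigh (indicator P) C ≡ b
choose P S zero    b≤ = ∅ , (⊥-elim ∘ ∉⊥) , (⊥-elim ∘ ∉⊥) , weigh-∅ (indicator P)
choose []          []          (suc b) ()
choose (p ∷ P)     (false ∷ S) (suc b) b≤ with choose P S (suc b) b≤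
... | C , c , d , e = false ∷ C , s⊆s c , out⊆ d , e
choose (false ∷ P) (true ∷ S)  (suc b) b≤ with choose P S (suc b) b≤
... | C , c , d , e = false ∷ C , out⊆ c , s⊆s d , e
choose (true ∷ P)  (true ∷ S)  (suc b) (s≤s b≤) with choose P S b b≤
... | C , c , d , e = true ∷ C , s⊆s c , s⊆s d , cong suc e

-- Bicliques of a partitioned vertex set

module _ {n : ℕ} (G : BipartiteGraph n) where
  open BipartiteGraph G

  Clique : Subset n → Set
  Clique C = ∀ {u v} → u ∈ₛ C → u ∈ₛ B → v ∈ₛ C → v ∉ B → v ∈ₛ N u

  -- The number of white vertices and the vertices themselves can both be read
  -- off the total weight of a set.
  weight : Fin n → ℕ
  weight v = indicator W v * 2 ^ n + 2 ^ (n ∸ suc (toℕ v))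

  blacks total : Subset n → ℕ
  blacks = weigh (indicator B)
  total  = weigh weight

  record Candidate (S : Subset n) (q b x : ℕ) : Set where
    field
      {set}      : Subset n
      inside-S   : set ⊆ S
      clique     : Clique set
      only-black : q ≡ 0 → set ⊆ B
      blacks-≡   : blacks set ≡ b
      total-≡    : total set ≡ x
  open Candidate public

  -- One adjacent pair decides for all, which is what makes a test on representatives conclusive.
  Uniform : Subset n → Subset n → Set
  Uniform X Y = ∀ {u u′ v v′} → u ∈ₛ X → u ∈ₛ B → u′ ∈ₛ X → u′ ∈ₛ B →
    v ∈ₛ Y → v ∉ B → v′ ∈ₛ Y → v′ ∉ B → v ∈ₛ N u → v′ ∈ₛ N u′

  union : (ℕ → Subset n) → ℕ → Subset n
  union V zero    = ∅
  union V (suc i) = union V i ∪ V i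

  ∈-union⁻ : ∀ V i {v} → v ∈ₛ union V i → ∃[ j ] j < i × v ∈ₛ V j
  ∈-union⁻ V zero    v∈ = ⊥-elim (∉⊥ v∈)
  ∈-union⁻ V (suc i) v∈ with x∈p∪q⁻ (union V i) (V i) v∈
  ... | inj₂ p = i , ≤-refl , p
  ... | inj₁ p with ∈-union⁻ V i p
  ...   | j , j< , q = j , m<n⇒m<1+n j< , q

  ∈-union⁺ : ∀ V {i j v} → j < i → v ∈ₛ V j → v ∈ₛ union V i
  ∈-union⁺ V {suc i} (s≤s j≤) v∈ with m≤n⇒m<n∨m≡n j≤
  ... | inj₁ j<   = x∈p∪q⁺ (inj₁ (∈-union⁺ V j< v∈))
  ... | inj₂ refl = x∈p∪q⁺ (inj₂ v∈)

  PairwiseDisjoint : (ℕ → Subset n) → ℕ → Set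
  PairwiseDisjoint V m = ∀ {i j v} → i < m → j < m → v ∈ₛ V i → v ∈ₛ V j → i ≡ j

  black-in : ∀ {C v} → v ∈ₛ C → v ∈ₛ B → blacks C ≢ 0
  black-in {C} {v} v∈ b e = case subst (1 ≤_) e (subst (_≤ blacks C) (indicator-∈ b) (weigh-∈ (indicator B) C v∈)) of λ ()

  black-out : ∀ C → blacks C ≢ 0 → ∃[ v ] v ∈ₛ C × v ∈ₛ B
  black-out C p with weigh-positive (indicator B) C p
  ... | v , v∈ , q = v , v∈ , indicator⇒∈ q

  weight-positive : ∀ v → weight v ≢ 0
  weight-positive v e = m^n≢0′ (n ∸ suc (toℕ v)) (m+n≡0⇒n≡0 (indicator W v * 2 ^ n) e)
    where
    m^n≢0′ : ∀ k → 2 ^ k ≢ 0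
    m^n≢0′ k p = case subst (1 ≤_) p (m^n>0 2 k) of λ ()

  disjoint-sum : ∀ {V m i C₁ C₂} (w : Fin n → ℕ) → PairwiseDisjoint V m → i < m →
    C₁ ⊆ union V i → C₂ ⊆ V i → weigh w (C₁ ∪ C₂) ≡ weigh w C₁ + weigh w C₂
  disjoint-sum {V} {i = i} {C₁} {C₂} w disj i<m s₁ s₂ = weigh-∪ w C₁ C₂ λ (v , v∈) →
    let v∈₁ , v∈₂ = x∈p∩q⁻ C₁ C₂ v∈
        j , j<i , v∈j = ∈-union⁻ V i (s₁ v∈₁)
    in <-irrefl (disj (<-trans j<i i<m) i<m v∈j (s₂ v∈₂)) j<i

  -- X j = 0 forbids black vertices in the part j, and al j = 0 forbids white ones.
  record Fits (X al : ℕ → ℕ) (j : ℕ) (D : Subset n) : Set where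
    constructor fits
    field
      fit-clique : Clique D
      fit-black  : ∀ {v} → v ∈ₛ D → v ∈ₛ B → X j ≢ 0
      fit-white  : al j ≡ 0 → D ⊆ B
  open Fits public

  fits-⊆ : ∀ {X al j C D} → C ⊆ D → Fits X al j D → Fits X al j C
  fits-⊆ s (fits c b w) = fits (λ u∈ ub v∈ → c (s u∈) ub (s v∈)) (λ v∈ → b (s v∈)) (λ e v∈ → w e (s v∈))

  -- Adjacency between different parts is absent here; it is recovered from the permissions in
  -- `prefix-candidate`. Each part is thus constrained on its own, and adding a part is a plain
  -- convolution.
  record Prefix (V : ℕ → Subset n) (X al : ℕ → ℕ) (i b x : ℕ) : Set where
    field
      {pset}    : Subset n
      pinside   : pset ⊆ union V i
      pfits     : ∀ {j} → j < i → Fits X al j (pset ∩ V j)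
      pblacks-≡ : blacks pset ≡ b
      ptotal-≡  : total pset ≡ x
  open Prefix public

  prefix-zero : ∀ {V X al} → Prefix V X al 0 0 0
  prefix-zero = record
    { pset = ∅ ; pinside = id ; pfits = λ () ; pblacks-≡ = weigh-∅ (indicator B) ; ptotal-≡ = weigh-∅ weight }

  prefix-zero⁻ : ∀ {V X al b x} → Prefix V X al 0 b x → b ≡ 0 × x ≡ 0
  prefix-zero⁻ p with ⊆-antisym (pinside p) (⊥-elim ∘ ∉⊥)
  ... | e = trans (sym (pblacks-≡ p)) (trans (cong blacks e) (weigh-∅ (indicator B))) ,
            trans (sym (ptotal-≡ p)) (trans (cong total e) (weigh-∅ weight))

  Limited : (S : Subset n) (X al lb : ℕ) → Family
  Limited S X al lb b x = b ≤ lb × Candidate S al b x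

  prefix-suc : ∀ {V X al i m lb b x} → PairwiseDisjoint V m → i < m → (X i ≡ 0 → lb ≡ 0) →
    (Prefix V X al i ⊕ Limited (V i) (X i) (al i) lb) b x → Prefix V X al (suc i) b x
  prefix-suc {V} {X} {al} {i} {m} {lb} disj i<m lb-0 (b₁ , x₁ , b₂ , x₂ , p , (b₂≤ , k) , refl , refl) = record
    { pset      = pset p ∪ set k
    ; pinside   = λ v∈ → x∈p∪q⁺ ([ inj₁ ∘ pinside p , inj₂ ∘ inside-S k ]′ (x∈p∪q⁻ (pset p) (set k) v∈))
    ; pfits     = fits′
    ; pblacks-≡ = trans (disjoint-sum (indicator B) disj i<m (pinside p) (inside-S k)) (cong₂ _+_ (pblacks-≡ p) (blacks-≡ k))
    ; ptotal-≡  = trans (disjoint-sum weight disj i<m (pinside p) (inside-S k)) (cong₂ _+_ (ptotal-≡ p) (total-≡ k))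
    }
    where
    last : Fits X al i (set k)
    last = fits (clique k)
      (λ v∈ vb e → black-in v∈ vb (trans (blacks-≡ k) (n≤0⇒n≡0 (subst (b₂ ≤_) (lb-0 e) b₂≤))))
      (only-black k)
    fits′ : ∀ {j} → j < suc i → Fits X al j ((pset p ∪ set k) ∩ V j)
    fits′ {j} (s≤s j≤) with m≤n⇒m<n∨m≡n j≤
    ... | inj₁ j<i = fits-⊆ (λ v∈ → let v∈′ , v∈j = x∈p∩q⁻ (pset p ∪ set k) (V j) v∈ in
      case x∈p∪q⁻ (pset p) (set k) v∈′ of λ
        { (inj₁ v∈p) → x∈p∩q⁺ (v∈p , v∈j)
        ; (inj₂ v∈k) → ⊥-elim (<-irrefl (disj (<-trans j<i i<m) i<m v∈j (inside-S k v∈k)) j<i) }) (pfits p j<i)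
    ... | inj₂ refl = fits-⊆ (λ v∈ → let v∈′ , v∈j = x∈p∩q⁻ (pset p ∪ set k) (V j) v∈ in
      case x∈p∪q⁻ (pset p) (set k) v∈′ of λ
        { (inj₂ v∈k) → v∈k
        ; (inj₁ v∈p) → let l , l<i , v∈l = ∈-union⁻ V i (pinside p v∈p) in
            ⊥-elim (<-irrefl (disj (<-trans l<i i<m) i<m v∈l v∈j) l<i) }) last

  -- The limit `lb` is the only way in which X acts on the block of a part. If the share of the part
  -- has no black vertex, every limit admits it; otherwise X contains the part and the limit is the
  -- full length.
  prefix-suc⁻ : ∀ {V X al i m lb b x} → PairwiseDisjoint V m → i < m → (X i ≢ 0 → lb ≡ blacks (V i)) →
    Prefix V X al (suc i) b x → (Prefix V X al i ⊕ Limited (V i) (X i) (al i) lb) b x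
  prefix-suc⁻ {V} {X} {al} {i} {m} {lb} disj i<m lb-1 p =
    _ , _ , _ , _ ,
    record { pset = C₁ ; pinside = p∩q⊆q (pset p) (union V i) ; pblacks-≡ = refl ; ptotal-≡ = refl
           ; pfits = λ {j} j<i → fits-⊆ (λ v∈ → let v∈₁ , v∈j = x∈p∩q⁻ C₁ (V j) v∈ in
               x∈p∩q⁺ (p∩q⊆p (pset p) (union V i) v∈₁ , v∈j)) (pfits p (m<n⇒m<1+n j<i)) } ,
    (b₂≤ ,
     record { set = C₂ ; inside-S = p∩q⊆q (pset p) (V i) ; clique = fit-clique f
            ; only-black = fit-white f ; blacks-≡ = refl ; total-≡ = refl }) ,
    trans (sym (pblacks-≡ p)) (divided (indicator B)) ,
    trans (sym (ptotal-≡ p)) (divided weight)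
    where
    C₁ = pset p ∩ union V i
    C₂ = pset p ∩ V i
    f  = pfits p (n<1+n i)
    covers : pset p ≡ C₁ ∪ C₂
    covers = trans (⊆-antisym (λ v∈ → x∈p∩q⁺ (v∈ , pinside p v∈)) (p∩q⊆p (pset p) _)) (∩-distribˡ-∪ _ _ _)
    divided : ∀ w → weigh w (pset p) ≡ weigh w C₁ + weigh w C₂
    divided w = trans (cong (weigh w) covers)
      (disjoint-sum w disj i<m (p∩q⊆q (pset p) (union V i)) (p∩q⊆q (pset p) (V i)))
    b₂≤ : blacks C₂ ≤ lb
    b₂≤ with blacks C₂ ℕ.≟ 0
    ... | yes e = ≤-trans (≤-reflexive e) z≤n
    ... | no ne with black-out C₂ ne
    ...   | v , v∈ , vb = subst (blacks C₂ ≤_) (sym (lb-1 (fit-black f v∈ vb)))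
      (weigh-mono (indicator B) C₂ (V i) (p∩q⊆q (pset p) (V i)))

  -- E j i tells whether the black vertices of part j are adjacent to the white
  -- vertices of part i.
  record Linked (V : ℕ → Subset n) (m : ℕ) (E : ℕ → ℕ → ℕ) : Set where
    field
      link    : ∀ {i j u v} → i < m → j < m → j ≢ i → E j i ≢ 0 → u ∈ₛ V j → u ∈ₛ B → v ∈ₛ V i → v ∉ B → v ∈ₛ N u
      no-link : ∀ {i j u v} → i < m → j < m → j ≢ i → E j i ≡ 0 → u ∈ₛ V j → u ∈ₛ B → v ∈ₛ V i → v ∉ B → v ∉ N u
  open Linked public

  record Allowed (m : ℕ) (E : ℕ → ℕ → ℕ) (q : ℕ) (X : ℕ → ℕ) (i a : ℕ) : Set where
    field
      allowed   : a ≢ 0 → q ≢ 0 × (∀ {j} → j < m → j ≢ i → X j ≢ 0 → E j i ≢ 0)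
      forbidden : a ≡ 0 → q ≡ 0 ⊎ (∃[ j ] j < m × j ≢ i × X j ≢ 0 × E j i ≡ 0)
  open Allowed public

  -- Sound for every X: a white vertex in part i presupposes permission, hence adjacency to all
  -- other parts of X, while a black vertex in part j presupposes that j belongs to X.
  prefix-candidate : ∀ {V m E q X al b x} → Linked V m E → (∀ {i} → i < m → Allowed m E q X i (al i)) →
    Prefix V X al m b x → Candidate (union V m) q b x
  prefix-candidate {V} {m} {E} {q} {X} {al} L A p = record
    { set = pset p ; inside-S = pinside p ; clique = clique′ ; only-black = black′
    ; blacks-≡ = pblacks-≡ p ; total-≡ = ptotal-≡ p }
    where
    clique′ : Clique (pset p)
    clique′ {u} {v} u∈ ub v∈ vw with ∈-union⁻ V m (pinside p u∈) | ∈-union⁻ V m (pinside p v∈)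
    ... | j , j< , u∈j | i , i< , v∈i with j ℕ.≟ i
    ... | yes refl = fit-clique (pfits p j<) (x∈p∩q⁺ (u∈ , u∈j)) ub (x∈p∩q⁺ (v∈ , v∈i)) vw
    ... | no j≢i = link L i< j< j≢i
      (proj₂ (allowed (A i<) (λ e → vw (fit-white (pfits p i<) e (x∈p∩q⁺ (v∈ , v∈i))))) j< j≢i
        (fit-black (pfits p j<) (x∈p∩q⁺ (u∈ , u∈j)) ub)) u∈j ub v∈i vw
    black′ : q ≡ 0 → pset p ⊆ B
    black′ e v∈ with ∈-union⁻ V m (pinside p v∈)
    ... | i , i< , v∈i with al i ℕ.≟ 0
    ... | yes z = fit-white (pfits p i<) z (x∈p∩q⁺ (v∈ , v∈i))
    ... | no nz = ⊥-elim (proj₁ (allowed (A i<) nz) e)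

  -- Here X has to be exact. When white vertices of part i are forbidden on account of some j in X,
  -- an actual black vertex in part j is the witness that the clique has no white vertex in part i.
  candidate-prefix : ∀ {V m E q X al b x} → Linked V m E → (∀ {i} → i < m → Allowed m E q X i (al i)) →
    (k : Candidate (union V m) q b x) → (∀ {j} → j < m → blacks (set k ∩ V j) ≢ 0 → X j ≢ 0) →
    (∀ {j} → j < m → X j ≢ 0 → blacks (set k ∩ V j) ≢ 0) → Prefix V X al m b x
  candidate-prefix {V} {m} {E} {q} {X} {al} L A k X⁺ X⁻ = record
    { pset = C ; pinside = inside-S k ; pblacks-≡ = blacks-≡ k ; ptotal-≡ = total-≡ k
    ; pfits = λ {j} j< → fits
        (λ u∈ ub v∈ vw → clique k (p∩q⊆p C (V j) u∈) ub (p∩q⊆p C (V j) v∈) vw)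
        (λ v∈ vb → X⁺ j< (black-in v∈ vb))
        (λ e → white j< e) }
    where
    C = set k
    white : ∀ {i} → i < m → al i ≡ 0 → C ∩ V i ⊆ B
    white {i} i< e {v} v∈ with v ∈? B
    ... | yes vb = vb
    ... | no vw with forbidden (A i<) e
    ...   | inj₁ q0 = only-black k q0 (p∩q⊆p C (V i) v∈)
    ...   | inj₂ (j , j< , j≢i , Xj , e0) with black-out _ (X⁻ j< Xj)
    ...     | u , u∈ , ub = ⊥-elim (no-link L i< j< j≢i e0 (p∩q⊆q C (V j) u∈) ub (p∩q⊆q C (V i) v∈) vw
      (clique k (p∩q⊆p C (V j) u∈) ub (p∩q⊆p C (V i) v∈) vw))

  black-candidate : ∀ S q b → b ≤ blacks S → ∃[ x ] Candidate S q b x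
  black-candidate S q b b≤ with choose B S b b≤
  ... | C , C⊆S , C⊆B , e = _ , record
    { set = C ; inside-S = C⊆S ; clique = λ _ _ v∈ vw → ⊥-elim (vw (C⊆B v∈)) ; only-black = λ _ → C⊆B
    ; blacks-≡ = e ; total-≡ = refl }

  white-candidate : ∀ S → Candidate S 1 0 (total (S ∩ W))
  white-candidate S = record
    { set = S ∩ W ; inside-S = p∩q⊆p S W
    ; clique = λ u∈ ub _ _ → ⊥-elim (x∈∁p⇒x∉p (p∩q⊆q S W u∈) ub)
    ; only-black = λ ()
    ; blacks-≡ = none ; total-≡ = refl }
    where
    none : blacks (S ∩ W) ≡ 0
    none with blacks (S ∩ W) ℕ.≟ 0
    ... | yes e = e
    ... | no ne with black-out _ ne
    ...   | v , v∈ , vb = ⊥-elim (x∈∁p⇒x∉p (p∩q⊆q S W v∈) vb)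

  white-value : ∀ {H p l S v} → Optimal H p l (Candidate S 1) → v ∈ₛ S → v ∉ B → H p ≢ 0
  white-value {H} {p} {l} {S} {v} o v∈ vw e with complete o (white-candidate S)
  ... | _ , x≤ = weight-positive v (n≤0⇒n≡0 (≤-trans (weigh-∈ weight (S ∩ W) (x∈p∩q⁺ (v∈ , x∉p⇒x∈∁p vw)))
    (≤-trans x≤ (≤-reflexive (trans (cong H (+-identityʳ p)) e)))))

  value-white : ∀ {H p l S} → Optimal H p l (Candidate S 1) → H p ≢ 0 → ∃[ v ] v ∈ₛ S × v ∉ B
  value-white {H} {p} o nz with sound o {0} z≤n
  ... | k with weigh-positive weight (set k) (λ e → nz (trans (cong H (sym (+-identityʳ p))) (trans (sym (total-≡ k)) e)))
  ... | v , v∈ , _ = v , inside-S k v∈ , λ vb → black-in v∈ vb (blacks-≡ k)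

-- Data that survive the combination of items

-- The arrays from `adj` to `wrep`: the input graph and the descriptions of the items, but neither
-- heap and registers nor the scratch arrays.
static : ℕ → Bool
static a = (1 <ᵇ a) ∧ (a <ᵇ 10)

record Static (s s′ : State) : Set where
  constructor static-by
  field
    same : ∀ a k → T (static a) → arr s′ a k ≡ arr s a k
open Static public

static-refl : ∀ {s} → Static s s
static-refl .same _ _ _ = refl

static-trans : ∀ {s s′ s″} → Static s s′ → Static s′ s″ → Static s s″
static-trans p q .same a k t = trans (same q a k t) (same p a k t)

keeps : Cmd → Bool
keeps skip           = true
keeps (c ⨟ d)        = keeps c ∧ keeps d
keeps (assign a _ _) = not (static a)
keeps (get a _)      = not (static a)
keeps (put _)        = true
keeps (when _ c d)   = keeps c ∧ keeps d
keeps (bind _ _ c)   = keeps c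
keeps (loop _ _ c)   = keeps c

static-write : ∀ m b i x a k → T (not (static b)) → T (static a) → (m [ b · i ↦ x ]) a k ≡ m a k
static-write m b i x a k p q with b ≡ᵇ a in eq
... | false = refl
... | true with ≡ᵇ⇒≡ b a (subst T (sym eq) tt)
... | refl with static a
static-write m b i x a k () q | true | refl | true
static-write m b i x a k p () | true | refl | false

keeps-static : ∀ c ρ s → T (keeps c) → Static s (run c ρ s)
keeps-static skip           ρ s p = static-refl
keeps-static (c ⨟ d)        ρ s p = static-trans (keeps-static c ρ s (proj₁ (∧⁻ p))) (keeps-static d ρ _ (proj₂ (∧⁻ {keeps c} p)))
keeps-static (assign b i e) ρ s p .same a k q = static-write (arr s) b (eval i ρ (arr s)) (eval e ρ (arr s)) a k p q
keeps-static (get b i)      ρ s p .same a k q = static-write (arr s) b (eval i ρ (arr s)) (hd (inp s)) a k p q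
keeps-static (put e)        ρ s p = static-by λ _ _ _ → refl
keeps-static (when e c d)   ρ s p with eval e ρ (arr s)
... | zero  = keeps-static d ρ s (proj₂ (∧⁻ {keeps c} p))
... | suc _ = keeps-static c ρ s (proj₁ (∧⁻ p))
keeps-static (bind x e c)   ρ s p = keeps-static c _ s p
keeps-static (loop x e c)   ρ s p = rounds (eval e ρ (arr s))
  where
  rounds : ∀ k → Static s (iter k (λ i → run c (ρ [ x ↦ i ])) s)
  rounds zero    = static-refl
  rounds (suc k) = static-trans (rounds k) (keeps-static c _ _ p)

record Preserved (c : Cmd) (s s′ : State) : Set where
  field
    fixed  : ∀ a k → mayWrite c a k ≡ false → arr s′ a k ≡ arr s a k
    keep   : T (keeps c) → Static s s′
open Preserved public

loop-rule⁺ : ∀ (I : ℕ → State → Set) x e c ρ s n b → eval e ρ (arr s) ≡ n → I 0 s →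
  (∀ i s′ → i < n → Preserved c s s′ → I i s′ → I (suc i) (run c (ρ [ x ↦ i ]) s′) × cost c (ρ [ x ↦ i ]) s′ ≤ b) →
  I n (run (loop x e c) ρ s) × cost (loop x e c) ρ s ≤ costE e + 6 + n * (b + 4)
loop-rule⁺ I x e c ρ s n b eq base step
  with loop-rule (λ i s′ → Preserved c s s′ × I i s′) x e c ρ s n b eq
    (record { fixed = λ _ _ _ → refl ; keep = λ _ → static-refl } , base)
    (λ i s′ i< (p , inv) → let inv′ , c≤ = step i s′ i< p inv in
      (record { fixed = λ a k q → trans (frame c a k q _ s′) (fixed p a k q)
              ; keep  = λ q → static-trans (keep p q) (keeps-static c _ s′ q) } , inv′) , c≤)
... | (_ , inv) , c≤ = inv , c≤

-- Permission for white vertices and one step of the accumulation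

allowance : (E : ℕ → ℕ → ℕ) (q : ℕ) (X : ℕ → ℕ) (i m : ℕ) → ℕ
allowance E q X i zero    = q
allowance E q X i (suc j) =
  branch (X j) (branch ((i ∸ j) + (j ∸ i)) (branch (E j i) (allowance E q X i j) 0) (allowance E q X i j))
    (allowance E q X i j)

allowance-≤ : ∀ E q X i m → allowance E q X i m ≤ q
allowance-≤ E q X i zero    = ≤-refl
allowance-≤ E q X i (suc j) with X j | (i ∸ j) + (j ∸ i) | E j i
... | zero  | _     | _     = allowance-≤ E q X i j
... | suc _ | zero  | _     = allowance-≤ E q X i j
... | suc _ | suc _ | zero  = z≤n
... | suc _ | suc _ | suc _ = allowance-≤ E q X i j

-- If part j has no black or part i no white vertex, a representative is missing and the number read
-- is arbitrary; `Linked` is then vacuous for this pair.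
edges : State → ℕ → ℕ → ℕ → ℕ
edges s d j i = arr s adj (arr s brep (d + j) + arr s wrep (d + i))

Allows : Env → State → ℕ → ℕ → ℕ
Allows ρ s i m = allowance (edges s (ρ 4)) (ρ 5) (arr s pat) i m

allow-correct : ∀ ρ s →
  arr (run allow ρ s) reg rAL ≡ Allows ρ s (ρ 7) (ρ 3) × cost allow ρ s ≤ 40 + ρ 3 * 100
allow-correct ρ s =
  let p , q = loop-rule⁺ (λ j s′ → arr s′ reg rAL ≡ Allows ρ s (ρ 7) j)
        8 (var 3) body ρ s₁ (ρ 3) 96 refl refl round
  in p , ≤-trans (+-monoʳ-≤ (costE (lit 3) + costE (var 5) + 7) q) (≤-trans (m≤m+n (18 + ρ 3 * 100) 22) (≤-reflexive (+-comm _ 22)))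
  where
  body = when (pat at var 8)
    (when ((var 7 ⊟ var 8) ⊞ (var 8 ⊟ var 7))
      (when (adj at (brep at (var 4 ⊞ var 8) ⊞ wrep at (var 4 ⊞ var 7))) skip (set-reg rAL (lit 0)))
      skip)
    skip
  s₁ = run (set-reg rAL (var 5)) ρ s
  round : ∀ j s′ → j < ρ 3 → Preserved body s₁ s′ → arr s′ reg rAL ≡ Allows ρ s (ρ 7) j →
    arr (run body (ρ [ 8 ↦ j ]) s′) reg rAL ≡ Allows ρ s (ρ 7) (suc j) × cost body (ρ [ 8 ↦ j ]) s′ ≤ 96
  round j s′ _ p inv
    with arr s′ pat j | fixed p pat j refl
       | (ρ 7 ∸ j) + (j ∸ ρ 7)
       | arr s′ adj (arr s′ brep (ρ 4 + j) + arr s′ wrep (ρ 4 + ρ 7))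
       | trans (cong (arr s′ adj) (cong₂ _+_ (fixed p brep (ρ 4 + j) refl) (fixed p wrep (ρ 4 + ρ 7) refl))) (fixed p adj _ refl)
  ... | zero  | eq | _     | _ | _ rewrite sym eq = inv , ≤ᵇ⇒≤ _ _ tt
  ... | suc _ | eq | zero  | _ | _ rewrite sym eq = inv , ≤ᵇ⇒≤ _ _ tt
  ... | suc _ | eq | suc _ | zero  | eq′ rewrite sym eq | sym eq′ = refl , ≤ᵇ⇒≤ _ _ tt
  ... | suc _ | eq | suc _ | suc _ | eq′ rewrite sym eq | sym eq′ = inv , ≤ᵇ⇒≤ _ _ tt

allowance-cong : ∀ {E E′ X X′} q i m → (∀ j → E j i ≡ E′ j i) → (∀ j → X j ≡ X′ j) →
  allowance E q X i m ≡ allowance E′ q X′ i m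
allowance-cong q i zero    e x = refl
allowance-cong {E} {E′} {X} {X′} q i (suc j) e x
  rewrite e j | x j | allowance-cong {E} {E′} {X} {X′} q i j e x = refl

limit : Cmd
limit = when (pat at var 7) (set-reg rLB (len at (var 4 ⊞ var 7))) (set-reg rLB (lit 0))

-- To be used with the numbers of black vertices in the first i parts and in part i. `products` then
-- bounds every convolution of the accumulation, and `sums` the final copying into the target.
record Measure (M m : ℕ) (f g : ℕ → ℕ) : Set where
  field
    products : ∀ {i} → i < m → suc (f i) * suc (g i) ≤ M
    sums     : ∀ {i} → i ≤ m → suc (f i) ≤ M
open Measure public

module _ {n : ℕ} (G : BipartiteGraph n) where
  open BipartiteGraph G

  allowance-allowed : ∀ E q X i m → Allowed G m E q X i (allowance E q X i m)
  allowance-allowed E q X i zero .allowed   nz = nz , λ ()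
  allowance-allowed E q X i zero .forbidden e  = inj₁ e
  allowance-allowed E q X i (suc m) with X m in x | (i ∸ m) + (m ∸ i) in d | E m i in e | allowance-allowed E q X i m
  ... | suc _ | suc _ | zero  | _ = record
    { allowed   = λ z → ⊥-elim (z refl)
    ; forbidden = λ _ → inj₂ (m , ≤-refl , differ , (λ p → case trans (sym x) p of λ ()) , e) }
    where
    differ : m ≢ i
    differ refl = case trans (sym d) (cong₂ _+_ (n∸n≡0 m) (n∸n≡0 m)) of λ ()
  ... | zero  | _     | _     | a = record
    { allowed = λ nz → proj₁ (allowed a nz) , λ j< j≢ Xj → case m≤n⇒m<n∨m≡n (≤-pred j<) of λ
        { (inj₁ j<m) → proj₂ (allowed a nz) j<m j≢ Xj ; (inj₂ refl) → ⊥-elim (Xj x) }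
    ; forbidden = λ z → case forbidden a z of λ
        { (inj₁ p) → inj₁ p ; (inj₂ (j , j< , p)) → inj₂ (j , m<n⇒m<1+n j< , p) } }
  ... | suc _ | zero  | _     | a = record
    { allowed = λ nz → proj₁ (allowed a nz) , λ j< j≢ Xj → case m≤n⇒m<n∨m≡n (≤-pred j<) of λ
        { (inj₁ j<m) → proj₂ (allowed a nz) j<m j≢ Xj
        ; (inj₂ refl) → ⊥-elim (j≢ (≤-antisym (m∸n≡0⇒m≤n (m+n≡0⇒n≡0 (i ∸ m) d)) (m∸n≡0⇒m≤n (m+n≡0⇒m≡0 (i ∸ m) d)))) }
    ; forbidden = λ z → case forbidden a z of λ
        { (inj₁ p) → inj₁ p ; (inj₂ (j , j< , p)) → inj₂ (j , m<n⇒m<1+n j< , p) } }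
  ... | suc _ | suc _ | suc _ | a = record
    { allowed = λ nz → proj₁ (allowed a nz) , λ j< j≢ Xj → case m≤n⇒m<n∨m≡n (≤-pred j<) of λ
        { (inj₁ j<m) → proj₂ (allowed a nz) j<m j≢ Xj
        ; (inj₂ refl) → λ p → case trans (sym e) p of λ () }
    ; forbidden = λ z → case forbidden a z of λ
        { (inj₁ p) → inj₁ p ; (inj₂ (j , j< , p)) → inj₂ (j , m<n⇒m<1+n j< , p) } }

  -- Item s D d S: position d of the stack describes S, by blocks below address D.
  record Item (s : State) (D d : ℕ) (S : Subset n) : Set where
    field
      len-≡     : arr s len d ≡ blacks G S
      room      : ∀ {q} → q < 2 → arr s ptr (d + d + q) + blacks G S < D
      optimal   : ∀ {q} → q < 2 → Optimal (arr s heap) (arr s ptr (d + d + q)) (blacks G S) (Candidate G S q)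
      black-rep : ∀ {u} → u ∈ₛ S → u ∈ₛ B → ∃[ v ] v ∈ₛ S × v ∈ₛ B × arr s brep d ≡ toℕ v * n
      white-rep : ∀ {u} → u ∈ₛ S → u ∉ B → ∃[ v ] v ∈ₛ S × v ∉ B × arr s wrep d ≡ toℕ v
  open Item public

  record Parts (s : State) (m d D : ℕ) (V : ℕ → Subset n) : Set where
    field
      items    : ∀ {i} → i < m → Item s D (d + i) (V i)
      linked   : Linked G V m (edges s d)
      disjoint : PairwiseDisjoint G V m
      unit     : arr s heap 0 ≡ 0
      positive : 0 < D
  open Parts public

  pattern-allowance : State → (m d q : ℕ) → ℕ → ℕ
  pattern-allowance s m d q i = allowance (edges s d) q (arr s pat) i m

  -- During the accumulation blocks are only appended, so items and target remain intact. The
  -- accumulator and the target are kept apart by a disjunction because the accumulator starts at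
  -- address 0, below the target, and lies above it after the first step.
  record Building (s₀ : State) (m d q D bs : ℕ) (V : ℕ → Subset n) (i : ℕ) (s : State) : Set where
    field
      below     : ∀ {a} → a < arr s₀ reg rFP → arr s heap a ≡ arr s₀ heap a
      advanced  : arr s₀ reg rFP ≤ arr s reg rFP
      fresh     : ∀ {a} → arr s reg rFP ≤ a → arr s heap a ≡ 0
      acc-room  : arr s reg rACC + arr s reg rLA < arr s reg rFP
      acc-apart : Apart (arr s reg rACC) (arr s reg rLA) D bs
      la-≤      : arr s reg rLA ≤ blacks G (union G V i)
      acc-opt   : Optimal (arr s heap) (arr s reg rACC) (arr s reg rLA)
                    (Prefix G V (arr s₀ pat) (pattern-allowance s₀ m d q) i)
  open Building public

  module ExtendStep (ρ : Env) (s₀ s : State) (V : ℕ → Subset n) (bs : ℕ) (i : ℕ)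
    (parts : Parts s₀ (ρ 3) (ρ 4) (ρ 6) V) (q<2 : ρ 5 < 2) (i<m : i < ρ 3)
    (target : ρ 6 + bs < arr s₀ reg rFP)
    (pres : Preserved extend s₀ s) (inv : Building s₀ (ρ 3) (ρ 4) (ρ 5) (ρ 6) bs V i s)
    where

    m d q D : ℕ
    m = ρ 3
    d = ρ 4
    q = ρ 5
    D = ρ 6

    X al : ℕ → ℕ
    X  = arr s₀ pat
    al = pattern-allowance s₀ m d q

    ρ₇ = ρ [ 7 ↦ i ]
    s₁ = run allow ρ₇ s
    s₂ = run limit ρ₇ s₁
    FP = arr s reg rFP
    ACC = arr s reg rACC
    LA = arr s reg rLA

    st₁ : Static s₀ s₁
    st₁ = static-trans (keep pres tt) (keeps-static allow ρ₇ s tt)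
    st₂ : Static s₀ s₂
    st₂ = static-trans st₁ (keeps-static limit ρ₇ s₁ tt)

    edges-≡ : ∀ j → edges s d j i ≡ edges s₀ d j i
    edges-≡ j = trans (cong (arr s adj) (cong₂ _+_ (same st brep _ tt) (same st wrep _ tt))) (same st adj _ tt)
      where st = keep pres tt

    al-≡ : arr s₂ reg rAL ≡ al i
    al-≡ = trans (frame limit reg rAL refl ρ₇ s₁) (trans (proj₁ (allow-correct ρ₇ s))
      (allowance-cong q i m edges-≡ (λ j → fixed pres pat j refl)))

    lb : ℕ
    lb = branch (X i) (blacks G (V i)) 0

    lb-≡ : arr s₂ reg rLB ≡ lb
    lb-≡ with arr s₁ pat i | trans (frame allow pat i refl ρ₇ s) (fixed pres pat i refl)
    ... | zero  | e rewrite sym e = refl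
    ... | suc _ | e rewrite sym e = trans (same st₁ len _ tt) (len-≡ (items parts i<m))

    lb-≤ : lb ≤ blacks G (V i)
    lb-≤ with X i
    ... | zero  = z≤n
    ... | suc _ = ≤-refl

    lb-0 : X i ≡ 0 → lb ≡ 0
    lb-0 e rewrite e = refl

    lb-1 : X i ≢ 0 → lb ≡ blacks G (V i)
    lb-1 nz with X i
    ... | zero  = ⊥-elim (nz refl)
    ... | suc _ = refl

    heap₂ : ∀ a → arr s₂ heap a ≡ arr s heap a
    heap₂ a = trans (frame limit heap a refl ρ₇ s₁) (frame allow heap a refl ρ₇ s)

    reg₂ : ∀ r → mayWrite (allow ⨟ limit) reg r ≡ false → arr s₂ reg r ≡ arr s reg r
    reg₂ r p = frame (allow ⨟ limit) reg r p ρ₇ s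

    al<2 : al i < 2
    al<2 = ≤-<-trans (allowance-≤ _ q X i m) q<2

    Q : ℕ
    Q = arr s₀ ptr ((d + i) + (d + i) + al i)

    Q-≡ : arr s₂ ptr ((d + i) + (d + i) + arr s₂ reg rAL) ≡ Q
    Q-≡ = trans (same st₂ ptr _ tt) (cong (λ a → arr s₀ ptr ((d + i) + (d + i) + a)) al-≡)

    Q-room : Q + lb < arr s₀ reg rFP
    Q-room = <-trans (≤-<-trans (+-monoʳ-≤ Q lb-≤) (room (items parts i<m) al<2)) (≤-<-trans (m≤m+n D bs) target)

    ρ₁₂ = ρ₇ [ 8 ↦ arr s₂ reg rFP ] [ 9 ↦ arr s₂ reg rACC ] [ 10 ↦ arr s₂ reg rLA ]
             [ 11 ↦ arr s₂ ptr ((d + i) + (d + i) + arr s₂ reg rAL) ] [ 12 ↦ arr s₂ reg rLB ]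

    acc-away : Apart ACC LA FP (LA + lb)
    acc-away i≤ = inj₁ (≤-<-trans (+-monoʳ-≤ ACC i≤) (acc-room inv))

    Q-away : Apart Q lb FP (LA + lb)
    Q-away i≤ = inj₁ (<-≤-trans (≤-<-trans (+-monoʳ-≤ Q i≤) Q-room) (advanced inv))

    convolved : Convolved (arr s₂ heap) FP ACC LA Q lb Everywhere (arr (run convolve ρ₁₂ s₂) heap) ×
                cost convolve ρ₁₂ s₂ ≤ 100 * (suc LA * suc lb)
    convolved = convolve-values ρ₁₂ s₂ (reg₂ rFP refl) (reg₂ rACC refl) (reg₂ rLA refl) Q-≡ lb-≡ acc-away Q-away

    s₄ = run extend ρ₇ s

    H₄ : ∀ a → a < FP ⊎ FP + (LA + lb) < a → arr s₄ heap a ≡ arr s heap a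
    H₄ a p = trans (outside (proj₁ convolved) a p) (heap₂ a)

    Q-optimal : Optimal (arr s₂ heap) Q lb (Limited G (V i) (X i) (al i) lb)
    Q-optimal = optimal-heap
      (λ b≤ → trans (heap₂ _) (below inv (≤-<-trans (+-monoʳ-≤ Q b≤) Q-room)))
      (truncate lb-≤ (optimal (items parts i<m) al<2))

    acc₄ : arr s₄ reg rACC ≡ FP
    acc₄ = reg₂ rFP refl

    la₄ : arr s₄ reg rLA ≡ LA + lb
    la₄ = cong₂ _+_ (reg₂ rLA refl) lb-≡

    fp₄ : arr s₄ reg rFP ≡ FP + (LA + lb) + 1
    fp₄ = cong (_+ 1) (cong₂ _+_ acc₄ la₄)

    next-union : blacks G (union G V (suc i)) ≡ blacks G (union G V i) + blacks G (V i)
    next-union = disjoint-sum G (indicator B) (disjoint parts) i<m id id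

    optimal₄ : Optimal (arr s₄ heap) FP (LA + lb) (Prefix G V X al (suc i))
    optimal₄ = optimal-cong (prefix-suc G (disjoint parts) i<m lb-0) (prefix-suc⁻ G (disjoint parts) i<m lb-1)
      (optimal-convolution (optimal-heap (λ _ → heap₂ _) (acc-opt inv)) Q-optimal
        (λ {t} _ → trans (heap₂ _) (fresh inv (m≤m+n FP t))) (proj₁ convolved))

    preserves : Building s₀ m d q D bs V (suc i) s₄
    preserves = record
      { below     = λ a< → trans (H₄ _ (inj₁ (<-≤-trans a< (advanced inv)))) (below inv a<)
      ; advanced  = ≤-trans (advanced inv) FP≤
      ; fresh     = λ {a} a≥ → let a> = subst (_≤ a) (trans fp₄ (+-comm _ 1)) a≥ in
          trans (H₄ a (inj₂ a>)) (fresh inv (≤-trans (≤-trans (m≤m+n FP (LA + lb)) (n≤1+n _)) a>))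
      ; acc-room  = subst₂ _<_ (sym (cong₂ _+_ acc₄ la₄)) (sym (trans fp₄ (+-comm _ 1))) ≤-refl
      ; acc-apart = λ {j} _ → inj₂ (<-≤-trans target (≤-trans (advanced inv)
          (≤-trans (≤-reflexive (sym acc₄)) (m≤m+n _ j))))
      ; la-≤      = subst₂ _≤_ (sym la₄) (sym next-union) (+-mono-≤ (la-≤ inv) lb-≤)
      ; acc-opt   = subst₂ (λ p l → Optimal (arr s₄ heap) p l (Prefix G V X al (suc i))) (sym acc₄) (sym la₄) optimal₄
      }
      where
      FP≤ : FP ≤ arr s₄ reg rFP
      FP≤ = subst (FP ≤_) (sym fp₄) (≤-trans (m≤m+n FP (LA + lb)) (m≤m+n _ 1))

    cost-≤ : ∀ {M} → suc (blacks G (union G V i)) * suc (blacks G (V i)) ≤ M →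
      cost extend ρ₇ s ≤ 190 + m * 100 + 100 * M
    cost-≤ {M} M≥ = ≤-trans (+-mono-≤ (proj₂ (allow-correct ρ₇ s)) (+-mono-≤ limit-≤
      (+-monoʳ-≤ 69 (+-monoˡ-≤ 41 conv-≤)))) (≤-reflexive
        (solve 2 (λ m c → con 40 :+ m :* con 100 :+ (con 40 :+ (con 69 :+ (c :+ con 41))) :=
          con 190 :+ m :* con 100 :+ c) refl m (100 * M)))
      where
      open +-*-Solver
      limit-≤ : cost limit ρ₇ s₁ ≤ 40
      limit-≤ with arr s₁ pat i
      ... | zero  = ≤ᵇ⇒≤ _ _ tt
      ... | suc _ = ≤ᵇ⇒≤ _ _ tt
      conv-≤ : cost convolve ρ₁₂ s₂ ≤ 100 * M
      conv-≤ = ≤-trans (proj₂ convolved) (*-monoʳ-≤ 100 (≤-trans (*-mono-≤ (s≤s (la-≤ inv)) (s≤s lb-≤)) M≥))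

-- Trying all patterns

kept-or-zero : ∀ {a l x y} → a < l ⊎ l ≤ a → (a < l → x ≡ y) → (l ≤ a → x ≡ 0) → x ≤ y
kept-or-zero (inj₁ p) f g = ≤-reflexive (f p)
kept-or-zero (inj₂ p) f g = ≤-trans (≤-reflexive (g p)) z≤n

tryCost : ℕ → ℕ
tryCost K = 300 + K * (294 + K * 100)

tryPatternsCost : ℕ → ℕ → ℕ
tryPatternsCost K zero    = tryCost K
tryPatternsCost K (suc k) = 20 + (tryPatternsCost K k + tryPatternsCost K k)

-- With a variable k the syntactic check does not compute, but each level of the enumeration adds
-- only writes to `pat`.
mayWrite-tryPatterns : ∀ k a i → (pat ≡ᵇ a) ≡ false → mayWrite tryPattern a i ≡ false →
  mayWrite (tryPatterns k) a i ≡ false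
mayWrite-tryPatterns zero    a i p q = q
mayWrite-tryPatterns (suc k) a i p q rewrite p | mayWrite-tryPatterns k a i p q = refl

keeps-tryPatterns : ∀ k → T (keeps (tryPatterns k))
keeps-tryPatterns zero    = tt
keeps-tryPatterns (suc k) with keeps (tryPatterns k) | keeps-tryPatterns k
... | true | _ = tt

pattern-above : ∀ k ρ s {j} → k ≤ j → arr (run (tryPatterns k) ρ s) pat j ≡ arr s pat j
pattern-above zero    ρ s {j} k≤j = frame tryPattern pat j refl ρ s
pattern-above (suc k) ρ s {j} k<j =
  trans (pattern-above k ρ _ (<⇒≤ k<j)) (trans (↦-other _ k≢j) (trans (pattern-above k ρ _ (<⇒≤ k<j)) (↦-other _ k≢j)))
  where
  k≢j : k ≢ j
  k≢j e = <-irrefl e k<j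

module _ {n : ℕ} (G : BipartiteGraph n) where
  open BipartiteGraph G

  item-static : ∀ {s s′ D D′ d S} → Static s s′ → (∀ {a} → a < D → arr s′ heap a ≡ arr s heap a) → D ≤ D′ →
    Item G s D d S → Item G s′ D′ d S
  item-static {s} {s′} {D} {D′} {d} {S} st h D≤ it = record
    { len-≡     = trans (same st len d tt) (len-≡ it)
    ; room      = λ {q} q< → <-≤-trans (subst (λ p → p + blacks G S < D) (sym (same st ptr (d + d + q) tt)) (room it q<)) D≤
    ; optimal   = λ {q} q< → subst (λ p → Optimal (arr s′ heap) p (blacks G S) (Candidate G S q)) (sym (same st ptr (d + d + q) tt))
        (optimal-heap (λ b≤ → h (≤-<-trans (+-monoʳ-≤ _ b≤) (room it q<))) (optimal it q<))
    ; black-rep = λ u∈ ub → let v , v∈ , vb , e = black-rep it u∈ ub in v , v∈ , vb , trans (same st brep d tt) e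
    ; white-rep = λ u∈ uw → let v , v∈ , vw , e = white-rep it u∈ uw in v , v∈ , vw , trans (same st wrep d tt) e
    }

  parts-static : ∀ {s s′ m d D D′ V} → Static s s′ → (∀ {a} → a < D → arr s′ heap a ≡ arr s heap a) → D ≤ D′ →
    Parts G s m d D V → Parts G s′ m d D′ V
  parts-static {s} {s′} {m} {d} {D} {V = V} st h D≤ p = record
    { items    = λ i< → item-static st h D≤ (items p i<)
    ; linked   = record
        { link    = λ i< j< j≢ e → link (linked p) i< j< j≢ (e ∘ trans (edges-≡ _ _))
        ; no-link = λ i< j< j≢ e → no-link (linked p) i< j< j≢ (trans (sym (edges-≡ _ _)) e) }
    ; disjoint = disjoint p
    ; unit     = trans (h (positive p)) (unit p)
    ; positive = <-≤-trans (positive p) D≤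
    }
    where
    edges-≡ : ∀ j i → edges s′ d j i ≡ edges s d j i
    edges-≡ j i = trans (cong (arr s′ adj) (cong₂ _+_ (same st brep _ tt) (same st wrep _ tt))) (same st adj _ tt)

  -- The alternative 0 in `reached` stands for cells that no pattern has raised yet; it disappears
  -- in `optimal-target`.
  record Target (H₀ : ℕ → ℕ) (q D : ℕ) (S : Subset n) (s : State) : Set where
    field
      under  : ∀ {a} → a < D → arr s heap a ≡ H₀ a
      unused : ∀ {a} → arr s reg rFP ≤ a → arr s heap a ≡ 0
      within-FP : D + blacks G S < arr s reg rFP
      reached : ∀ {b} → b ≤ blacks G S → arr s heap (D + b) ≡ 0 ⊎ Candidate G S q b (arr s heap (D + b))
  open Target public

  Matches : ℕ → (ℕ → Subset n) → (ℕ → ℕ) → Subset n → Set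
  Matches m V X C = ∀ {j} → j < m →
    (blacks G (C ∩ V j) ≢ 0 → X j ≢ 0) × (X j ≢ 0 → blacks G (C ∩ V j) ≢ 0)

  Covers : (m : ℕ) (V : ℕ → Subset n) (q D : ℕ) (X : ℕ → ℕ) (s : State) → Set
  Covers m V q D X s = ∀ {b x} (k : Candidate G (union G V m) q b x) → Matches m V X (set k) →
    x ≤ arr s heap (D + b)

  Raises : ℕ → State → State → Set
  Raises D s s′ = ∀ b → arr s heap (D + b) ≤ arr s′ heap (D + b)

  MeasureOf : (ℕ → Subset n) → ℕ → ℕ → Set
  MeasureOf V m M = Measure M m (λ i → blacks G (union G V i)) (λ i → blacks G (V i))

  module _ (H₀ : ℕ → ℕ) (ρ : Env) (V : ℕ → Subset n) (q<2 : ρ 5 < 2)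
    {K M : ℕ} (m≤K : ρ 3 ≤ K) (measure : MeasureOf V (ρ 3) M)
    where

    private
      m = ρ 3
      d = ρ 4
      q = ρ 5
      D = ρ 6
      S = union G V m
      bs = blacks G S

    1≤M : 1 ≤ M
    1≤M = ≤-trans (s≤s z≤n) (sums measure {m} ≤-refl)

    ReadyFor : State → Set
    ReadyFor s = Parts G s m d D V × Target H₀ q D S s

    module TryPattern (s : State) (parts : Parts G s m d D V) (target : Target H₀ q D S s) where

      s₁ = run (set-reg rACC (lit 0) ⨟ set-reg rLA (lit 0)) ρ s
      st₁ : Static s s₁
      st₁ = keeps-static (set-reg rACC (lit 0) ⨟ set-reg rLA (lit 0)) ρ s tt
      parts₁ : Parts G s₁ m d D V
      parts₁ = parts-static st₁ (λ _ → refl) ≤-refl parts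
      s₂ = run (loop 7 (var 3) extend) ρ s₁
      st : Static s s₂
      st = static-trans st₁ (keeps-static (loop 7 (var 3) extend) ρ s₁ tt)
      tail = bind 7 (lit 0) (bind 8 (var 6) (bind 9 (get-reg rACC) (bind 10 (get-reg rLA)
        (bind 11 (lit 0) (bind 12 (lit 0) convolve)))))

      empty-prefix : Optimal (arr s heap) 0 0 (Prefix G V (arr s₁ pat) (pattern-allowance G s₁ m d q) 0)
      empty-prefix .sound z≤n = subst (Prefix G V (arr s₁ pat) (pattern-allowance G s₁ m d q) 0 0)
        (sym (unit parts)) (prefix-zero G)
      empty-prefix .complete p with prefix-zero⁻ G p
      ... | refl , refl = z≤n , z≤n

      start-building : Building G s₁ m d q D bs V 0 s₁
      start-building = record
        { below     = λ _ → refl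
        ; advanced  = ≤-refl
        ; fresh     = unused target
        ; acc-room  = ≤-<-trans z≤n (within-FP target)
        ; acc-apart = λ { z≤n → inj₁ (positive parts) }
        ; la-≤      = z≤n
        ; acc-opt   = empty-prefix }

      loops = loop-rule⁺ (Building G s₁ m d q D bs V) 7 (var 3) extend ρ s₁ m (190 + m * 100 + 100 * M) refl start-building
        (λ i s′ i<m pres inv →
          ExtendStep.preserves G ρ s₁ s′ V bs i parts₁ q<2 i<m (within-FP target) pres inv ,
          ExtendStep.cost-≤ G ρ s₁ s′ V bs i parts₁ q<2 i<m (within-FP target) pres inv (products measure i<m))
      built : Building G s₁ m d q D bs V m s₂
      built = proj₁ loops

      ACC = arr s₂ reg rACC
      LA = arr s₂ reg rLA
      la+0≤ : LA + 0 ≤ bs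
      la+0≤ = ≤-trans (≤-reflexive (+-identityʳ LA)) (la-≤ built)

      ρ′ = ρ [ 7 ↦ 0 ] [ 8 ↦ D ] [ 9 ↦ ACC ] [ 10 ↦ LA ] [ 11 ↦ 0 ] [ 12 ↦ 0 ]

      s₃ = run tryPattern ρ s

      conv : Convolved (arr s₂ heap) D ACC LA 0 0 Everywhere (arr s₃ heap) ×
             cost convolve ρ′ s₂ ≤ 100 * (suc LA * 1)
      conv = convolve-values ρ′ s₂ refl refl refl refl refl
        (λ j≤ → case acc-apart built j≤ of λ
          { (inj₁ p) → inj₁ p ; (inj₂ p) → inj₂ (≤-<-trans (+-monoʳ-≤ D la+0≤) p) })
        (λ { z≤n → inj₁ (positive parts) })

      fp₃ : arr s₃ reg rFP ≡ arr s₂ reg rFP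
      fp₃ = frame tail reg rFP refl ρ s₂

      low : ∀ {a} → a ≤ D + bs → arr s₂ heap a ≡ arr s heap a
      low a≤ = below built (≤-<-trans a≤ (within-FP target))

      unit₂ : arr s₂ heap 0 ≡ 0
      unit₂ = trans (low z≤n) (unit parts)

      raise : ∀ b → arr s heap (D + b) ≤ arr s₂ heap (D + b)
      -- The accumulation may write from the free pointer on, but there the old values are 0.
      raise b = kept-or-zero {x = arr s heap (D + b)} (<-≤-connex (D + b) (arr s reg rFP))
        (λ p → sym (below built p)) (unused target)

      under′ : ∀ {a} → a < D → arr s₃ heap a ≡ H₀ a
      under′ a< = trans (outside (proj₁ conv) _ (inj₁ a<)) (trans (low (≤-trans (<⇒≤ a<) (m≤m+n D bs))) (under target a<))

      allowed′ : ∀ {i} → i < m → Allowed G m (edges s₁ d) q (arr s₁ pat) i (pattern-allowance G s₁ m d q i)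
      allowed′ {i} _ = allowance-allowed G (edges s₁ d) q (arr s₁ pat) i m

      reached′ : ∀ {b} → b ≤ bs → arr s₃ heap (D + b) ≡ 0 ⊎ Candidate G S q b (arr s₃ heap (D + b))
      reached′ {b} b≤ = [
        (λ e → subst (λ x → x ≡ 0 ⊎ Candidate G S q b x)
          (sym (trans e (low (+-monoʳ-≤ D b≤)))) (reached target b≤)) ,
        (λ { (i , .0 , i≤ , z≤n , e , v) → inj₂ (subst₂ (Candidate G S q)
          (sym (+-cancelˡ-≡ D b i (trans e (+-identityʳ (D + i)))))
          (sym (trans v (trans (cong (arr s₂ heap (ACC + i) +_) unit₂) (+-identityʳ _))))
          (prefix-candidate G (linked parts₁) allowed′ (sound (acc-opt built) i≤))) }) ]′
        (attained (proj₁ conv) (D + b))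

      covers : Covers m V q D (arr s pat) s₃
      covers {b} {x} k match =
        let b≤ , x≤ = complete (acc-opt built) (candidate-prefix G (linked parts₁) allowed′ k
              (λ j< → proj₁ (match j<)) (λ j< → proj₂ (match j<)))
        in ≤-trans x≤ (≤-trans (m≤m+n _ (arr s₂ heap 0))
          (≤-trans (bound (proj₁ conv) b≤ z≤n tt) (≤-reflexive (cong (arr s₃ heap) (+-identityʳ (D + b))))))

      cost-≤ : cost tryPattern ρ s ≤ tryCost K * M
      cost-≤ = begin
        cost tryPattern ρ s
          ≤⟨ +-monoʳ-≤ 9 (+-monoʳ-≤ 9 (+-mono-≤ (proj₂ loops) (+-monoʳ-≤ 33 (proj₂ conv)))) ⟩
        9 + (9 + (8 + m * (190 + m * 100 + 100 * M + 4) + (33 + 100 * (suc LA * 1))))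
          ≤⟨ +-monoʳ-≤ 9 (+-monoʳ-≤ 9 (+-mono-≤ (+-monoʳ-≤ 8 (*-mono-≤ m≤K
               (+-monoˡ-≤ 4 (+-monoˡ-≤ (100 * M) (+-monoʳ-≤ 190 (*-monoˡ-≤ 100 m≤K))))))
               (+-monoʳ-≤ 33 (*-monoʳ-≤ 100 la≤M)))) ⟩
        9 + (9 + (8 + K * (190 + K * 100 + 100 * M + 4) + (33 + 100 * M)))
          ≡⟨ solve 2 (λ K M → con 9 :+ (con 9 :+ (con 8 :+ K :* (con 190 :+ K :* con 100 :+ con 100 :* M :+ con 4) :+ (con 33 :+ con 100 :* M)))
               := (con 59 :+ K :* (con 194 :+ K :* con 100)) :* con 1 :+ (con 100 :+ K :* con 100) :* M) refl K M ⟩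
        (59 + K * (194 + K * 100)) * 1 + (100 + K * 100) * M
          ≤⟨ +-monoˡ-≤ _ (*-monoʳ-≤ (59 + K * (194 + K * 100)) 1≤M) ⟩
        (59 + K * (194 + K * 100)) * M + (100 + K * 100) * M
          ≤⟨ m≤m+n _ (141 * M) ⟩
        (59 + K * (194 + K * 100)) * M + (100 + K * 100) * M + 141 * M
          ≡⟨ solve 2 (λ K M → (con 59 :+ K :* (con 194 :+ K :* con 100)) :* M :+ (con 100 :+ K :* con 100) :* M :+ con 141 :* M
               := (con 300 :+ K :* (con 294 :+ K :* con 100)) :* M) refl K M ⟩
        tryCost K * M ∎
        where
        open ≤-Reasoning
        open +-*-Solver
        la≤M : suc LA * 1 ≤ M
        la≤M = ≤-trans (≤-reflexive (*-identityʳ (suc LA))) (≤-trans (s≤s (la-≤ built)) (sums measure ≤-refl))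

      ready′ : ReadyFor s₃
      ready′ =
        parts-static (static-trans st (keeps-static tail ρ s₂ tt))
          (λ a< → trans (under′ a<) (sym (under target a<))) ≤-refl parts ,
        record
          { under   = under′
          ; unused  = λ {a} a≥ → let a≥′ = ≤-trans (≤-reflexive (sym fp₃)) a≥ in
              trans (outside (proj₁ conv) a (inj₂ (<-≤-trans (≤-<-trans (+-monoʳ-≤ D la+0≤) (<-≤-trans (within-FP target) (advanced built))) a≥′)))
                (fresh built a≥′)
          ; within-FP = <-≤-trans (<-≤-trans (within-FP target) (advanced built)) (≤-reflexive (sym fp₃))
          ; reached = reached′ }

      raises′ : Raises D s s₃
      raises′ b = ≤-trans {arr s heap (D + b)} {arr s₂ heap (D + b)} {arr s₃ heap (D + b)} (raise b) (grows (proj₁ conv) (D + b))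

    record Tried (k : ℕ) (s s′ : State) (c : ℕ) : Set where
      constructor tried
      field
        ready-after  : ReadyFor s′
        raised-after : Raises D s s′
        covers-after : ∀ X → (∀ {j} → k ≤ j → X j ≡ arr s pat j) → (∀ {j} → j < k → X j < 2) → Covers m V q D X s′
        cost-after   : c ≤ tryPatternsCost K k * M
    open Tried public

    raises-trans : ∀ s s₁ s₂ s₃ s₄ → (∀ a → arr s₁ heap a ≡ arr s heap a) → (∀ a → arr s₃ heap a ≡ arr s₂ heap a) →
      Raises D s₁ s₂ → Raises D s₃ s₄ → Raises D s₂ s₄ × Raises D s s₄
    raises-trans s s₁ s₂ s₃ s₄ e₁ e₃ r₁ r₃ = r₂₄ , λ b →
      ≤-trans (≤-reflexive (sym (e₁ (D + b)))) (≤-trans (r₁ b) (r₂₄ b))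
      where
      r₂₄ : Raises D s₂ s₄
      r₂₄ b = ≤-trans (≤-reflexive (sym (e₃ (D + b)))) (r₃ b)

    sequence-cost : ∀ k {c₂ c₄} → c₂ ≤ tryPatternsCost K k * M → c₄ ≤ tryPatternsCost K k * M →
      9 + (c₂ + (9 + c₄)) ≤ tryPatternsCost K (suc k) * M
    sequence-cost k {c₂} {c₄} p₂ p₄ = begin
      9 + (c₂ + (9 + c₄))
        ≤⟨ +-monoʳ-≤ 9 (+-mono-≤ p₂ (+-monoʳ-≤ 9 p₄)) ⟩
      9 + (c * M + (9 + c * M))
        ≡⟨ solve 2 (λ c M → con 9 :+ (c :* M :+ (con 9 :+ c :* M)) := con 18 :* con 1 :+ (c :+ c) :* M) refl c M ⟩
      18 * 1 + (c + c) * M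
        -- The two assignments to the pattern cost 9 each; as M is positive, the constant becomes a
        -- multiple of M.
        ≤⟨ +-monoˡ-≤ _ (*-mono-≤ (≤ᵇ⇒≤ 18 20 tt) 1≤M) ⟩
      20 * M + (c + c) * M
        ≡⟨ *-distribʳ-+ M 20 (c + c) ⟨
      (20 + (c + c)) * M ∎
      where
      open ≤-Reasoning
      open +-*-Solver
      c = tryPatternsCost K k

    try-both : ∀ k s s₁ s₂ s₃ s₄ {c₂ c₄} →
      (∀ a → arr s₁ heap a ≡ arr s heap a) → (∀ a → arr s₃ heap a ≡ arr s₂ heap a) →
      arr s₁ pat k ≡ 0 → (∀ {j} → k < j → arr s₁ pat j ≡ arr s pat j) →
      arr s₃ pat k ≡ 1 → (∀ {j} → k < j → arr s₃ pat j ≡ arr s pat j) →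
      Tried k s₁ s₂ c₂ → Tried k s₃ s₄ c₄ → Tried (suc k) s s₄ (9 + (c₂ + (9 + c₄)))
    try-both k s s₁ s₂ s₃ s₄ e₁ e₃ z₁ f₁ z₃ f₃ h₂ h₄ =
      tried (ready-after h₄) (proj₂ ups) covers (sequence-cost k (cost-after h₂) (cost-after h₄))
      where
      ups : Raises D s₂ s₄ × Raises D s s₄
      ups = raises-trans s s₁ s₂ s₃ s₄ e₁ e₃ (raised-after h₂) (raised-after h₄)
      agree : ∀ {X} s′ {x} → X k ≡ x → arr s′ pat k ≡ x → (∀ {j} → k < j → arr s′ pat j ≡ arr s pat j) →
        (∀ {j} → suc k ≤ j → X j ≡ arr s pat j) → ∀ {j} → k ≤ j → X j ≡ arr s′ pat j
      agree s′ p z f e k≤j with m≤n⇒m<n∨m≡n k≤j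
      ... | inj₂ refl = trans p (sym z)
      ... | inj₁ k<j  = trans (e k<j) (sym (f k<j))
      covers : ∀ X → (∀ {j} → suc k ≤ j → X j ≡ arr s pat j) → (∀ {j} → j < suc k → X j < 2) → Covers m V q D X s₄
      covers X e X<2 {b} cand match with X k in eq | X<2 (n<1+n k)
      ... | 0 | _ = ≤-trans
        (covers-after h₂ X (agree {X} s₁ eq z₁ f₁ e) (X<2 ∘ m<n⇒m<1+n) cand match) (proj₁ ups b)
      ... | 1 | _ = covers-after h₄ X (agree {X} s₃ eq z₃ f₃ e) (X<2 ∘ m<n⇒m<1+n) cand match
      ... | suc (suc _) | s≤s (s≤s ())

    try-one : ∀ s s′ {c} → ReadyFor s′ → Raises D s s′ → Covers m V q D (arr s pat) s′ → c ≤ tryCost K * M →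
      Tried zero s s′ c
    try-one s s′ r up cov c = tried r up (λ X e _ k match → cov k (λ {j} j< →
      (λ p → subst (_≢ 0) (e {j} z≤n) (proj₁ (match j<) p)) ,
      (λ p → proj₂ (match j<) (subst (_≢ 0) (sym (e {j} z≤n)) p)))) c

    set-pattern : ∀ k e s → ReadyFor s → ReadyFor (run (assign pat (lit k) e) ρ s)
    set-pattern k e s (p , t) = parts-static (keeps-static (assign pat (lit k) e) ρ s tt) (λ _ → refl) ≤-refl p ,
      record { under = under t ; unused = unused t ; within-FP = within-FP t ; reached = reached t }

    tryPatterns-correct : ∀ k s → ReadyFor s → Tried k s (run (tryPatterns k) ρ s) (cost (tryPatterns k) ρ s)
    tryPatterns-correct zero    s (parts , target) =
      try-one s (run tryPattern ρ s) ready′ raises′ covers cost-≤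
      where open TryPattern s parts target
    tryPatterns-correct (suc k) s r =
      try-both k s s₁ s₂ s₃ (run (tryPatterns k) ρ s₃) (λ _ → refl) (λ _ → refl)
        (↦-same (arr s pat) k) (λ k<j → ↦-other (arr s pat) (λ p → <-irrefl p k<j))
        (↦-same (arr s₂ pat) k) (λ k<j → trans (↦-other (arr s₂ pat) (λ p → <-irrefl p k<j))
          (trans (pattern-above k ρ s₁ (<⇒≤ k<j)) (↦-other (arr s pat) (λ p → <-irrefl p k<j))))
        half₂ (tryPatterns-correct k s₃ (set-pattern k (lit 1) s₂ (ready-after half₂)))
      where
      s₁ s₂ s₃ : State
      s₁ = run (assign pat (lit k) (lit 0)) ρ s
      s₂ = run (tryPatterns k) ρ s₁
      s₃ = run (assign pat (lit k) (lit 1)) ρ s₂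
      half₂ : Tried k s₁ s₂ (cost (tryPatterns k) ρ s₁)
      half₂ = tryPatterns-correct k s₁ (set-pattern k (lit 0) s r)

-- Optimal blocks and representatives of a node

zero-or-pos : ∀ k → k ≡ 0 ⊎ k ≢ 0
zero-or-pos zero    = inj₁ refl
zero-or-pos (suc k) = inj₂ λ ()

branch-0 : ∀ {A : Set} {k} {x y : A} → k ≡ 0 → branch k x y ≡ y
branch-0 refl = refl

branch-1 : ∀ {A : Set} {k} {x y : A} → k ≢ 0 → branch k x y ≡ x
branch-1 {k = zero}  p = ⊥-elim (p refl)
branch-1 {k = suc k} p = refl

arr-branch : ∀ k s s′ a i → arr (branch k s s′) a i ≡ branch k (arr s a i) (arr s′ a i)
arr-branch zero    s s′ a i = refl
arr-branch (suc k) s s′ a i = refl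

branch-≤ : ∀ k {x y c} → x ≤ c → y ≤ c → branch k x y ≤ c
branch-≤ zero    p q = q
branch-≤ (suc k) p q = p

module _ {n : ℕ} (G : BipartiteGraph n) where
  open BipartiteGraph G

  -- Each biclique is covered at the pattern of the parts in which it has black vertices, and this
  -- pattern is among those enumerated because the number of parts is at most K.
  optimal-target : ∀ {H₀ ρ V} (q<2 : ρ 5 < 2) {K M} (m≤K : ρ 3 ≤ K) (μ : MeasureOf G V (ρ 3) M) s s′ {c} →
    Tried G H₀ ρ V q<2 m≤K μ K s s′ c →
    Optimal (arr s′ heap) (ρ 6) (blacks G (union G V (ρ 3))) (Candidate G (union G V (ρ 3)) (ρ 5))
  optimal-target {H₀} {ρ} {V} q<2 {K} m≤K μ s s′ t = record { sound = sound′ ; complete = λ k → complete′ k }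
    where
    S = union G V (ρ 3)
    D = ρ 6
    complete′ : ∀ {b x} → Candidate G S (ρ 5) b x → b ≤ blacks G S × x ≤ arr s′ heap (D + b)
    complete′ {b} {x} k =
      subst (_≤ blacks G S) (blacks-≡ k) (weigh-mono (indicator B) (set k) S (inside-S k)) ,
      covers-after t X X-above X-below k matches
      where
      presence : ℕ → ℕ
      presence j = branch (blacks G (set k ∩ V j)) 1 0
      -- From K on the enumeration leaves the array as it found it, so X has to agree with it there.
      X : ℕ → ℕ
      X j = if j <ᵇ K then presence j else arr s pat j
      X-above : ∀ {j} → K ≤ j → X j ≡ arr s pat j
      X-above {j} K≤j with j <ᵇ K in eq
      ... | false = refl
      ... | true  = ⊥-elim (<-irrefl refl (<-≤-trans (lt {j} {K} (subst T (sym eq) tt)) K≤j))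
      X-≡ : ∀ {j} → j < K → X j ≡ presence j
      X-≡ {j} j<K with j <ᵇ K | <⇒<ᵇ j<K
      ... | true | _ = refl
      X-below : ∀ {j} → j < K → X j < 2
      X-below {j} j<K = subst (_< 2) (sym (X-≡ j<K)) (s≤s (branch-≤ (blacks G (set k ∩ V j)) ≤-refl z≤n))
      matches : Matches G (ρ 3) V X (set k)
      matches {j} j<m =
        (λ p e → case trans (sym (branch-1 p)) (trans (sym (X-≡ j<K)) e) of λ ()) ,
        (λ p e → p (trans (X-≡ j<K) (branch-0 e)))
        where
        j<K : j < K
        j<K = <-≤-trans j<m m≤K
    sound′ : ∀ {b} → b ≤ blacks G S → Candidate G S (ρ 5) b (arr s′ heap (D + b))
    sound′ {b} b≤ with reached (proj₂ (ready-after t)) b≤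
    ... | inj₂ k = k
    -- A cell still 0 is sound too: some b black vertices alone form a biclique, and by completeness
    -- its weight is at most 0. So the cell already contains this weight.
    ... | inj₁ e with black-candidate G S (ρ 5) b b≤
    ... | x , k = subst (Candidate G S (ρ 5) b)
      (≤-antisym (proj₂ (complete′ k)) (≤-trans (≤-reflexive e) z≤n)) k

  record Summary (V : ℕ → Subset n) (i : ℕ) (s : State) : Set where
    field
      bs-≡ : arr s reg rBS ≡ blacks G (union G V i)
      br   : ∀ {u} → u ∈ₛ union G V i → u ∈ₛ B → ∃[ v ] v ∈ₛ union G V i × v ∈ₛ B × arr s reg rBR ≡ toℕ v * n
      wr   : ∀ {u} → u ∈ₛ union G V i → u ∉ B → ∃[ v ] v ∈ₛ union G V i × v ∉ B × arr s reg rWR ≡ toℕ v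
  open Summary public

  summary-step : ∀ V {i m} s s′ → PairwiseDisjoint G V m → i < m → ∀ {l r h w} →
    l ≡ blacks G (V i) →
    (∀ {u} → u ∈ₛ V i → u ∈ₛ B → ∃[ v ] v ∈ₛ V i × v ∈ₛ B × r ≡ toℕ v * n) →
    (∀ {u} → u ∈ₛ V i → u ∉ B → ∃[ v ] v ∈ₛ V i × v ∉ B × w ≡ toℕ v) →
    (∀ {u} → u ∈ₛ V i → u ∉ B → h ≢ 0) → (h ≢ 0 → ∃[ u ] u ∈ₛ V i × u ∉ B) →
    arr s′ reg rBS ≡ arr s reg rBS + l → arr s′ reg rBR ≡ branch l r (arr s reg rBR) →
    arr s′ reg rWR ≡ branch h w (arr s reg rWR) →
    Summary V i s → Summary V (suc i) s′
  summary-step V {i} {m} s s′ disj i<m {l} {r} {h} {w} l≡ R U h⁺ h⁻ e₁ e₂ e₃ S = record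
    { bs-≡ = trans e₁ (trans (cong₂ _+_ (bs-≡ S) l≡) (sym (disjoint-sum G (indicator B) disj i<m id id)))
    ; br   = λ u∈ ub → [
        (λ nz → let u′ , u′∈ , u′b = black-out G (V i) (nz ∘ trans l≡)
                    v , v∈ , vb , e = R u′∈ u′b
                in v , x∈p∪q⁺ (inj₂ v∈) , vb , trans e₂ (trans (branch-1 nz) e)) ,
        (λ z → [ (λ u∈′ → let v , v∈ , vb , e = br S u∈′ ub
                          in v , x∈p∪q⁺ (inj₁ v∈) , vb , trans e₂ (trans (branch-0 z) e)) ,
                 (λ u∈′ → ⊥-elim (black-in G u∈′ ub (trans (sym l≡) z))) ]′
               (x∈p∪q⁻ (union G V i) (V i) u∈)) ]′ (swap⊎ (zero-or-pos l))
    ; wr   = λ u∈ uw → [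
        (λ nz → let u′ , u′∈ , u′w = h⁻ nz
                    v , v∈ , vw , e = U u′∈ u′w
                in v , x∈p∪q⁺ (inj₂ v∈) , vw , trans e₃ (trans (branch-1 nz) e)) ,
        (λ z → [ (λ u∈′ → let v , v∈ , vw , e = wr S u∈′ uw
                          in v , x∈p∪q⁺ (inj₁ v∈) , vw , trans e₃ (trans (branch-0 z) e)) ,
                 (λ u∈′ → ⊥-elim (h⁺ u∈′ uw z)) ]′
               (x∈p∪q⁻ (union G V i) (V i) u∈)) ]′ (swap⊎ (zero-or-pos h))
    }
    where
    swap⊎ : ∀ {k} → k ≡ 0 ⊎ k ≢ 0 → k ≢ 0 ⊎ k ≡ 0
    swap⊎ = [ inj₂ , inj₁ ]′

  summarize-correct : ∀ ρ V s {D} → Parts G s (ρ 3) (ρ 4) D V →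
    Summary V (ρ 3) (run summarize ρ s) × cost summarize ρ s ≤ 17 + ρ 3 * 200
  summarize-correct ρ V s {D} parts =
    let p , c = loop-rule⁺ (Summary V) 5 (var 3) summarizeStep ρ s₁ (ρ 3) 196 refl
          (record { bs-≡ = sym (weigh-∅ (indicator B)) ; br = λ u∈ → ⊥-elim (∉⊥ u∈) ; wr = λ u∈ → ⊥-elim (∉⊥ u∈) })
          step′
    in p , +-monoʳ-≤ 9 c
    where
    s₁ = run (set-reg rBS (lit 0)) ρ s
    step′ : ∀ i s′ → i < ρ 3 → Preserved summarizeStep s₁ s′ → Summary V i s′ →
      Summary V (suc i) (run summarizeStep (ρ [ 5 ↦ i ]) s′) × cost summarizeStep (ρ [ 5 ↦ i ]) s′ ≤ 196
    step′ i s′ i<m p S = summary-step V s′ (run summarizeStep (ρ [ 5 ↦ i ]) s′) (disjoint parts) i<m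
      (len-≡ it) (black-rep it) (white-rep it)
      (λ u∈ uw e → white-value G (optimal it (lt tt)) u∈ uw e)
      (λ nz → value-white G (optimal it (lt tt)) nz)
      bs′ br′ wr′ S , cost′
      where
      j = ρ 4 + i
      st : Static s s′
      st = static-trans (keeps-static (set-reg rBS (lit 0)) ρ s tt) (keep p tt)
      it : Item G s D j (V i)
      it = items parts i<m
      L = arr s′ len j
      h = arr s′ heap (arr s′ ptr (j + j + 1))
      heap-≡ : ∀ a → arr s′ heap a ≡ arr s heap a
      heap-≡ a = fixed p heap a refl
      t₁ = run (set-reg rBS (get-reg rBS ⊞ len at (var 4 ⊞ var 5))) (ρ [ 5 ↦ i ]) s′
      s₂ = run (when (len at (var 4 ⊞ var 5)) (set-reg rBR (brep at (var 4 ⊞ var 5))) skip) (ρ [ 5 ↦ i ]) t₁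
      w₃ = when (heap at (ptr at ((var 4 ⊞ var 5) ⊞ (var 4 ⊞ var 5) ⊞ lit 1))) (set-reg rWR (wrep at (var 4 ⊞ var 5))) skip
      w₂ = when (len at (var 4 ⊞ var 5)) (set-reg rBR (brep at (var 4 ⊞ var 5))) skip
      bs′ : arr (run summarizeStep (ρ [ 5 ↦ i ]) s′) reg rBS ≡ arr s′ reg rBS + arr s len j
      bs′ = trans (frame w₃ reg rBS refl (ρ [ 5 ↦ i ]) s₂) (trans (frame w₂ reg rBS refl (ρ [ 5 ↦ i ]) t₁)
        (cong (arr s′ reg rBS +_) (same st len j tt)))
      br′ : arr (run summarizeStep (ρ [ 5 ↦ i ]) s′) reg rBR ≡ branch (arr s len j) (arr s brep j) (arr s′ reg rBR)
      br′ = trans (frame w₃ reg rBR refl (ρ [ 5 ↦ i ]) s₂)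
        (trans (arr-branch L (run (set-reg rBR (brep at (var 4 ⊞ var 5))) (ρ [ 5 ↦ i ]) t₁) t₁ reg rBR)
          (cong₂ (λ k x → branch k x (arr s′ reg rBR)) (same st len j tt) (same st brep j tt)))
      wr′ : arr (run summarizeStep (ρ [ 5 ↦ i ]) s′) reg rWR ≡
        branch (arr s heap (arr s ptr (j + j + 1))) (arr s wrep j) (arr s′ reg rWR)
      wr′ = trans (arr-branch (arr s₂ heap (arr s₂ ptr (j + j + 1))) (run (set-reg rWR (wrep at (var 4 ⊞ var 5))) (ρ [ 5 ↦ i ]) s₂) s₂ reg rWR)
        (cong₃ branch
          (trans (frame w₂ heap _ refl (ρ [ 5 ↦ i ]) t₁) (trans (heap-≡ _) (cong (arr s heap)
            (trans (frame w₂ ptr (j + j + 1) refl (ρ [ 5 ↦ i ]) t₁) (same st ptr (j + j + 1) tt)))))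
          (trans (frame w₂ wrep j refl (ρ [ 5 ↦ i ]) t₁) (same st wrep j tt))
          (frame w₂ reg rWR refl (ρ [ 5 ↦ i ]) t₁))
        where
        cong₃ : ∀ (f : ℕ → ℕ → ℕ → ℕ) {a a′ b b′ c c′} → a ≡ a′ → b ≡ b′ → c ≡ c′ → f a b c ≡ f a′ b′ c′
        cong₃ f refl refl refl = refl
      cost′ : cost summarizeStep (ρ [ 5 ↦ i ]) s′ ≤ 196
      cost′ = ≤-trans (+-monoʳ-≤ 29 (+-mono-≤
          (+-monoʳ-≤ 15 (branch-≤ L {20} {0} {20} ≤-refl z≤n))
          (+-monoʳ-≤ 30 (branch-≤ (arr s₂ heap (arr s₂ ptr (j + j + 1))) {20} {0} {20} ≤-refl z≤n))))
        (≤ᵇ⇒≤ 114 196 tt)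

-- Combining the topmost items of the stack

optimize-reg : ∀ k r → (rFP ≡ᵇ r) ≡ false → mayWrite tryPattern reg r ≡ false → mayWrite (optimize k) reg r ≡ false
optimize-reg k r p q = trans (cong (_∨ mayWrite (tryPatterns k) reg r) p) (mayWrite-tryPatterns k reg r refl q)

combineCost : ℕ → ℕ
combineCost K = 400 + K * 200 + 2 * (tryPatternsCost K K)

module _ {n : ℕ} (G : BipartiteGraph n) where
  open BipartiteGraph G

  Spare : State → Set
  Spare s = ∀ {a} → arr s reg rFP ≤ a → arr s heap a ≡ 0

  record Optimized (S : Subset n) (q : ℕ) (s s′ : State) : Set where
    field
      lower     : ∀ {a} → a < arr s reg rFP → arr s′ heap a ≡ arr s heap a
      spare     : Spare s′
      space     : arr s reg rFP + blacks G S < arr s′ reg rFP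
      best      : Optimal (arr s′ heap) (arr s reg rFP) (blacks G S) (Candidate G S q)
      dest-≡    : arr s′ dest q ≡ arr s reg rFP
      dest-else : ∀ {j} → q ≢ j → arr s′ dest j ≡ arr s dest j
      bs-kept   : arr s′ reg rBS ≡ arr s reg rBS
      stable    : Static s s′
  open Optimized

  optimize-correct : ∀ {K M} ρ V s → ρ 5 < 2 → ρ 3 ≤ K → MeasureOf G V (ρ 3) M →
    Parts G s (ρ 3) (ρ 4) (arr s reg rFP) V → Spare s → arr s reg rBS ≡ blacks G (union G V (ρ 3)) →
    Optimized (union G V (ρ 3)) (ρ 5) s (run (optimize K) ρ s) ×
    cost (optimize K) ρ s ≤ 49 + tryPatternsCost K K * M
  optimize-correct {K} {M} ρ V s q<2 m≤K μ parts free bs≡ = record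
    { lower     = under (proj₂ after)
    ; spare     = unused (proj₂ after)
    ; space     = within-FP (proj₂ after)
    ; best      = optimal-target G {arr s heap} {ρ₆} {V} q<2 m≤K μ s₁ s₂ result
    ; dest-≡    = trans (frame (tryPatterns K) dest (ρ 5) (mayWrite-tryPatterns K dest (ρ 5) refl refl) ρ₆ s₁)
                    (↦-same (arr s dest) (ρ 5))
    ; dest-else = λ {j} q≢j → trans (frame (tryPatterns K) dest j (mayWrite-tryPatterns K dest j refl refl) ρ₆ s₁)
                    (↦-other (arr s dest) q≢j)
    ; bs-kept   = frame (optimize K) reg rBS (optimize-reg K rBS refl refl) ρ s
    ; stable    = static-trans (keeps-static header ρ₆ s tt) (keeps-static (tryPatterns K) ρ₆ s₁ (keeps-tryPatterns K))
    } , ≤-trans (+-monoʳ-≤ 10 (+-monoʳ-≤ 21 (+-monoʳ-≤ 11 (cost-after result))))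
          (+-monoˡ-≤ _ (≤ᵇ⇒≤ 42 49 tt))
    where
    ρ₆ : Env
    ρ₆ = ρ [ 6 ↦ arr s reg rFP ]
    header : Cmd
    header = set-reg rFP (var 6 ⊞ get-reg rBS ⊞ lit 1) ⨟ assign dest (var 5) (var 6)
    s₁ s₂ : State
    s₁ = run header ρ₆ s
    s₂ = run (tryPatterns K) ρ₆ s₁
    FP : ℕ
    FP = arr s reg rFP
    ready : ReadyFor G (arr s heap) ρ₆ V q<2 m≤K μ s₁
    ready = parts-static G (keeps-static header ρ₆ s tt) (λ _ → refl) ≤-refl parts , record
      { under     = λ _ → refl
      ; unused    = λ a≥ → free (≤-trans (≤-trans (m≤m+n FP (arr s reg rBS)) (m≤m+n _ 1)) a≥)
      ; within-FP = subst (λ b → FP + blacks G (union G V (ρ 3)) < FP + b + 1) (sym bs≡) (≤-reflexive (+-comm 1 _))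
      ; reached   = λ {b} _ → inj₁ (free (m≤m+n FP b)) }
    result : Tried G (arr s heap) ρ₆ V q<2 m≤K μ K s₁ s₂ (cost (tryPatterns K) ρ₆ s₁)
    result = tryPatterns-correct G (arr s heap) ρ₆ V q<2 m≤K μ K s₁ ready
    after : ReadyFor G (arr s heap) ρ₆ V q<2 m≤K μ s₂
    after = ready-after result

  record Optimizing (S : Subset n) (s₀ : State) (i : ℕ) (s : State) : Set where
    field
      stable′ : Static s₀ s
      lower′  : ∀ {a} → a < arr s₀ reg rFP → arr s heap a ≡ arr s₀ heap a
      spare′  : Spare s
      fp-≤    : arr s₀ reg rFP ≤ arr s reg rFP
      bs-≡′   : arr s reg rBS ≡ blacks G S
      blocks  : ∀ {q} → q < i → arr s dest q + blacks G S < arr s reg rFP ×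
                  Optimal (arr s heap) (arr s dest q) (blacks G S) (Candidate G S q)
  open Optimizing

  optimizing-step : ∀ {S s₀} i s s′ → Optimizing S s₀ i s → Optimized S i s s′ → Optimizing S s₀ (suc i) s′
  optimizing-step {S} {s₀} i s s′ I O = record
    { stable′ = static-trans (stable′ I) (stable O)
    ; lower′  = λ a< → trans (lower O (<-≤-trans a< (fp-≤ I))) (lower′ I a<)
    ; spare′  = spare O
    ; fp-≤    = ≤-trans (fp-≤ I) FP≤
    ; bs-≡′   = trans (bs-kept O) (bs-≡′ I)
    ; blocks  = λ {q} q≤ → blocks′ q (m≤n⇒m<n∨m≡n (≤-pred q≤))
    }
    where
    FP≤ : arr s reg rFP ≤ arr s′ reg rFP
    FP≤ = <⇒≤ (≤-<-trans (m≤m+n _ (blacks G S)) (space O))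
    blocks′ : ∀ q → q < i ⊎ q ≡ i → arr s′ dest q + blacks G S < arr s′ reg rFP ×
      Optimal (arr s′ heap) (arr s′ dest q) (blacks G S) (Candidate G S q)
    blocks′ q (inj₂ refl) = subst (λ p → p + blacks G S < arr s′ reg rFP × Optimal (arr s′ heap) p (blacks G S) (Candidate G S q))
      (sym (dest-≡ O)) (space O , best O)
    blocks′ q (inj₁ q<i) = subst (λ p → p + blacks G S < arr s′ reg rFP × Optimal (arr s′ heap) p (blacks G S) (Candidate G S q))
      (sym (dest-else O (λ e → <-irrefl (sym e) q<i)))
      (<-≤-trans (proj₁ (blocks I q<i)) FP≤ ,
       optimal-heap (λ b≤ → lower O (≤-<-trans (+-monoʳ-≤ _ b≤) (proj₁ (blocks I q<i)))) (proj₂ (blocks I q<i)))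

  -- What a computation owes to the d items below it: their descriptions, with two entries of `ptr`
  -- each, and all heap cells below the old free pointer, where their blocks lie.
  record Grown (d : ℕ) (s s′ : State) : Set where
    field
      fp-grown   : arr s reg rFP ≤ arr s′ reg rFP
      heap-kept  : ∀ {a} → a < arr s reg rFP → arr s′ heap a ≡ arr s heap a
      len-kept   : ∀ {j} → j < d → arr s′ len j ≡ arr s len j
      brep-kept  : ∀ {j} → j < d → arr s′ brep j ≡ arr s brep j
      wrep-kept  : ∀ {j} → j < d → arr s′ wrep j ≡ arr s wrep j
      ptr-kept   : ∀ {j q} → j < d → q < 2 → arr s′ ptr (j + j + q) ≡ arr s ptr (j + j + q)
  open Grown public

  grown-refl : ∀ {d s} → Grown d s s
  grown-refl = record { fp-grown = ≤-refl ; heap-kept = λ _ → refl ; len-kept = λ _ → refl ; brep-kept = λ _ → refl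
                      ; wrep-kept = λ _ → refl ; ptr-kept = λ _ _ → refl }

  grown-trans : ∀ {d e s s′ s″} → d ≤ e → Grown d s s′ → Grown e s′ s″ → Grown d s s″
  grown-trans d≤e g h = record
    { fp-grown  = ≤-trans (fp-grown g) (fp-grown h)
    ; heap-kept = λ a< → trans (heap-kept h (<-≤-trans a< (fp-grown g))) (heap-kept g a<)
    ; len-kept  = λ j< → trans (len-kept h (<-≤-trans j< d≤e)) (len-kept g j<)
    ; brep-kept = λ j< → trans (brep-kept h (<-≤-trans j< d≤e)) (brep-kept g j<)
    ; wrep-kept = λ j< → trans (wrep-kept h (<-≤-trans j< d≤e)) (wrep-kept g j<)
    ; ptr-kept  = λ j< q< → trans (ptr-kept h (<-≤-trans j< d≤e) q<) (ptr-kept g j< q<) }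

  item-grown : ∀ {d s s′ j S} → Grown d s s′ → j < d → Item G s (arr s reg rFP) j S → Item G s′ (arr s′ reg rFP) j S
  item-grown {d} {s} {s′} {j} {S} g j< it = record
    { len-≡     = trans (len-kept g j<) (len-≡ it)
    ; room      = λ {q} q< → <-≤-trans (subst (λ p → p + blacks G S < arr s reg rFP) (sym (ptr-kept g j< q<)) (room it q<)) (fp-grown g)
    ; optimal   = λ {q} q< → subst (λ p → Optimal (arr s′ heap) p (blacks G S) (Candidate G S q)) (sym (ptr-kept g j< q<))
        (optimal-heap (λ b≤ → heap-kept g (≤-<-trans (+-monoʳ-≤ _ b≤) (room it q<))) (optimal it q<))
    ; black-rep = λ u∈ ub → let v , v∈ , vb , e = black-rep it u∈ ub in v , v∈ , vb , trans (brep-kept g j<) e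
    ; white-rep = λ u∈ uw → let v , v∈ , vw , e = white-rep it u∈ uw in v , v∈ , vw , trans (wrep-kept g j<) e
    }

  double-< : ∀ {j d q} → j < d → q < 2 → j + j + q < d + d
  double-< {j} {d} {q} j<d q<2 = begin-strict
    j + j + q     ≤⟨ +-monoʳ-≤ (j + j) (≤-pred q<2) ⟩
    j + j + 1     <⟨ ≤-reflexive (solve 1 (λ j → con 1 :+ (j :+ j :+ con 1) := (con 1 :+ j) :+ (con 1 :+ j)) refl j) ⟩
    suc j + suc j ≤⟨ +-mono-≤ j<d j<d ⟩
    d + d         ∎
    where
    open ≤-Reasoning
    open +-*-Solver

  finalize-grown : ∀ ρ s → Grown (ρ 4) s (run finalize ρ s)
  finalize-grown ρ s = record
    { fp-grown  = ≤-refl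
    ; heap-kept = λ _ → refl
    ; len-kept  = λ j< → ↦-other (arr s len) (λ e → <-irrefl (sym e) j<)
    ; brep-kept = λ j< → ↦-other (arr s brep) (λ e → <-irrefl (sym e) j<)
    ; wrep-kept = λ j< → ↦-other (arr s wrep) (λ e → <-irrefl (sym e) j<)
    ; ptr-kept  = λ j< q< → trans
        (↦-other (arr s ptr [ ρ 4 + ρ 4 ↦ arr s dest 0 ]) (λ e → <-irrefl (sym e) (<-≤-trans (double-< j< q<) (m≤m+n _ 1))))
        (↦-other (arr s ptr) (λ e → <-irrefl (sym e) (double-< j< q<)))
    }

  finalize-item : ∀ ρ {s₀ S m V} s → union G V m ≡ S → Optimizing S s₀ 2 s → Summary G V m s →
    Item G (run finalize ρ s) (arr s reg rFP) (ρ 4) S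
  finalize-item ρ {S = S} s refl I Y = record
    { len-≡     = trans (↦-same (arr s len) (ρ 4)) (bs-≡′ I)
    ; room      = λ {q} q< → subst (λ p → p + blacks G S < arr s reg rFP) (sym (pointer q q<)) (proj₁ (blocks I q<))
    ; optimal   = λ {q} q< → subst (λ p → Optimal (arr s heap) p (blacks G S) (Candidate G S q)) (sym (pointer q q<)) (proj₂ (blocks I q<))
    ; black-rep = λ u∈ ub → let v , v∈ , vb , e = br Y u∈ ub in v , v∈ , vb , trans (↦-same (arr s brep) (ρ 4)) e
    ; white-rep = λ u∈ uw → let v , v∈ , vw , e = wr Y u∈ uw in v , v∈ , vw , trans (↦-same (arr s wrep) (ρ 4)) e
    }
    where
    d = ρ 4
    pointer : ∀ q → q < 2 → (arr s ptr [ d + d ↦ arr s dest 0 ] [ d + d + 1 ↦ arr s dest 1 ]) (d + d + q) ≡ arr s dest q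
    pointer 0 _ rewrite +-identityʳ (d + d) =
      trans (↦-other (arr s ptr [ d + d ↦ arr s dest 0 ]) (λ e → <-irrefl (sym e) (≤-reflexive (+-comm 1 (d + d)))))
        (↦-same (arr s ptr) (d + d))
    pointer 1 _ = ↦-same (arr s ptr [ d + d ↦ arr s dest 0 ]) (d + d + 1)
    pointer (suc (suc _)) (s≤s (s≤s ()))

∨⁺ : ∀ {x y} → x ≡ false → y ≡ false → x ∨ y ≡ false
∨⁺ refl refl = refl

graph-array persistent : ℕ → Bool
graph-array a = (1 <ᵇ a) ∧ (a <ᵇ 6)

persistent rPH  = true
persistent rCD  = true
persistent rN   = true
persistent rBIG = true
persistent _    = false

record Ground (s s′ : State) : Set where
  field
    graph-kept : ∀ a k → T (graph-array a) → arr s′ a k ≡ arr s a k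
    reg-kept   : ∀ r → T (persistent r) → arr s′ reg r ≡ arr s reg r
    inp-kept   : inp s′ ≡ inp s
    out-kept   : out s′ ≡ out s
open Ground public

∧-intro : ∀ {x y} → T x → T y → T (x ∧ y)
∧-intro {true} _ q = q

silent-tryPatterns : ∀ k → T (silent (tryPatterns k))
silent-tryPatterns zero    = tt
silent-tryPatterns (suc k) = ∧-intro {silent (tryPatterns k)} (silent-tryPatterns k) (silent-tryPatterns k)

combine-reg : ∀ k r → T (persistent r) → mayWrite (combine k) reg r ≡ false
combine-reg k r p = ∨⁺ {mayWrite summarize reg r} (table₁ r p) (∨⁺ {mayWrite (optimize k) reg r}
  (optimize-reg k r (table₂ r p) (table₃ r p)) (table₄ r p))
  where
  table₁ : ∀ r → T (persistent r) → mayWrite summarize reg r ≡ false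
  table₁ rPH p = refl
  table₁ rCD p = refl
  table₁ rN p = refl
  table₁ rBIG p = refl
  table₂ : ∀ r → T (persistent r) → (rFP ≡ᵇ r) ≡ false
  table₂ (suc r) p = refl
  table₃ : ∀ r → T (persistent r) → mayWrite tryPattern reg r ≡ false
  table₃ rPH p = refl
  table₃ rCD p = refl
  table₃ rN p = refl
  table₃ rBIG p = refl
  table₄ : ∀ r → T (persistent r) → mayWrite finalize reg r ≡ false
  table₄ rPH p = refl
  table₄ rCD p = refl
  table₄ rN p = refl
  table₄ rBIG p = refl

combine-graph : ∀ k a i → T (graph-array a) → mayWrite (combine k) a i ≡ false
combine-graph k 2 i p = mayWrite-tryPatterns k 2 i refl refl ∨0
  where
  _∨0 : ∀ {x} → x ≡ false → x ∨ false ≡ false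
  refl ∨0 = refl
combine-graph k 3 i p = ∨⁺ {mayWrite (tryPatterns k) 3 i} (mayWrite-tryPatterns k 3 i refl refl) refl
combine-graph k 4 i p = ∨⁺ {mayWrite (tryPatterns k) 4 i} (mayWrite-tryPatterns k 4 i refl refl) refl
combine-graph k 5 i p = ∨⁺ {mayWrite (tryPatterns k) 5 i} (mayWrite-tryPatterns k 5 i refl refl) refl
combine-graph k (suc (suc (suc (suc (suc (suc a)))))) i ()

combine-silent : ∀ k → T (silent (combine k))
combine-silent k = ∧-intro {silent (tryPatterns k)} (silent-tryPatterns k) tt

combine-ground : ∀ k ρ s → Ground s (run (combine k) ρ s)
combine-ground k ρ s = record
  { graph-kept = λ a i p → frame (combine k) a i (combine-graph k a i p) ρ s
  ; reg-kept   = λ r p → frame (combine k) reg r (combine-reg k r p) ρ s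
  ; inp-kept   = proj₁ (silent-io (combine k) (combine-silent k) ρ s)
  ; out-kept   = proj₂ (silent-io (combine k) (combine-silent k) ρ s) }

-- True by computation, but stated over variables so that its uses compare names instead of
-- unfolding the intermediate states of `combine`. The similar equations for `when`, `loop` and
-- `bind` below have the same purpose.
run-bind₃ : ∀ {c x e c₁ c₂ c₃ ρ ρ′ s s₁ s₂} → c ≡ bind x e (c₁ ⨟ c₂ ⨟ c₃) → ρ′ ≡ ρ [ x ↦ eval e ρ (arr s) ] →
  s₁ ≡ run c₁ ρ′ s → s₂ ≡ run c₂ ρ′ s₁ → run c ρ s ≡ run c₃ ρ′ s₂
run-bind₃ refl refl refl refl = refl

cost-bind₃ : ∀ {c x e c₁ c₂ c₃ ρ ρ′ s s₁ s₂} → c ≡ bind x e (c₁ ⨟ c₂ ⨟ c₃) → ρ′ ≡ ρ [ x ↦ eval e ρ (arr s) ] →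
  s₁ ≡ run c₁ ρ′ s → s₂ ≡ run c₂ ρ′ s₁ →
  cost c ρ s ≡ costE e + 2 + (cost c₁ ρ′ s + (cost c₂ ρ′ s₁ + cost c₃ ρ′ s₂))
cost-bind₃ refl refl refl refl = refl

module _ {n : ℕ} (G : BipartiteGraph n) where
  open BipartiteGraph G

  record Pushed (S : Subset n) (d : ℕ) (s s′ : State) : Set where
    field
      sp-≡       : arr s′ reg rSP ≡ suc d
      top-item   : Item G s′ (arr s′ reg rFP) d S
      grown      : Grown G d s s′
      spare-room : Spare G s′
  open Pushed public

  pushed : ∀ {ρ V s} s₁ s₂ → Static s s₁ → (∀ a → arr s₁ heap a ≡ arr s heap a) → arr s₁ reg rFP ≡ arr s reg rFP →
    Summary G V (ρ 3) s₂ → Optimizing G (union G V (ρ 3)) s₁ 2 s₂ →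
    Pushed (union G V (ρ 3)) (ρ 4) s (run finalize ρ s₂)
  pushed {ρ} {V} {s} s₁ s₂ st h f Y I = record
    { sp-≡       = +-comm (ρ 4) 1
    ; top-item   = finalize-item G ρ s₂ refl I Y
    ; grown      = grown-trans G ≤-refl before (finalize-grown G ρ s₂)
    ; spare-room = Optimizing.spare′ I }
    where
    st₂ : Static s s₂
    st₂ = static-trans st (Optimizing.stable′ I)
    before : Grown G (ρ 4) s s₂
    before = record
      { fp-grown  = ≤-trans (≤-reflexive (sym f)) (Optimizing.fp-≤ I)
      ; heap-kept = λ {a} a< → trans (Optimizing.lower′ I (<-≤-trans a< (≤-reflexive (sym f)))) (h a)
      ; len-kept  = λ _ → same st₂ len _ tt
      ; brep-kept = λ _ → same st₂ brep _ tt
      ; wrep-kept = λ _ → same st₂ wrep _ tt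
      ; ptr-kept  = λ _ _ → same st₂ ptr _ tt }

  -- The summary costs x and the two optimizations y; computing the base of the group costs 13 and
  -- `finalize` costs 105. Constants are turned into multiples of M, which is positive.
  combine-cost : ∀ {K M m x y} → 1 ≤ M → m ≤ K → x ≤ 17 + m * 200 → y ≤ 7 + 2 * (49 + tryPatternsCost K K * M + 4) →
    13 + (x + (y + 105)) ≤ combineCost K * M
  combine-cost {K} {M} {m} {x} {y} 1≤M m≤K p q = begin
    13 + (x + (y + 105))
      ≤⟨ +-monoʳ-≤ 13 (+-mono-≤ (≤-trans p (+-monoʳ-≤ 17 (*-monoˡ-≤ 200 m≤K))) (+-monoˡ-≤ 105 q)) ⟩
    13 + (17 + K * 200 + (7 + 2 * (49 + t * M + 4) + 105))
      ≡⟨ solve 3 (λ K t M → con 13 :+ (con 17 :+ K :* con 200 :+ (con 7 :+ con 2 :* (con 49 :+ t :* M :+ con 4) :+ con 105))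
           := (con 248 :+ K :* con 200) :* con 1 :+ con 2 :* t :* M) refl K t M ⟩
    (248 + K * 200) * 1 + 2 * t * M
      ≤⟨ +-monoˡ-≤ _ (*-mono-≤ (+-monoˡ-≤ (K * 200) (≤ᵇ⇒≤ 248 400 tt)) 1≤M) ⟩
    (400 + K * 200) * M + 2 * t * M
      ≡⟨ *-distribʳ-+ M (400 + K * 200) (2 * t) ⟨
    combineCost K * M ∎
    where
    open ≤-Reasoning
    open +-*-Solver
    t = tryPatternsCost K K

  combine-correct : ∀ {K M} ρ V s → ρ 3 ≤ K → MeasureOf G V (ρ 3) M →
    Parts G s (ρ 3) (arr s reg rSP ∸ ρ 3) (arr s reg rFP) V → Spare G s →
    Pushed (union G V (ρ 3)) (arr s reg rSP ∸ ρ 3) s (run (combine K) ρ s) ×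
    cost (combine K) ρ s ≤ combineCost K * M
  combine-correct {K} {M} ρ V s m≤K μ parts free =
    subst (Pushed S d s) (sym run-≡) (pushed {ρ₄} {V} {s} s₁ s₂ st₁ heap₁ fp₁ summary₂ (proj₁ opts)) ,
    subst (_≤ combineCost K * M) (sym cost-≡)
      (combine-cost {m = ρ 3} {cost summarize ρ₄ s} {cost (loop 5 (lit 2) (optimize K)) ρ₄ s₁}
        (≤-trans (s≤s z≤n) (sums μ {ρ 3} ≤-refl)) m≤K (proj₂ summary) (proj₂ opts))
    where
    S = union G V (ρ 3)
    d = arr s reg rSP ∸ ρ 3
    ρ₄ : Env
    ρ₄ = ρ [ 4 ↦ d ]
    s₁ s₂ : State
    s₁ = run summarize ρ₄ s
    s₂ = run (loop 5 (lit 2) (optimize K)) ρ₄ s₁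
    run-≡ : run (combine K) ρ s ≡ run finalize ρ₄ s₂
    run-≡ = run-bind₃ {combine K} {4} {get-reg rSP ⊟ var 3} {summarize} {loop 5 (lit 2) (optimize K)} {finalize}
      {ρ} {ρ₄} {s} {s₁} {s₂} refl refl refl refl
    cost-≡ : cost (combine K) ρ s ≡
      13 + (cost summarize ρ₄ s + (cost (loop 5 (lit 2) (optimize K)) ρ₄ s₁ + 105))
    cost-≡ = cost-bind₃ {combine K} {4} {get-reg rSP ⊟ var 3} {summarize} {loop 5 (lit 2) (optimize K)} {finalize}
      {ρ} {ρ₄} {s} {s₁} {s₂} refl refl refl refl
    st₁ : Static s s₁
    st₁ = keeps-static summarize ρ₄ s tt
    heap₁ : ∀ a → arr s₁ heap a ≡ arr s heap a
    heap₁ a = frame summarize heap a refl ρ₄ s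
    fp₁ : arr s₁ reg rFP ≡ arr s reg rFP
    fp₁ = frame summarize reg rFP refl ρ₄ s
    summary : Summary G V (ρ 3) s₁ × cost summarize ρ₄ s ≤ 17 + ρ 3 * 200
    summary = summarize-correct G ρ₄ V s parts
    spare₁ : Spare G s₁
    spare₁ {a} a≥ = trans (heap₁ a) (free (≤-trans (≤-reflexive (sym fp₁)) a≥))
    round : ∀ i s′ → i < 2 → Preserved (optimize K) s₁ s′ → Optimizing G S s₁ i s′ →
      Optimizing G S s₁ (suc i) (run (optimize K) (ρ₄ [ 5 ↦ i ]) s′) ×
      cost (optimize K) (ρ₄ [ 5 ↦ i ]) s′ ≤ 49 + tryPatternsCost K K * M
    round i s′ i<2 _ I =
      let O , c = optimize-correct G (ρ₄ [ 5 ↦ i ]) V s′ i<2 m≤K μ parts′ (Optimizing.spare′ I) (Optimizing.bs-≡′ I)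
      in optimizing-step G i s′ (run (optimize K) (ρ₄ [ 5 ↦ i ]) s′) I O , c
      where
      parts′ : Parts G s′ (ρ 3) d (arr s′ reg rFP) V
      parts′ = parts-static G (static-trans st₁ (Optimizing.stable′ I))
        (λ {a} a< → trans (Optimizing.lower′ I (<-≤-trans a< (≤-reflexive (sym fp₁)))) (heap₁ a))
        (≤-trans (≤-reflexive (sym fp₁)) (Optimizing.fp-≤ I)) parts
    opts : Optimizing G S s₁ 2 s₂ × cost (loop 5 (lit 2) (optimize K)) ρ₄ s₁ ≤ 7 + 2 * (49 + tryPatternsCost K K * M + 4)
    opts = loop-rule⁺ (Optimizing G S s₁) 5 (lit 2) (optimize K) ρ₄ s₁ 2 (49 + tryPatternsCost K K * M) refl
      (record { stable′ = static-refl ; lower′ = λ _ → refl ; spare′ = spare₁ ; fp-≤ = ≤-refl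
              ; bs-≡′ = bs-≡ (proj₁ summary) ; blocks = λ () })
      round
    reg₂ : ∀ r → (rFP ≡ᵇ r) ≡ false → mayWrite tryPattern reg r ≡ false → arr s₂ reg r ≡ arr s₁ reg r
    reg₂ r p q = frame (loop 5 (lit 2) (optimize K)) reg r (optimize-reg K r p q) ρ₄ s₁
    summary₂ : Summary G V (ρ 3) s₂
    summary₂ = record
      { bs-≡ = trans (reg₂ rBS refl refl) (bs-≡ (proj₁ summary))
      ; br   = λ u∈ ub → let v , v∈ , vb , e = br (proj₁ summary) u∈ ub in v , v∈ , vb , trans (reg₂ rBR refl refl) e
      ; wr   = λ u∈ uw → let v , v∈ , vw , e = wr (proj₁ summary) u∈ uw in v , v∈ , vw , trans (reg₂ rWR refl refl) e }

-- Sums of products of sizes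

nth : {A : Set} → A → List A → ℕ → A
nth z []       _       = z
nth z (x ∷ xs) zero    = x
nth z (x ∷ xs) (suc i) = nth z xs i

prefix-sum : List ℕ → ℕ → ℕ
prefix-sum xs zero    = 0
prefix-sum xs (suc i) = prefix-sum xs i + nth 0 xs i

-- `pairs` is the second elementary symmetric polynomial, the sum of the products of two entries at
-- different positions.
squares pairs : List ℕ → ℕ
squares []       = 0
squares (x ∷ xs) = x ^ 2 + squares xs
pairs []       = 0
pairs (x ∷ xs) = x * sum xs + pairs xs

square-sum : ∀ xs → sum xs ^ 2 ≡ squares xs + 2 * pairs xs
square-sum []       = refl
square-sum (x ∷ xs) = trans
  (solve 2 (λ x s → (x :+ s) :^ 2 := x :^ 2 :+ s :^ 2 :+ con 2 :* (x :* s)) refl x (sum xs))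
  (trans (cong (λ t → x ^ 2 + t + 2 * (x * sum xs)) (square-sum xs))
    (solve 4 (λ x s q p → x :^ 2 :+ (q :+ con 2 :* p) :+ con 2 :* (x :* s) := x :^ 2 :+ q :+ con 2 :* (x :* s :+ p))
      refl x (sum xs) (squares xs) (pairs xs)))
  where open +-*-Solver

prefix-sum-∷ : ∀ x xs i → prefix-sum (x ∷ xs) (suc i) ≡ x + prefix-sum xs i
prefix-sum-∷ x xs zero    = sym (+-identityʳ x)
prefix-sum-∷ x xs (suc i) = trans (cong (_+ nth 0 xs i) (prefix-sum-∷ x xs i)) (+-assoc x _ _)

prefix-sum-all : ∀ xs → prefix-sum xs (length xs) ≡ sum xs
prefix-sum-all []       = refl
prefix-sum-all (x ∷ xs) = trans (prefix-sum-∷ x xs (length xs)) (cong (x +_) (prefix-sum-all xs))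

prefix-sum-≤ : ∀ xs i → prefix-sum xs i ≤ sum xs
prefix-sum-≤ xs       zero    = z≤n
prefix-sum-≤ []       (suc i) = ≤-trans (≤-reflexive (+-identityʳ _)) (prefix-sum-≤ [] i)
prefix-sum-≤ (x ∷ xs) (suc i) = ≤-trans (≤-reflexive (prefix-sum-∷ x xs i)) (+-monoʳ-≤ x (prefix-sum-≤ xs i))

nth-≤-sum : ∀ xs i → nth 0 xs i ≤ sum xs
nth-≤-sum []       i       = z≤n
nth-≤-sum (x ∷ xs) zero    = m≤m+n x _
nth-≤-sum (x ∷ xs) (suc i) = ≤-trans (nth-≤-sum xs i) (m≤n+m _ x)

-- The i-th convolution of a node meets part i with all parts before it, and the products involved
-- are distinct terms of `pairs`.
prefix-product : ∀ xs i → prefix-sum xs i * nth 0 xs i ≤ pairs xs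
prefix-product []       i       = ≤-reflexive (*-zeroʳ (prefix-sum [] i))
prefix-product (x ∷ xs) zero    = z≤n
prefix-product (x ∷ xs) (suc i) = begin
  prefix-sum (x ∷ xs) (suc i) * nth 0 xs i        ≡⟨ cong (_* nth 0 xs i) (prefix-sum-∷ x xs i) ⟩
  (x + prefix-sum xs i) * nth 0 xs i              ≡⟨ *-distribʳ-+ (nth 0 xs i) x _ ⟩
  x * nth 0 xs i + prefix-sum xs i * nth 0 xs i   ≤⟨ +-mono-≤ (*-monoʳ-≤ x (nth-≤-sum xs i)) (prefix-product xs i) ⟩
  pairs (x ∷ xs)                                  ∎
  where open ≤-Reasoning

-- This is (a - 1)(b - 1) ≥ 0.
sum≤1+product : ∀ {a b} → 1 ≤ a → 1 ≤ b → a + b ≤ 1 + a * b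
sum≤1+product {suc a} {suc b} _ _ = begin
  suc a + suc b                 ≤⟨ m≤m+n _ (a * b) ⟩
  suc a + suc b + a * b         ≡⟨ solve 2 (λ a b → con 1 :+ a :+ (con 1 :+ b) :+ a :* b := con 1 :+ (con 1 :+ a) :* (con 1 :+ b)) refl a b ⟩
  1 + suc a * suc b             ∎
  where
  open ≤-Reasoning
  open +-*-Solver

Positive : List ℕ → Set
Positive = All (1 ≤_)

sum-positive : ∀ {xs} → 1 ≤ length xs → Positive xs → 1 ≤ sum xs
sum-positive _ (p ∷ _) = ≤-trans p (m≤m+n _ _)

sum≤1+pairs : ∀ {xs} → 2 ≤ length xs → Positive xs → sum xs ≤ 1 + pairs xs
sum≤1+pairs (s≤s l) (p ∷ ps) = ≤-trans (sum≤1+product p (sum-positive l ps)) (s≤s (m≤m+n _ _))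

1≤pairs : ∀ {xs} → 2 ≤ length xs → Positive xs → 1 ≤ pairs xs
1≤pairs (s≤s l) (p ∷ ps) = ≤-trans (*-mono-≤ p (sum-positive l ps)) (m≤m+n _ _)

-- The successors come from the cells for zero black vertices. They contribute 1 + (a + b), at most
-- 2 + `pairs`, which the positivity of `pairs` turns into three of the four copies.
sizes-measure : ∀ {xs f g} → 2 ≤ length xs → Positive xs →
  (∀ {i} → i ≤ length xs → f i ≤ prefix-sum xs i) → (∀ {i} → i < length xs → g i ≤ nth 0 xs i) →
  Measure (4 * pairs xs) (length xs) f g
sizes-measure {xs} {f} {g} l ps F H = record
  { products = λ {i} i< → begin
      suc (f i) * suc (g i)     ≤⟨ *-mono-≤ (s≤s (F (<⇒≤ i<))) (s≤s (H i<)) ⟩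
      suc (a i) * suc (b i)     ≡⟨ solve 2 (λ a b → (con 1 :+ a) :* (con 1 :+ b) := con 1 :+ (a :+ b) :+ a :* b) refl (a i) (b i) ⟩
      1 + (a i + b i) + a i * b i
        ≤⟨ +-mono-≤ (s≤s (≤-trans (prefix-sum-≤ xs (suc i)) (sum≤1+pairs l ps))) (prefix-product xs i) ⟩
      1 + (1 + p) + p           ≤⟨ +-monoˡ-≤ p (+-mono-≤ 1≤p (+-monoˡ-≤ p 1≤p)) ⟩
      p + (p + p) + p           ≡⟨ solve 1 (λ p → p :+ (p :+ p) :+ p := con 4 :* p) refl p ⟩
      4 * p                     ∎
  ; sums = λ {i} i≤ → begin
      suc (f i)                 ≤⟨ s≤s (≤-trans (F i≤) (≤-trans (prefix-sum-≤ xs i) (sum≤1+pairs l ps))) ⟩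
      1 + (1 + p)               ≤⟨ +-mono-≤ 1≤p (+-monoˡ-≤ p 1≤p) ⟩
      p + (p + p)               ≤⟨ m≤m+n _ p ⟩
      p + (p + p) + p           ≡⟨ solve 1 (λ p → p :+ (p :+ p) :+ p := con 4 :* p) refl p ⟩
      4 * p                     ∎ }
  where
  open ≤-Reasoning
  open +-*-Solver
  a = prefix-sum xs
  b = nth 0 xs
  p = pairs xs
  1≤p : 1 ≤ p
  1≤p = 1≤pairs l ps

nth-pairs : ∀ {A : Set} {R : A → A → Set} {z xs} → AllPairs R xs → ∀ {i j} → i < j → j < length xs → R (nth z xs i) (nth z xs j)
nth-pairs {z = z} (p ∷ ps) {zero}  {suc j} _ (s≤s j<) = lookup-all p j<
  where
  lookup-all : ∀ {A : Set} {P : A → Set} {z xs} → All P xs → ∀ {j} → j < length xs → P (nth z xs j)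
  lookup-all (p ∷ ps) {zero}  _        = p
  lookup-all (p ∷ ps) {suc j} (s≤s j<) = lookup-all ps j<
nth-pairs (p ∷ ps) {suc i} {suc j} (s≤s i<j) (s≤s j<) = nth-pairs ps i<j j<

nth-map : ∀ {A : Set} (f : A → ℕ) {z} xs {i} → i < length xs → nth 0 (map f xs) i ≡ f (nth z xs i)
nth-map f (x ∷ xs) {zero}  _        = refl
nth-map f (x ∷ xs) {suc i} (s≤s i<) = nth-map f xs i<

-- Relations between the parts of a decomposition

∈-⋃⁻ : ∀ {n} (Vs : List (Subset n)) {v} → v ∈ₛ ⋃ Vs → ∃[ i ] i < length Vs × v ∈ₛ nth ∅ Vs i
∈-⋃⁻ []       v∈ = ⊥-elim (∉⊥ v∈)
∈-⋃⁻ (V ∷ Vs) v∈ with x∈p∪q⁻ V (⋃ Vs) v∈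
... | inj₁ p = 0 , s≤s z≤n , p
... | inj₂ p with ∈-⋃⁻ Vs p
...   | i , i< , q = suc i , s≤s i< , q

∈-⋃⁺ : ∀ {n} (Vs : List (Subset n)) {i v} → i < length Vs → v ∈ₛ nth ∅ Vs i → v ∈ₛ ⋃ Vs
∈-⋃⁺ (V ∷ Vs) {zero}  _        v∈ = x∈p∪q⁺ (inj₁ v∈)
∈-⋃⁺ (V ∷ Vs) {suc i} (s≤s i<) v∈ = x∈p∪q⁺ (inj₂ (∈-⋃⁺ Vs i< v∈))

∈-⋃-all : ∀ {n} {P : Subset n → Set} {Vs v} → All P Vs → v ∈ₛ ⋃ Vs → ∃[ V ] P V × v ∈ₛ V
∈-⋃-all []               v∈ = ⊥-elim (∉⊥ v∈)
∈-⋃-all {Vs = V ∷ Vs} (p ∷ ps) v∈ with x∈p∪q⁻ V (⋃ Vs) v∈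
... | inj₁ q = V , p , q
... | inj₂ q = ∈-⋃-all ps q

⊆-⋃ : ∀ {n} {Vs : List (Subset n)} {V} → V ∈ Vs → V ⊆ ⋃ Vs
⊆-⋃ (here refl) v∈ = x∈p∪q⁺ (inj₁ v∈)
⊆-⋃ (there p)   v∈ = x∈p∪q⁺ (inj₂ (⊆-⋃ p v∈))

Disjoint : ∀ {n} → Subset n → Subset n → Set
Disjoint X Y = Empty (X ∩ Y)

card : ∀ {n} → Subset n → ℕ
card = weigh (λ _ → 1)

card-positive : ∀ {n} {S : Subset n} → Nonempty S → 1 ≤ card S
card-positive {S = S} (v , v∈) = weigh-∈ (λ _ → 1) S v∈

disjoint-⋃ : ∀ {n} {V : Subset n} {Vs} → All (Disjoint V) Vs → Disjoint V (⋃ Vs)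
disjoint-⋃ {V = V} {Vs} ds (v , v∈) =
  let Y , d , v∈Y = ∈-⋃-all ds (p∩q⊆q V (⋃ Vs) v∈)
  in d (v , x∈p∩q⁺ (p∩q⊆p V (⋃ Vs) v∈ , v∈Y))

card-⋃ : ∀ {n} {Vs : List (Subset n)} → AllPairs Disjoint Vs → card (⋃ Vs) ≡ sum (map card Vs)
card-⋃ {n} {[]}     []       = weigh-∅ {n} (λ _ → 1)
card-⋃ {n} {V ∷ Vs} (d ∷ ds) = trans (weigh-∪ (λ _ → 1) V (⋃ Vs) (disjoint-⋃ d)) (cong (card V +_) (card-⋃ ds))

cards-positive : ∀ {n} {Vs : List (Subset n)} → All Nonempty Vs → Positive (map card Vs)
cards-positive []       = []
cards-positive (p ∷ ps) = card-positive p ∷ cards-positive ps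

module _ {n : ℕ} (G : BipartiteGraph n) where
  open BipartiteGraph G

  Biuniform : Subset n → Subset n → Set
  Biuniform X Y = Uniform G X Y × Uniform G Y X

  -- `tame-⋃` is what permits merging two parts at a time from the right: a part is in the relation
  -- to the union of all later ones, and by `tame-uniform` representatives still decide.
  record Tame (R : Subset n → Subset n → Set) : Set where
    field
      tame-uniform : ∀ {X Y} → R X Y → Biuniform X Y
      tame-⋃       : ∀ {X Vs} → All (R X) Vs → R X (⋃ Vs)
  open Tame public

  tame-nonadjacent : Tame (Nonadjacent G)
  tame-nonadjacent = record
    { tame-uniform = λ r → (λ u∈ _ _ _ v∈ _ _ _ e → ⊥-elim (r u∈ v∈ e)) ,
                           (λ u∈ _ _ _ v∈ _ _ _ e → ⊥-elim (r v∈ u∈ (symmetric e)))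
    ; tame-⋃ = λ rs u∈ v∈ → let Y , r , v∈Y = ∈-⋃-all rs v∈ in r u∈ v∈Y }

  both : ∀ {X Y : Subset n} {v} → v ∈ₛ X → v ∈ₛ Y → v ∈ₛ X ∩ Y
  both p q = x∈p∩q⁺ (p , q)

  tame-fully : Tame (FullyAdjacent G)
  tame-fully = record
    { tame-uniform = λ (r , r′) →
        (λ _ _ u∈ ub _ _ v∈ vw _ → r (both u∈ ub) (both v∈ (x∉p⇒x∈∁p vw))) ,
        (λ _ _ u∈ ub _ _ v∈ vw _ → symmetric (r′ (both v∈ (x∉p⇒x∈∁p vw)) (both u∈ ub)))
    ; tame-⋃ = λ {X} {Vs} rs →
        (λ u∈ v∈ → let Y , r , v∈Y = ∈-⋃-all rs (p∩q⊆p (⋃ Vs) W v∈) in proj₁ r u∈ (both v∈Y (p∩q⊆q (⋃ Vs) W v∈))) ,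
        (λ u∈ v∈ → let Y , r , v∈Y = ∈-⋃-all rs (p∩q⊆p (⋃ Vs) B v∈) in proj₂ r u∈ (both v∈Y (p∩q⊆q (⋃ Vs) B v∈))) }

  tame-left : Tame (LeftAdjacent G)
  tame-left = record
    { tame-uniform = λ (r , r′) →
        (λ _ _ u∈ ub _ _ v∈ vw _ → r (both u∈ ub) (both v∈ (x∉p⇒x∈∁p vw))) ,
        (λ u∈ ub _ _ v∈ vw _ _ e → ⊥-elim (r′ (both v∈ (x∉p⇒x∈∁p vw)) (both u∈ ub) (symmetric e)))
    ; tame-⋃ = λ {X} {Vs} rs →
        (λ u∈ v∈ → let Y , r , v∈Y = ∈-⋃-all rs (p∩q⊆p (⋃ Vs) W v∈) in proj₁ r u∈ (both v∈Y (p∩q⊆q (⋃ Vs) W v∈))) ,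
        (λ u∈ v∈ → let Y , r , v∈Y = ∈-⋃-all rs (p∩q⊆p (⋃ Vs) B v∈) in proj₂ r u∈ (both v∈Y (p∩q⊆q (⋃ Vs) B v∈))) }

  Modular : Subset n → Subset n → Set
  Modular S M = ∀ {v} → v ∈ₛ S → v ∉ M → Nonadjacent G ⁅ v ⁆ M ⊎ FullyAdjacent G ⁅ v ⁆ M

  singleton-modular : ∀ S x → Modular S ⁅ x ⁆
  singleton-modular S x {v} _ _ with x ∈? N v
  ... | no x∉ = inj₁ λ u∈ y∈ e → x∉ (subst₂ (λ u y → y ∈ₛ N u) (x∈⁅y⁆⇒x≡y v u∈) (x∈⁅y⁆⇒x≡y x y∈) e)
  ... | yes x∈ = inj₂ (full , full)
    where
    full : ∀ {P Q u y} → u ∈ₛ ⁅ v ⁆ ∩ P → y ∈ₛ ⁅ x ⁆ ∩ Q → y ∈ₛ N u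
    full {P} {Q} u∈ y∈ = subst₂ (λ u y → y ∈ₛ N u) (sym (x∈⁅y⁆⇒x≡y v (p∩q⊆p ⁅ v ⁆ P u∈))) (sym (x∈⁅y⁆⇒x≡y x (p∩q⊆p ⁅ x ⁆ Q y∈))) x∈

  -- The ends of an edge are moved one at a time: u lies outside Y, so it is adjacent to v′ as well;
  -- v′ lies outside X, so it is adjacent to u′ as well.
  modular-uniform : ∀ {S X Y} → X ⊆ S → Y ⊆ S → Disjoint X Y → Modular S X → Modular S Y → Uniform G X Y
  modular-uniform {S} {X} {Y} X⊆ Y⊆ d mX mY {u} {u′} {v} {v′} u∈ ub u′∈ u′b v∈ vw v′∈ v′w e
    with mY (X⊆ u∈) (λ u∈Y → d (u , both u∈ u∈Y)) | mX (Y⊆ v′∈) (λ v′∈X → d (v′ , both v′∈X v′∈))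
  ... | inj₁ non | _ = ⊥-elim (non (x∈⁅x⁆ u) v∈ e)
  ... | inj₂ full | inj₁ non = ⊥-elim (non (x∈⁅x⁆ v′) u∈ (symmetric (proj₁ full (both (x∈⁅x⁆ u) ub) (both v′∈ (x∉p⇒x∈∁p v′w)))))
  ... | inj₂ _ | inj₂ full = symmetric (proj₂ full (both (x∈⁅x⁆ v′) (x∉p⇒x∈∁p v′w)) (both u′∈ u′b))

  module _ {S : Subset n} {Vs : List (Subset n)} (p : PrimeDecomposition G S Vs) where

    private
      2≤S : 2 ≤ ∣ S ∣
      2≤S = proj₁ p
      partition : Partition S Vs
      partition = proj₁ (proj₂ (proj₂ (proj₂ (proj₂ p))))
      parts-≡ : ∀ X → X ∈ Vs ⇔ (CanonicalBimodule G S X ⊎ RemainingSingleton G S X)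
      parts-≡ = proj₂ (proj₂ (proj₂ (proj₂ (proj₂ p))))

    prime-modular : ∀ {X} → X ∈ Vs → Modular S X
    prime-modular {X} X∈ with Equivalence.to (parts-≡ X) X∈
    ... | inj₁ (((_ , m) , _) , _)   = m
    ... | inj₂ (x , _ , _ , refl) = singleton-modular S x

    prime-proper : ∀ {X} → X ∈ Vs → X ≢ S
    prime-proper {X} X∈ e with Equivalence.to (parts-≡ X) X∈
    ... | inj₁ ((_ , _ , ne) , _)  = ne e
    ... | inj₂ (x , _ , _ , refl) = case subst (2 ≤_) (trans (cong ∣_∣ (sym e)) (∣⁅x⁆∣≡1 x)) 2≤S of λ { (s≤s ()) }

    prime-uniform : AllPairs Biuniform Vs
    prime-uniform = go Vs id (proj₁ (proj₂ partition))
      where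
      inside : ∀ {X} → X ∈ Vs → X ⊆ S
      inside X∈ v∈ = subst (_ ∈ₛ_) (proj₂ (proj₂ partition)) (⊆-⋃ X∈ v∈)
      against : ∀ {X} Ys → X ∈ Vs → (∀ {Y} → Y ∈ Ys → Y ∈ Vs) → All (Disjoint X) Ys → All (Biuniform X) Ys
      against []       X∈ f []       = []
      against {X} (Y ∷ Ys) X∈ f (d ∷ ds) =
        (modular-uniform (inside X∈) (inside Y∈) d (prime-modular X∈) (prime-modular Y∈) ,
         modular-uniform (inside Y∈) (inside X∈) (λ (v , v∈) → d (v , both (p∩q⊆q Y X v∈) (p∩q⊆p Y X v∈)))
           (prime-modular Y∈) (prime-modular X∈))
        ∷ against Ys X∈ (f ∘ there) ds
        where
        Y∈ : Y ∈ Vs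
        Y∈ = f (here refl)
      go : ∀ Xs → (∀ {X} → X ∈ Xs → X ∈ Vs) → AllPairs Disjoint Xs → AllPairs Biuniform Xs
      go []       f []       = []
      go (X ∷ Xs) f (d ∷ ds) = against Xs (f (here refl)) (f ∘ there) d ∷ go Xs (f ∘ there) ds

    -- A single part would be all of S, and no part at all would leave S empty.
    prime-length : 2 ≤ length Vs
    prime-length = go Vs (proj₂ (proj₂ partition)) prime-proper
      where
      go : ∀ Xs → ⋃ Xs ≡ S → (∀ {X} → X ∈ Xs → X ≢ S) → 2 ≤ length Xs
      go []           e f = ⊥-elim (case subst (2 ≤_) (trans (cong ∣_∣ (sym e)) (∣⊥∣≡0 n)) 2≤S of λ ())
      go (X ∷ [])     e f = ⊥-elim (f (here refl) (trans (sym (∪-identityʳ X)) e))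
      go (X ∷ Y ∷ Xs) e f = s≤s (s≤s z≤n)

-- The stack machine

run-when-0 : ∀ {c e c₁ c₀ ρ s} → c ≡ when e c₁ c₀ → eval e ρ (arr s) ≡ 0 → run c ρ s ≡ run c₀ ρ s
run-when-0 refl p = branch-0 p

run-when-1 : ∀ {c e c₁ c₀ ρ s} → c ≡ when e c₁ c₀ → eval e ρ (arr s) ≢ 0 → run c ρ s ≡ run c₁ ρ s
run-when-1 refl p = branch-1 p

cost-when-0 : ∀ {c e c₁ c₀ ρ s} → c ≡ when e c₁ c₀ → eval e ρ (arr s) ≡ 0 → cost c ρ s ≡ costE e + 3 + cost c₀ ρ s
cost-when-0 {e = e} refl p = cong (costE e + 3 +_) (branch-0 p)

cost-when-1 : ∀ {c e c₁ c₀ ρ s} → c ≡ when e c₁ c₀ → eval e ρ (arr s) ≢ 0 → cost c ρ s ≡ costE e + 3 + cost c₁ ρ s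
cost-when-1 {e = e} refl p = cong (costE e + 3 +_) (branch-1 p)

run-⨟-bind : ∀ {c c₁ x e c₂ ρ ρ′ s s₁} → c ≡ (c₁ ⨟ bind x e c₂) → s₁ ≡ run c₁ ρ s → ρ′ ≡ ρ [ x ↦ eval e ρ (arr s₁) ] →
  run c ρ s ≡ run c₂ ρ′ s₁
run-⨟-bind refl refl refl = refl

cost-⨟-bind : ∀ {c c₁ x e c₂ ρ ρ′ s s₁} → c ≡ (c₁ ⨟ bind x e c₂) → s₁ ≡ run c₁ ρ s → ρ′ ≡ ρ [ x ↦ eval e ρ (arr s₁) ] →
  cost c ρ s ≡ cost c₁ ρ s + (costE e + 2 + cost c₂ ρ′ s₁)
cost-⨟-bind refl refl refl = refl

-- Trace f g i s m s′ c: m rounds of a loop with body f and cost g, starting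
-- with round i, lead from s to s′ at cost c.
data Trace (f : ℕ → State → State) (g : ℕ → State → ℕ) (i : ℕ) (s : State) : ℕ → State → ℕ → Set where
  none  : Trace f g i s 0 s 0
  round : ∀ {m s′ s″ c} → f i s ≡ s′ → Trace f g (suc i) s′ m s″ c → Trace f g i s (suc m) s″ (g i s + 4 + c)

trace-shift : ∀ {f g i j s m s′ c} → i ≡ j → Trace f g i s m s′ c → Trace f g j s m s′ c
trace-shift refl t = t

trace-++ : ∀ {f g i s m s′ c m′ s″ c′} → Trace f g i s m s′ c → Trace f g (m + i) s′ m′ s″ c′ →
  Trace f g i s (m + m′) s″ (c + c′)
trace-++ none q = q
trace-++ {f} {g} {i} {s} {suc m} {m′ = m′} {s″} {c′ = c′} (round {c = c} e p) q =
  subst (Trace f g i s (suc (m + m′)) s″) (sym (+-assoc (g i s + 4) c c′))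
    (round e (trace-++ p (trace-shift (sym (+-suc m i)) q)))

trace-iter : ∀ {f g i s m s′ c} s₀ → s ≡ iter i f s₀ → Trace f g i s m s′ c →
  s′ ≡ iter (m + i) f s₀ × iterCost i g f s₀ + c ≡ iterCost (m + i) g f s₀
trace-iter s₀ e none = e , +-identityʳ _
trace-iter {f} {g} {i} {s} {suc m} {s″} s₀ refl (round {c = c} refl p) with trace-iter {f} {g} {suc i} s₀ refl p
... | e′ , c′ = subst (λ j → s″ ≡ iter j f s₀) (+-suc m i) e′ ,
  trans (sym (+-assoc (iterCost i g f s₀) (g i (iter i f s₀) + 4) c)) (trans c′ (cong (λ j → iterCost j g f s₀) (+-suc m i)))

trace-cast : ∀ {f g i s m s′ c m′ s″ c′} → m ≡ m′ → s′ ≡ s″ → c ≡ c′ → Trace f g i s m s′ c → Trace f g i s m′ s″ c′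
trace-cast refl refl refl t = t

-- A node takes a round for its code, of cost 29, and a round for its argument, of cost 39 besides
-- the processing; with the overhead 4 of either round this makes 76.
two-rounds : ∀ (f : ℕ → State → State) (g : ℕ → State → ℕ) i s s₁ s₂ x → f i s ≡ s₁ → g i s ≡ 29 → f (suc i) s₁ ≡ s₂ →
  g (suc i) s₁ ≡ 39 + x → Trace f g i s 2 s₂ (76 + x)
two-rounds f g i s s₁ s₂ x p q p′ q′ = trace-cast refl refl
  (trans (cong₂ (λ a b → a + 4 + (b + 4 + 0)) q q′)
    (cong (72 +_) (trans (+-assoc x 4 0) (+-comm x 4))))
  (round p (round p′ none))

roundEnv : ℕ → Env
roundEnv i = (λ _ → 0) [ 0 ↦ i ]

tokenRun : ℕ → ℕ → State → State
tokenRun k i = run (token k) (roundEnv i)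

tokenCost : ℕ → ℕ → State → ℕ
tokenCost k i = cost (token k) (roundEnv i)

argumentEnv : ℕ → ℕ → Env
argumentEnv i a = roundEnv i [ 1 ↦ a ]

afterCode afterRead : State → State
afterCode s = state (arr s [ reg · rPH ↦ 1 ] [ reg · rCD ↦ hd (inp s) ]) (tl (inp s)) (out s)
afterRead s = let s₁ = afterCode s in
  state (arr s₁ [ reg · rPH ↦ 0 ] [ reg · rLB ↦ hd (inp s₁) ]) (tl (inp s₁)) (out s₁)

processEnv : ℕ → State → Env
processEnv i s = argumentEnv (suc i) (hd (tl (inp s)))

read-tokens : ∀ k i s → arr s reg rPH ≡ 0 →
  Trace (tokenRun k) (tokenCost k) i s 2 (run (process k) (processEnv i s) (afterRead s))
    (76 + cost (process k) (processEnv i s) (afterRead s))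
read-tokens k i s ph =
  two-rounds (tokenRun k) (tokenCost k) i s (afterCode s) (run (process k) (processEnv i s) (afterRead s))
    (cost (process k) (processEnv i s) (afterRead s)) run₁ cost₁ run₂ cost₂
  where
  body : Cmd
  body = readArgument ⨟ bind 1 (get-reg rLB) (process k)
  run₁ : tokenRun k i s ≡ afterCode s
  run₁ = run-when-0 {token k} {get-reg rPH} {body} {readCode} {roundEnv i} {s} refl ph
  cost₁ : tokenCost k i s ≡ 29
  cost₁ = cost-when-0 {token k} {get-reg rPH} {body} {readCode} {roundEnv i} {s} refl ph
  run₂ : tokenRun k (suc i) (afterCode s) ≡ run (process k) (processEnv i s) (afterRead s)
  run₂ = trans {j = run body (roundEnv (suc i)) (afterCode s)}
    (run-when-1 {token k} {get-reg rPH} {body} {readCode} {roundEnv (suc i)} {afterCode s} refl (λ ()))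
    (run-⨟-bind {body} {readArgument} {1} {get-reg rLB} {process k} {roundEnv (suc i)} {processEnv i s} {afterCode s} {afterRead s}
      refl refl refl)
  cost₂ : tokenCost k (suc i) (afterCode s) ≡ 39 + cost (process k) (processEnv i s) (afterRead s)
  cost₂ = trans {j = 11 + cost body (roundEnv (suc i)) (afterCode s)}
    (cost-when-1 {token k} {get-reg rPH} {body} {readCode} {roundEnv (suc i)} {afterCode s} refl (λ ()))
    (cong (11 +_) (cost-⨟-bind {body} {readArgument} {1} {get-reg rLB} {process k} {roundEnv (suc i)} {processEnv i s}
      {afterCode s} {afterRead s} refl refl refl))

-- Leaves and groups of parts on the stack

module _ {n : ℕ} (G : BipartiteGraph n) where
  open BipartiteGraph G

  record Stored (s : State) : Set where
    field
      adj-≡ : ∀ u v → arr s adj (toℕ u * n + toℕ v) ≡ indicator (N u) v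
      blk-≡ : ∀ v → arr s blk (toℕ v) ≡ indicator B v
      row-≡ : ∀ (v : Fin n) → arr s row (toℕ v) ≡ toℕ v * n
      pow-≡ : ∀ (v : Fin n) → arr s pow (toℕ v) ≡ 2 ^ (n ∸ suc (toℕ v))
      n-≡   : arr s reg rN ≡ n
      big-≡ : arr s reg rBIG ≡ 2 ^ n
  open Stored public

  record Ready (s : State) : Set where
    field
      phase    : arr s reg rPH ≡ 0
      stored   : Stored s
      spare-≡  : Spare G s
      unit-≡   : arr s heap 0 ≡ 0
      positive : 0 < arr s reg rFP
      quiet    : out s ≡ []
  open Ready public

  stored-ground : ∀ {s s′} → Ground s s′ → Stored s → Stored s′
  stored-ground g S = record
    { adj-≡ = λ u v → trans (graph-kept g adj _ tt) (adj-≡ S u v)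
    ; blk-≡ = λ v → trans (graph-kept g blk _ tt) (blk-≡ S v)
    ; row-≡ = λ v → trans (graph-kept g row _ tt) (row-≡ S v)
    ; pow-≡ = λ v → trans (graph-kept g pow _ tt) (pow-≡ S v)
    ; n-≡   = trans (reg-kept g rN tt) (n-≡ S)
    ; big-≡ = trans (reg-kept g rBIG tt) (big-≡ S) }

  ready-grown : ∀ {d s s′} → Ground s s′ → Grown G d s s′ → Spare G s′ → Ready s → Ready s′
  ready-grown g h f r = record
    { phase    = trans (reg-kept g rPH tt) (phase r)
    ; stored   = stored-ground g (stored r)
    ; spare-≡  = f
    ; unit-≡   = trans (heap-kept h (positive r)) (unit-≡ r)
    ; positive = <-≤-trans (positive r) (fp-grown h)
    ; quiet    = trans (out-kept g) (quiet r) }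

  Items : State → List (Subset n) → Set
  Items s []       = T true
  Items s (S ∷ st) = Item G s (arr s reg rFP) (length st) S × Items s st

  record Stack (s : State) (st : List (Subset n)) : Set where
    field
      height : arr s reg rSP ≡ length st
      stacked : Items s st
  open Stack public

  items-grown : ∀ {d s s′} st → length st ≤ d → Grown G d s s′ → Items s st → Items s′ st
  items-grown []       l g _        = tt
  items-grown (S ∷ st) l g (i , is) = item-grown G g l i , items-grown st (<⇒≤ l) g is

  record Advanced (st : List (Subset n)) (d : ℕ) (s s′ : State) : Set where
    field
      ready′ : Ready s′
      stack′ : Stack s′ st
      grown′ : Grown G d s s′
      inp-≡  : inp s′ ≡ inp s
  open Advanced public

  push-advanced : ∀ {S} st {s s′} → Ready s → Ground s s′ → Items s st → Pushed G S (length st) s s′ →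
    Advanced (S ∷ st) (length st) s s′
  push-advanced st r g is p = record
    { ready′ = ready-grown g (grown p) (spare-room p) r
    ; stack′ = record { height = sp-≡ p ; stacked = top-item p , items-grown st ≤-refl (grown p) is }
    ; grown′ = grown p
    ; inp-≡  = inp-kept g }

  weight-black : ∀ {u} → u ∈ₛ B → weight G u ≡ 2 ^ (n ∸ suc (toℕ u))
  weight-black {u} ub = cong (λ i → i * 2 ^ n + 2 ^ (n ∸ suc (toℕ u))) (indicator-∉ (λ uw → x∈∁p⇒x∉p uw ub))

  weight-white : ∀ {u} → u ∉ B → weight G u ≡ 2 ^ n + 2 ^ (n ∸ suc (toℕ u))
  weight-white {u} uw = cong (_+ 2 ^ (n ∸ suc (toℕ u)))
    (trans (cong (_* 2 ^ n) (indicator-∈ (x∉p⇒x∈∁p uw))) (+-identityʳ (2 ^ n)))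

  total-of-none : ∀ {C} → (∀ {v} → v ∉ C) → total G C ≡ 0
  total-of-none {C} nobody with total G C ℕ.≟ 0
  ... | yes e = e
  ... | no ne = let v , v∈ , _ = weigh-positive (weight G) C ne in ⊥-elim (nobody v∈)

  candidate-∅ : ∀ S q → Candidate G S q 0 0
  candidate-∅ S q = record
    { set = ∅ ; inside-S = ⊥-elim ∘ ∉⊥ ; clique = λ u∈ → ⊥-elim (∉⊥ u∈) ; only-black = λ _ → ⊥-elim ∘ ∉⊥
    ; blacks-≡ = weigh-∅ (indicator B) ; total-≡ = weigh-∅ (weight G) }

  blacks-⁅⁆ : ∀ u → blacks G ⁅ u ⁆ ≡ indicator B u
  blacks-⁅⁆ = weigh-⁅⁆ (indicator B)

  singleton-≤ : ∀ {u q b x} → (k : Candidate G ⁅ u ⁆ q b x) → x ≤ weight G u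
  singleton-≤ {u} k = subst₂ _≤_ (total-≡ k) (weigh-⁅⁆ (weight G) u) (weigh-mono (weight G) (set k) ⁅ u ⁆ (inside-S k))

  optimal-black : ∀ {H p u q} → u ∈ₛ B → H p ≡ 0 → H (p + 1) ≡ weight G u → Optimal H p 1 (Candidate G ⁅ u ⁆ q)
  optimal-black {H} {p} {u} {q} ub e₀ e₁ = record { sound = sound′ ; complete = complete′ }
    where
    sound′ : ∀ {b} → b ≤ 1 → Candidate G ⁅ u ⁆ q b (H (p + b))
    sound′ {zero} _ = subst (Candidate G ⁅ u ⁆ q 0) (sym (trans (cong H (+-identityʳ p)) e₀)) (candidate-∅ ⁅ u ⁆ q)
    sound′ {suc zero} _ = record
      { set = ⁅ u ⁆ ; inside-S = id ; clique = λ _ _ v∈ vw → ⊥-elim (vw (black v∈)) ; only-black = λ _ → black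
      ; blacks-≡ = trans (blacks-⁅⁆ u) (indicator-∈ ub) ; total-≡ = trans (weigh-⁅⁆ (weight G) u) (sym e₁) }
      where
      black : ⁅ u ⁆ ⊆ B
      black v∈ = subst (_∈ₛ B) (sym (x∈⁅y⁆⇒x≡y u v∈)) ub
    sound′ {suc (suc b)} (s≤s ())
    complete′ : ∀ {b x} → Candidate G ⁅ u ⁆ q b x → b ≤ 1 × x ≤ H (p + b)
    complete′ {zero}  k = z≤n , ≤-trans (≤-reflexive (trans (sym (total-≡ k)) (total-of-none λ v∈ →
      black-in G v∈ (subst (_∈ₛ B) (sym (x∈⁅y⁆⇒x≡y u (inside-S k v∈))) ub) (blacks-≡ k)))) z≤n
    complete′ {suc zero} k = ≤-refl , ≤-trans (singleton-≤ k) (≤-reflexive (sym e₁))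
    complete′ {suc (suc b)} k = ⊥-elim (case subst₂ _≤_ (blacks-≡ k) (trans (blacks-⁅⁆ u) (indicator-∈ ub))
      (weigh-mono (indicator B) (set k) ⁅ u ⁆ (inside-S k)) of λ { (s≤s ()) })

  white-blacks : ∀ {u q b x} → u ∉ B → Candidate G ⁅ u ⁆ q b x → b ≡ 0
  white-blacks {u} uw k = n≤0⇒n≡0 (subst₂ _≤_ (blacks-≡ k) (trans (blacks-⁅⁆ u) (indicator-∉ uw))
    (weigh-mono (indicator B) (set k) ⁅ u ⁆ (inside-S k)))

  optimal-white-0 : ∀ {H p u} → u ∉ B → H p ≡ 0 → Optimal H p 0 (Candidate G ⁅ u ⁆ 0)
  optimal-white-0 {H} {p} {u} uw e .sound z≤n =
    subst (Candidate G ⁅ u ⁆ 0 0) (sym (trans (cong H (+-identityʳ p)) e)) (candidate-∅ ⁅ u ⁆ 0)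
  optimal-white-0 {H} {p} {u} uw e .complete k with white-blacks uw k
  ... | refl = z≤n , ≤-trans (≤-reflexive (trans (sym (total-≡ k)) (total-of-none λ v∈ →
    uw (subst (_∈ₛ B) (x∈⁅y⁆⇒x≡y u (inside-S k v∈)) (only-black k refl v∈))))) z≤n

  optimal-white-1 : ∀ {H p u} → u ∉ B → H p ≡ weight G u → Optimal H p 0 (Candidate G ⁅ u ⁆ 1)
  optimal-white-1 {H} {p} {u} uw e .sound z≤n = record
    { set = ⁅ u ⁆ ; inside-S = id
    ; clique = λ v∈ vb → ⊥-elim (uw (subst (_∈ₛ B) (x∈⁅y⁆⇒x≡y u v∈) vb))
    ; only-black = λ () ; blacks-≡ = trans (blacks-⁅⁆ u) (indicator-∉ uw)
    ; total-≡ = trans (weigh-⁅⁆ (weight G) u) (sym (trans (cong H (+-identityʳ p)) e)) }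
  optimal-white-1 {H} {p} {u} uw e .complete k with white-blacks uw k
  ... | refl = z≤n , ≤-trans (singleton-≤ k) (≤-reflexive (sym (trans (cong H (+-identityʳ p)) e)))

  leaf-item : ∀ {u} s D d p → (D ≡ p + 3) →
    arr s len d ≡ indicator B u → arr s brep d ≡ toℕ u * n → arr s wrep d ≡ toℕ u →
    arr s ptr (d + d + 0) ≡ p → arr s ptr (d + d + 1) ≡ p + (2 ∸ (indicator B u + indicator B u)) →
    arr s heap p ≡ 0 → arr s heap (p + 1) ≡ 2 ^ (n ∸ suc (toℕ u)) →
    arr s heap (p + 2) ≡ 2 ^ n + 2 ^ (n ∸ suc (toℕ u)) → Item G s D d ⁅ u ⁆
  leaf-item {u} s D d p refl l b w p₀ p₁ h₀ h₁ h₂ = record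
    { len-≡     = trans l (sym (blacks-⁅⁆ u))
    ; room      = λ {q} → room′ q
    ; optimal   = λ {q} → optimal′ q
    ; black-rep = λ {v} v∈ vb → u , x∈⁅x⁆ u , subst (_∈ₛ B) (x∈⁅y⁆⇒x≡y u v∈) vb , b
    ; white-rep = λ {v} v∈ vw → u , x∈⁅x⁆ u , (λ ub → vw (subst (_∈ₛ B) (sym (x∈⁅y⁆⇒x≡y u v∈)) ub)) , w }
    where
    black-1 : u ∈ₛ B → blacks G ⁅ u ⁆ ≡ 1
    black-1 ub = trans (blacks-⁅⁆ u) (indicator-∈ ub)
    white-0 : u ∉ B → blacks G ⁅ u ⁆ ≡ 0
    white-0 uw = trans (blacks-⁅⁆ u) (indicator-∉ uw)
    pointer-black : u ∈ₛ B → arr s ptr (d + d + 1) ≡ p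
    pointer-black ub = trans p₁ (trans (cong (λ i → p + (2 ∸ (i + i))) (indicator-∈ ub)) (+-identityʳ p))
    pointer-white : u ∉ B → arr s ptr (d + d + 1) ≡ p + 2
    pointer-white uw = trans p₁ (cong (λ i → p + (2 ∸ (i + i))) (indicator-∉ uw))
    fit : ∀ {a l} → a ≡ p → l ≤ 1 → a + l < p + 3
    fit refl l≤ = +-monoʳ-< p (≤-trans (s≤s l≤) (≤ᵇ⇒≤ 2 3 tt))
    black-or-white : u ∈ₛ B ⊎ u ∉ B
    black-or-white with u ∈? B
    ... | yes ub = inj₁ ub
    ... | no uw  = inj₂ uw
    blacks-≤1 : blacks G ⁅ u ⁆ ≤ 1
    blacks-≤1 = [ ≤-reflexive ∘ black-1 , (λ uw → ≤-trans (≤-reflexive (white-0 uw)) z≤n) ]′ black-or-white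
    room′ : ∀ q → q < 2 → arr s ptr (d + d + q) + blacks G ⁅ u ⁆ < p + 3
    room′ 0 _ = fit p₀ blacks-≤1
    room′ 1 _ = [ (λ ub → fit (pointer-black ub) blacks-≤1) ,
      (λ uw → subst₂ (λ a l → a + l < p + 3) (sym (pointer-white uw)) (sym (white-0 uw))
        (subst (_< p + 3) (sym (+-identityʳ (p + 2))) (+-monoʳ-< p (≤ᵇ⇒≤ 3 3 tt)))) ]′ black-or-white
    room′ (suc (suc _)) (s≤s (s≤s ()))
    optimal′ : ∀ q → q < 2 → Optimal (arr s heap) (arr s ptr (d + d + q)) (blacks G ⁅ u ⁆) (Candidate G ⁅ u ⁆ q)
    optimal′ 0 _ = [
      (λ ub → subst₂ (λ a l → Optimal (arr s heap) a l (Candidate G ⁅ u ⁆ 0)) (sym p₀) (sym (black-1 ub))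
        (optimal-black ub h₀ (trans h₁ (sym (weight-black ub))))) ,
      (λ uw → subst₂ (λ a l → Optimal (arr s heap) a l (Candidate G ⁅ u ⁆ 0)) (sym p₀) (sym (white-0 uw))
        (optimal-white-0 uw h₀)) ]′ black-or-white
    optimal′ 1 _ = [
      (λ ub → subst₂ (λ a l → Optimal (arr s heap) a l (Candidate G ⁅ u ⁆ 1)) (sym (pointer-black ub)) (sym (black-1 ub))
        (optimal-black ub h₀ (trans h₁ (sym (weight-black ub))))) ,
      (λ uw → subst₂ (λ a l → Optimal (arr s heap) a l (Candidate G ⁅ u ⁆ 1)) (sym (pointer-white uw)) (sym (white-0 uw))
        (optimal-white-1 uw (trans h₂ (sym (weight-white uw))))) ]′ black-or-white
    optimal′ (suc (suc _)) (s≤s (s≤s ()))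

  pushLeaf-pushed : ∀ ρ s u → ρ 1 ≡ toℕ u → Ready s → Pushed G ⁅ u ⁆ (arr s reg rSP) s (run pushLeaf ρ s)
  pushLeaf-pushed ρ s u e r = record
    { sp-≡       = +-comm d 1
    ; top-item   = leaf-item s′ (p + 3) d p refl
        (trans (↦-same (arr s len) d) (trans (cong (arr s blk) e) (blk-≡ (stored r) u)))
        (trans (↦-same (arr s brep) d) (trans (cong (arr s row) e) (row-≡ (stored r) u)))
        (trans (↦-same (arr s wrep) d) e)
        (trans (cong (arr s′ ptr) (+-identityʳ (d + d))) (trans (↦-other (arr s ptr [ d + d ↦ p ]) (λ q → <-irrefl (sym q) (≤-reflexive (+-comm 1 (d + d)))))
          (↦-same (arr s ptr) (d + d))))
        (trans (↦-same (arr s ptr [ d + d ↦ p ]) (d + d + 1))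
          (cong (λ i → p + (2 ∸ (i + i))) (trans (cong (arr s blk) e) (blk-≡ (stored r) u))))
        (trans (above-heap p (λ q → <-irrefl (sym q) (p<p+ 0)) (λ q → <-irrefl (sym q) (p<p+ 1))) (spare-≡ r ≤-refl))
        (trans (↦-other (arr s heap [ p + 1 ↦ arr s pow (ρ 1) ]) (λ q → case +-cancelˡ-≡ p 2 1 q of λ ()))
          (trans (↦-same (arr s heap) (p + 1)) (trans (cong (arr s pow) e) (pow-≡ (stored r) u))))
        (trans (↦-same (arr s heap [ p + 1 ↦ arr s pow (ρ 1) ]) (p + 2))
          (cong₂ _+_ (big-≡ (stored r)) (trans (cong (arr s pow) e) (pow-≡ (stored r) u))))
    ; grown      = record
        { fp-grown  = m≤m+n p 3
        ; heap-kept = λ {a} a<p → above-heap a (λ q → <-irrefl (sym q) (<-trans a<p (p<p+ 0))) (λ q → <-irrefl (sym q) (<-trans a<p (p<p+ 1)))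
        ; len-kept  = λ j< → ↦-other (arr s len) (λ q → <-irrefl (sym q) j<)
        ; brep-kept = λ j< → ↦-other (arr s brep) (λ q → <-irrefl (sym q) j<)
        ; wrep-kept = λ j< → ↦-other (arr s wrep) (λ q → <-irrefl (sym q) j<)
        ; ptr-kept  = λ j< q< → trans
            (↦-other (arr s ptr [ d + d ↦ p ]) (λ e → <-irrefl (sym e) (<-≤-trans (double-< G j< q<) (m≤m+n _ 1))))
            (↦-other (arr s ptr) (λ e → <-irrefl (sym e) (double-< G j< q<))) }
    ; spare-room = λ {a} p+3≤a → trans
        (above-heap a (λ q → <-irrefl q (<-≤-trans (+-monoʳ-< p (≤ᵇ⇒≤ 2 3 tt)) p+3≤a)) (λ q → <-irrefl q (<-≤-trans (+-monoʳ-< p (≤ᵇ⇒≤ 3 3 tt)) p+3≤a)))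
        (spare-≡ r (≤-trans (m≤m+n p 3) p+3≤a)) }
    where
    d = arr s reg rSP
    p = arr s reg rFP
    s′ = run pushLeaf ρ s
    p<p+ : ∀ k → p < p + suc k
    p<p+ k = ≤-trans (s≤s (m≤m+n p k)) (≤-reflexive (sym (+-suc p k)))
    above-heap : ∀ a → p + 1 ≢ a → p + 2 ≢ a → arr s′ heap a ≡ arr s heap a
    above-heap a x y = trans (↦-other (arr s heap [ p + 1 ↦ arr s pow (ρ 1) ]) y) (↦-other (arr s heap) x)

  pushLeaf-ground : ∀ ρ s → Ground s (run pushLeaf ρ s)
  pushLeaf-ground ρ s = record
    { graph-kept = λ a k p → frame pushLeaf a k (table a k p) ρ s
    ; reg-kept   = λ r p → frame pushLeaf reg r (table′ r p) ρ s
    ; inp-kept   = refl ; out-kept = refl }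
    where
    table : ∀ a k → T (graph-array a) → mayWrite pushLeaf a k ≡ false
    table 2 k p = refl
    table 3 k p = refl
    table 4 k p = refl
    table 5 k p = refl
    table (suc (suc (suc (suc (suc (suc a)))))) k ()
    table′ : ∀ r → T (persistent r) → mayWrite pushLeaf reg r ≡ false
    table′ rPH p = refl
    table′ rCD p = refl
    table′ rN p = refl
    table′ rBIG p = refl

  -- `edges` reads the adjacency of two representatives, and uniformity transfers it to any other
  -- black and white vertex of the two parts, in both directions.
  linked-parts : ∀ {s m d D V} → Stored s → (∀ {i j} → i < m → j < m → j ≢ i → Uniform G (V j) (V i)) →
    (∀ {i} → i < m → Item G s D (d + i) (V i)) → Linked G V m (edges s d)
  linked-parts {s} {m} {d} {V = V} S uni its = record
    { link = λ i< j< j≢i e u∈ ub v∈ vw →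
        let u′ , u′∈ , u′b , e₁ = black-rep (its j<) u∈ ub
            v′ , v′∈ , v′w , e₂ = white-rep (its i<) v∈ vw
        in uni i< j< j≢i u′∈ u′b u∈ ub v′∈ v′w v∈ vw
             (indicator⇒∈ (λ z → e (trans (cong (arr s adj) (cong₂ _+_ e₁ e₂)) (trans (adj-≡ S u′ v′) z))))
    ; no-link = λ i< j< j≢i e u∈ ub v∈ vw adjacent →
        let u′ , u′∈ , u′b , e₁ = black-rep (its j<) u∈ ub
            v′ , v′∈ , v′w , e₂ = white-rep (its i<) v∈ vw
        in case trans (sym (indicator-∈ (uni i< j< j≢i u∈ ub u′∈ u′b v∈ vw v′∈ v′w adjacent)))
             (trans (sym (adj-≡ S u′ v′)) (trans (cong (arr s adj) (sym (cong₂ _+_ e₁ e₂))) e)) of λ () }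

  -- The parts are pushed in order, so the last one is on top of the stack; counted from the bottom
  -- they are in order again.
  items-reversed : ∀ {s} Vs st → Items s (Vs ʳ++ st) →
    Items s st × (∀ {i} → i < length Vs → Item G s (arr s reg rFP) (length st + i) (nth ∅ Vs i))
  items-reversed []       st is = is , λ ()
  items-reversed {s} (V ∷ Vs) st is with items-reversed Vs (V ∷ st) is
  ... | (i , is′) , f = is′ , λ
    { {zero}  _        → subst (λ d → Item G s (arr s reg rFP) d V) (sym (+-identityʳ (length st))) i
    ; {suc j} (s≤s j<) → subst (λ d → Item G s (arr s reg rFP) d (nth ∅ Vs j)) (sym (+-suc (length st) j)) (f j<) }

  union-⋃ : ∀ Vs → union G (nth ∅ Vs) (length Vs) ≡ ⋃ Vs
  union-⋃ Vs = ⊆-antisym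
    (λ v∈ → let i , i< , v∈i = ∈-union⁻ G (nth ∅ Vs) (length Vs) v∈ in ∈-⋃⁺ Vs i< v∈i)
    (λ v∈ → let i , i< , v∈i = ∈-⋃⁻ Vs v∈ in ∈-union⁺ G (nth ∅ Vs) i< v∈i)

  order : ∀ i j → i ≢ j → i < j ⊎ j < i
  order i j i≢j = [ (λ p → inj₁ (≤∧≢⇒< p i≢j)) , (λ p → inj₂ (≤∧≢⇒< p (i≢j ∘ sym))) ]′ (ℕ.≤-total i j)

  pairwise-disjoint : ∀ {Vs} → AllPairs Disjoint Vs → PairwiseDisjoint G (nth ∅ Vs) (length Vs)
  pairwise-disjoint {Vs} ds {i} {j} {v} i< j< v∈i v∈j with i ℕ.≟ j
  ... | yes e = e
  ... | no ne = [
    (λ i<j → ⊥-elim (nth-pairs {z = ∅} ds i<j j< (v , x∈p∩q⁺ (v∈i , v∈j)))) ,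
    (λ j<i → ⊥-elim (nth-pairs {z = ∅} ds j<i i< (v , x∈p∩q⁺ (v∈j , v∈i)))) ]′ (order i j ne)

  pairwise-uniform : ∀ {Vs} → AllPairs (Biuniform G) Vs → ∀ {i j} → i < length Vs → j < length Vs → j ≢ i →
    Uniform G (nth ∅ Vs j) (nth ∅ Vs i)
  pairwise-uniform {Vs} us {i} {j} i< j< j≢i = [
    (λ j<i → proj₁ (nth-pairs {z = ∅} us j<i i<)) ,
    (λ i<j → proj₂ (nth-pairs {z = ∅} us i<j j<)) ]′ (order j i j≢i)

  blacks≤card : ∀ S → blacks G S ≤ card S
  blacks≤card []          = z≤n
  blacks≤card S = ≤-trans (≤-reflexive (weigh-indicator B S)) (≤-trans (p⊆q⇒∣p∣≤∣q∣ (p∩q⊆p S B)) (≤-reflexive (sym (weigh-1 S))))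

  -- Black vertices are counted by cardinalities here because a part may have none of them, whereas
  -- `sizes-measure` relies on positive sizes.
  parts-measure : ∀ {Vs} → 2 ≤ length Vs → All Nonempty Vs → AllPairs Disjoint Vs →
    MeasureOf G (nth ∅ Vs) (length Vs) (4 * pairs (map card Vs))
  parts-measure {Vs} l ne ds = subst (λ m → MeasureOf G (nth ∅ Vs) m (4 * pairs xs)) (length-map card Vs)
    (sizes-measure {xs} (subst (2 ≤_) (sym (length-map card Vs)) l) (cards-positive ne)
      (λ {i} i≤ → ≤-trans (blacks≤card (union G (nth ∅ Vs) i)) (≤-reflexive (card-union i (subst (i ≤_) (length-map card Vs) i≤))))
      (λ {i} i< → ≤-trans (blacks≤card (nth ∅ Vs i)) (≤-reflexive (sym (nth-map card Vs (subst (i <_) (length-map card Vs) i<))))))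
    where
    xs = map card Vs
    card-union : ∀ i → i ≤ length Vs → card (union G (nth ∅ Vs) i) ≡ prefix-sum xs i
    card-union zero    _  = weigh-∅ {n} (λ _ → 1)
    card-union (suc i) i< = trans (disjoint-sum G (λ _ → 1) (pairwise-disjoint ds) i< id id)
      (cong₂ _+_ (card-union i (<⇒≤ i<)) (sym (nth-map card Vs i<)))

  combine-top : ∀ {K} ρ s Vs st → ρ 3 ≡ length Vs → length Vs ≤ K → 2 ≤ length Vs → All Nonempty Vs →
    AllPairs Disjoint Vs → AllPairs (Biuniform G) Vs → Ready s → Stack s (Vs ʳ++ st) →
    Advanced (⋃ Vs ∷ st) (length st) s (run (combine K) ρ s) ×
    cost (combine K) ρ s ≤ combineCost K * (4 * pairs (map card Vs))
  combine-top {K} ρ s Vs st m≡ m≤K 2≤ ne ds us r k =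
    push-advanced st r (combine-ground K ρ s) (proj₁ its)
      (subst₂ (λ S d → Pushed G S d s (run (combine K) ρ s)) union-≡ d≡ (proj₁ combined)) ,
    proj₂ combined
    where
    its : Items s st × (∀ {i} → i < length Vs → Item G s (arr s reg rFP) (length st + i) (nth ∅ Vs i))
    its = items-reversed Vs st (stacked k)
    d≡ : arr s reg rSP ∸ ρ 3 ≡ length st
    d≡ = trans (cong₂ _∸_ (trans (height k) (length-ʳ++ Vs)) m≡) (m+n∸m≡n (length Vs) (length st))
    union-≡ : union G (nth ∅ Vs) (ρ 3) ≡ ⋃ Vs
    union-≡ = trans (cong (union G (nth ∅ Vs)) m≡) (union-⋃ Vs)
    its′ : ∀ {i} → i < length Vs → Item G s (arr s reg rFP) (arr s reg rSP ∸ ρ 3 + i) (nth ∅ Vs i)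
    its′ {i} i< = subst (λ d → Item G s (arr s reg rFP) (d + i) (nth ∅ Vs i)) (sym d≡) (proj₂ its i<)
    parts : Parts G s (length Vs) (arr s reg rSP ∸ ρ 3) (arr s reg rFP) (nth ∅ Vs)
    parts = record
      { items = its′ ; linked = linked-parts (stored r) (pairwise-uniform us) its′
      ; disjoint = pairwise-disjoint ds ; unit = unit-≡ r ; positive = Ready.positive r }
    combined : Pushed G (union G (nth ∅ Vs) (ρ 3)) (arr s reg rSP ∸ ρ 3) s (run (combine K) ρ s) ×
      cost (combine K) ρ s ≤ combineCost K * (4 * pairs (map card Vs))
    combined = combine-correct G ρ (nth ∅ Vs) s (subst (_≤ K) (sym m≡) m≤K)
      (subst (λ m → MeasureOf G (nth ∅ Vs) m (4 * pairs (map card Vs))) (sym m≡) (parts-measure 2≤ ne ds))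
      (subst (λ m → Parts G s m (arr s reg rSP ∸ ρ 3) (arr s reg rFP) (nth ∅ Vs)) (sym m≡) parts) (spare-≡ r)

-- Processing one node of the tree

run-loop : ∀ {c x e c₁ ρ s m} → c ≡ loop x e c₁ → eval e ρ (arr s) ≡ m →
  run c ρ s ≡ iter m (λ i → run c₁ (ρ [ x ↦ i ])) s
run-loop refl refl = refl

cost-loop : ∀ {c x e c₁ ρ s m} → c ≡ loop x e c₁ → eval e ρ (arr s) ≡ m →
  cost c ρ s ≡ costE e + 6 + iterCost m (λ i → cost c₁ (ρ [ x ↦ i ])) (λ i → run c₁ (ρ [ x ↦ i ])) s
cost-loop refl refl = refl

run-once : ∀ {c x e c₁ ρ ρ′ s} → c ≡ loop x e c₁ → eval e ρ (arr s) ≡ 1 → ρ′ ≡ ρ [ x ↦ 0 ] → run c ρ s ≡ run c₁ ρ′ s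
run-once refl p refl rewrite p = refl

cost-once : ∀ {c x e c₁ ρ ρ′ s} → c ≡ loop x e c₁ → eval e ρ (arr s) ≡ 1 → ρ′ ≡ ρ [ x ↦ 0 ] →
  cost c ρ s ≡ costE e + 6 + (cost c₁ ρ′ s + 4)
cost-once refl p refl rewrite p = refl

run-bind : ∀ {c x e c₁ ρ ρ′ s} → c ≡ bind x e c₁ → ρ′ ≡ ρ [ x ↦ eval e ρ (arr s) ] → run c ρ s ≡ run c₁ ρ′ s
run-bind refl refl = refl

cost-bind : ∀ {c x e c₁ ρ ρ′ s} → c ≡ bind x e c₁ → ρ′ ≡ ρ [ x ↦ eval e ρ (arr s) ] →
  cost c ρ s ≡ costE e + 2 + cost c₁ ρ′ s
cost-bind refl refl = refl

primeArities-bounded : ∀ {n} (T : Tree n) {k} → bimodularwidth T ≤ k → All (_≤ k) (primeArities T)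
primeArities-bounded T le with primeArities T
... | []     = []
... | a ∷ as = proj₁ (bounds as le) ∷ proj₂ (bounds as le)
  where
  open import Data.List using (foldr)
  open import Data.Nat using (_⊔_)
  bounds : ∀ {a k} as → foldr _⊔_ a as ≤ k → a ≤ k × All (_≤ k) as
  bounds []       p = p , []
  bounds (b ∷ as) p with bounds as (≤-trans (m≤n⊔m b _) p)
  ... | q , qs = q , ≤-trans (m≤m⊔n b _) p ∷ qs

-- 500 covers the 376 steps of a leaf as well as the fixed part 76 + 41 of an inner node.
treeCost : ℕ → ℕ
treeCost K = 500 + 4 * combineCost K

module _ {n : ℕ} (G : BipartiteGraph n) where
  open BipartiteGraph G

  advanced-trans : ∀ {st st′ d e s s′ s″} → d ≤ e → Advanced G st e s s′ → Advanced G st′ d s′ s″ → Advanced G st′ d s s″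
  advanced-trans d≤e p q = record
    { ready′ = ready′ q ; stack′ = stack′ q
    ; grown′ = grown-trans G ≤-refl (grown-weaken d≤e (grown′ p)) (grown′ q)
    ; inp-≡  = trans (inp-≡ q) (inp-≡ p) }
    where
    grown-weaken : ∀ {d e s s′} → d ≤ e → Grown G e s s′ → Grown G d s s′
    grown-weaken {d} {e} {s} {s′} d≤e g = grown-trans G d≤e (grown-refl G {d} {s}) g

  pairs-two : ∀ a b → pairs (a ∷ b ∷ []) ≡ a * b
  pairs-two a b = solve 2 (λ a b → a :* (b :+ con 0) :+ (b :* con 0 :+ con 0) := a :* b) refl a b
    where open +-*-Solver

  Merges : (ℕ → State → State) → (ℕ → State → ℕ) → ℕ → Set
  Merges f g c = ∀ i s V U st → Nonempty V → Nonempty U → Disjoint V U → Biuniform G V U → Ready G s →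
    Stack G s (U ∷ V ∷ st) → Advanced G (V ∪ U ∷ st) (length st) s (f i s) × g i s ≤ c * (card V * card U)

  nonempty-⋃ : ∀ {V : Subset n} {Vs} → Nonempty V → Nonempty (⋃ (V ∷ Vs))
  nonempty-⋃ (v , v∈) = v , x∈p∪q⁺ (inj₁ v∈)

  -- The earlier rounds merge `V′ ∷ Vs` on top of V, by induction with V as part of the stack below;
  -- the last round merges V with their union. The products of cardinalities are at least 1 and so
  -- also pay for the overhead of the rounds.
  merge-all : ∀ {R f g c} → Tame G R → Merges f g c → ∀ V Vs st s → AllPairs R (V ∷ Vs) → AllPairs Disjoint (V ∷ Vs) →
    All Nonempty (V ∷ Vs) → Ready G s → Stack G s ((V ∷ Vs) ʳ++ st) →
    Advanced G (⋃ (V ∷ Vs) ∷ st) (length st) s (iter (length Vs) f s) ×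
    iterCost (length Vs) g f s ≤ (c + 4) * pairs (map card (V ∷ Vs))
  merge-all t mg V [] st s _ _ _ r k = record
    { ready′ = r ; stack′ = subst (λ V → Stack G s (V ∷ st)) (sym (∪-identityʳ V)) k ; grown′ = grown-refl G ; inp-≡ = refl } , z≤n
  merge-all {f = f} {g} {c} t mg V (V′ ∷ Vs) st s (p ∷ ps) (d ∷ ds) (ne ∷ nes) r k
    with merge-all {f = f} {g} {c} t mg V′ Vs (V ∷ st) s ps ds nes r k
  ... | A , c₁ with mg (length Vs) (iter (length Vs) f s) V (⋃ (V′ ∷ Vs)) st ne (nonempty-⋃ {V′} {Vs} (All.head nes))
                     (disjoint-⋃ d) (tame-uniform t (tame-⋃ t p)) (ready′ A) (stack′ A)
  ... | A′ , c₂ = advanced-trans (n≤1+n _) A A′ , (begin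
    C + (g (length Vs) (iter (length Vs) f s) + 4)  ≤⟨ +-mono-≤ c₁ (+-monoˡ-≤ 4 c₂) ⟩
    (c + 4) * P + (c * (a * b) + 4)                 ≤⟨ +-monoʳ-≤ ((c + 4) * P) (+-monoʳ-≤ (c * (a * b)) (*-monoʳ-≤ 4 1≤ab)) ⟩
    (c + 4) * P + (c * (a * b) + 4 * (a * b))       ≡⟨ solve 3 (λ c P x → (c :+ con 4) :* P :+ (c :* x :+ con 4 :* x) := (c :+ con 4) :* (x :+ P)) refl c P (a * b) ⟩
    (c + 4) * (a * b + P)                           ≡⟨ cong (λ b → (c + 4) * (a * b + P)) (card-⋃ ds) ⟩
    (c + 4) * pairs (map card (V ∷ V′ ∷ Vs))        ∎)
    where
    open ≤-Reasoning
    open +-*-Solver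
    C = iterCost (length Vs) g f s
    P = pairs (map card (V′ ∷ Vs))
    a = card V
    b = card (⋃ (V′ ∷ Vs))
    1≤ab : 1 ≤ a * b
    1≤ab = *-mono-≤ (card-positive ne) (card-positive (nonempty-⋃ {V′} {Vs} (All.head nes)))

  merges : ∀ {K} ρ → 2 ≤ K → Merges (λ i → run (bind 3 (lit 2) (combine K)) (ρ [ 2 ↦ i ]))
    (λ i → cost (bind 3 (lit 2) (combine K)) (ρ [ 2 ↦ i ])) (3 + 4 * combineCost K)
  merges {K} ρ 2≤K i s V U st neV neU d u r k =
    subst₂ (λ s′ X → Advanced G (X ∷ st) (length st) s s′)
      (sym (run-bind {bind 3 (lit 2) (combine K)} {3} {lit 2} {combine K} {ρ [ 2 ↦ i ]} {ρ′} {s} refl refl))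
      (cong (V ∪_) (∪-identityʳ U)) (proj₁ top) ,
    subst (_≤ (3 + 4 * combineCost K) * (card V * card U))
      (sym (cost-bind {bind 3 (lit 2) (combine K)} {3} {lit 2} {combine K} {ρ [ 2 ↦ i ]} {ρ′} {s} refl refl))
      (bound-3 (cost (combine K) ρ′ s) (proj₂ top))
    where
    ρ′ : Env
    ρ′ = ρ [ 2 ↦ i ] [ 3 ↦ 2 ]
    top : Advanced G (⋃ (V ∷ U ∷ []) ∷ st) (length st) s (run (combine K) ρ′ s) ×
      cost (combine K) ρ′ s ≤ combineCost K * (4 * pairs (map card (V ∷ U ∷ [])))
    top = combine-top G {K} ρ′ s (V ∷ U ∷ []) st refl 2≤K ≤-refl (neV ∷ neU ∷ []) ((d ∷ []) ∷ [] ∷ []) ((u ∷ []) ∷ [] ∷ []) r k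
    ab : ℕ
    ab = card V * card U
    bound-3 : ∀ x → x ≤ combineCost K * (4 * pairs (map card (V ∷ U ∷ []))) → 3 + x ≤ (3 + 4 * combineCost K) * ab
    bound-3 x le = begin
      3 + x                             ≤⟨ +-monoʳ-≤ 3 le ⟩
      3 * 1 + combineCost K * (4 * pairs (card V ∷ card U ∷ []))
        ≡⟨ cong (λ p → 3 * 1 + combineCost K * (4 * p)) (pairs-two (card V) (card U)) ⟩
      3 * 1 + combineCost K * (4 * ab)  ≤⟨ +-monoˡ-≤ _ (*-monoʳ-≤ 3 (*-mono-≤ (card-positive neV) (card-positive neU))) ⟩
      3 * ab + combineCost K * (4 * ab) ≡⟨ solve 2 (λ c x → con 3 :* x :+ c :* (con 4 :* x) := (con 3 :+ con 4 :* c) :* x) refl (combineCost K) ab ⟩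
      (3 + 4 * combineCost K) * ab      ∎
      where
      open ≤-Reasoning
      open +-*-Solver

  grown-afterRead : ∀ {d} s → Grown G d s (afterRead s)
  grown-afterRead s = record { fp-grown = ≤-refl ; heap-kept = λ _ → refl ; len-kept = λ _ → refl
    ; brep-kept = λ _ → refl ; wrep-kept = λ _ → refl ; ptr-kept = λ _ _ → refl }

  ready-afterRead : ∀ s → Ready G s → Ready G (afterRead s)
  ready-afterRead s r = record
    { phase = refl
    ; stored = record { adj-≡ = adj-≡ S ; blk-≡ = blk-≡ S ; row-≡ = row-≡ S ; pow-≡ = pow-≡ S ; n-≡ = n-≡ S ; big-≡ = big-≡ S }
    ; spare-≡ = spare-≡ r ; unit-≡ = unit-≡ r ; positive = Ready.positive r ; quiet = quiet r }
    where S = stored r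

  stack-afterRead : ∀ s st → Stack G s st → Stack G (afterRead s) st
  stack-afterRead s st k = record { height = height k ; stacked = items-grown G {length st} st ≤-refl (grown-afterRead s) (stacked k) }

  process-leaf : ∀ K ρ s u st → arr s reg rCD ≡ 0 → ρ 1 ≡ toℕ u → Ready G s → Stack G s st →
    Advanced G (⁅ u ⁆ ∷ st) (length st) s (run (process K) ρ s) × cost (process K) ρ s ≤ 300
  process-leaf K ρ s u st z e r k =
    subst (Advanced G (⁅ u ⁆ ∷ st) (length st) s) (sym (run-when-0 {process K} {get-reg rCD} {inner} {pushLeaf} {ρ} {s} refl z))
      (push-advanced G st r (pushLeaf-ground G ρ s) (stacked k)
        (subst (λ d → Pushed G ⁅ u ⁆ d s (run pushLeaf ρ s)) (height k) (pushLeaf-pushed G ρ s u e r))) ,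
    subst (_≤ 300) (sym (cost-when-0 {process K} {get-reg rCD} {inner} {pushLeaf} {ρ} {s} refl z)) (≤ᵇ⇒≤ _ 300 tt)
    where
    inner : Cmd
    inner = when (get-reg rCD ⊟ lit 3) (combineAll K) (combinePairs K)

  process-prime : ∀ K ρ s Vs st → arr s reg rCD ≡ 4 → ρ 1 ≡ length Vs → length Vs ≤ K → 2 ≤ length Vs → All Nonempty Vs →
    AllPairs Disjoint Vs → AllPairs (Biuniform G) Vs → Ready G s → Stack G s (Vs ʳ++ st) →
    Advanced G (⋃ Vs ∷ st) (length st) s (run (process K) ρ s) ×
    cost (process K) ρ s ≤ 39 + combineCost K * (4 * pairs (map card Vs))
  process-prime K ρ s Vs st e₄ e m≤K 2≤ ne ds us r k =
    subst (Advanced G (⋃ Vs ∷ st) (length st) s) (sym run-≡) (proj₁ top) ,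
    subst (_≤ 39 + combineCost K * (4 * pairs (map card Vs))) (sym cost-≡)
      (+-monoʳ-≤ 35 (≤-trans (+-monoˡ-≤ 4 (proj₂ top)) (≤-reflexive (+-comm _ 4))))
    where
    inner body : Cmd
    inner = when (get-reg rCD ⊟ lit 3) (combineAll K) (combinePairs K)
    body = bind 3 (var 1) (combine K)
    ρ₂ ρ₃ : Env
    ρ₂ = ρ [ 2 ↦ 0 ]
    ρ₃ = ρ₂ [ 3 ↦ ρ 1 ]
    top : Advanced G (⋃ Vs ∷ st) (length st) s (run (combine K) ρ₃ s) ×
      cost (combine K) ρ₃ s ≤ combineCost K * (4 * pairs (map card Vs))
    top = combine-top G {K} ρ₃ s Vs st e m≤K 2≤ ne ds us r k
    nz : arr s reg rCD ≢ 0
    nz p = case trans (sym e₄) p of λ ()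
    nz′ : arr s reg rCD ∸ 3 ≢ 0
    nz′ p = case trans (sym (cong (_∸ 3) e₄)) p of λ ()
    run-≡ : run (process K) ρ s ≡ run (combine K) ρ₃ s
    run-≡ = trans {j = run inner ρ s} (run-when-1 {process K} {get-reg rCD} {inner} {pushLeaf} {ρ} {s} refl nz)
      (trans {j = run (combineAll K) ρ s} (run-when-1 {inner} {get-reg rCD ⊟ lit 3} {combineAll K} {combinePairs K} {ρ} {s} refl nz′)
      (trans {j = run body ρ₂ s} (run-once {combineAll K} {2} {lit 1} {body} {ρ} {ρ₂} {s} refl refl refl)
        (run-bind {body} {3} {var 1} {combine K} {ρ₂} {ρ₃} {s} refl refl)))
    cost-≡ : cost (process K) ρ s ≡ 35 + (cost (combine K) ρ₃ s + 4)
    cost-≡ = trans {j = 11 + cost inner ρ s} (cost-when-1 {process K} {get-reg rCD} {inner} {pushLeaf} {ρ} {s} refl nz)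
      (cong (11 +_) (trans {j = 13 + cost (combineAll K) ρ s} (cost-when-1 {inner} {get-reg rCD ⊟ lit 3} {combineAll K} {combinePairs K} {ρ} {s} refl nz′)
      (cong (13 +_) (trans {j = 7 + (cost body ρ₂ s + 4)} (cost-once {combineAll K} {2} {lit 1} {body} {ρ} {ρ₂} {s} refl refl refl)
        (cong (λ x → 7 + (x + 4)) (cost-bind {body} {3} {var 1} {combine K} {ρ₂} {ρ₃} {s} refl refl))))))

  process-pairs : ∀ {R} K ρ s V Vs st → arr s reg rCD ≢ 0 → arr s reg rCD ∸ 3 ≡ 0 → ρ 1 ≡ length (V ∷ Vs) → 2 ≤ K → Tame G R →
    AllPairs R (V ∷ Vs) → All Nonempty (V ∷ Vs) → AllPairs Disjoint (V ∷ Vs) → Ready G s → Stack G s ((V ∷ Vs) ʳ++ st) →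
    Advanced G (⋃ (V ∷ Vs) ∷ st) (length st) s (run (process K) ρ s) ×
    cost (process K) ρ s ≤ 34 + (3 + 4 * combineCost K + 4) * pairs (map card (V ∷ Vs))
  process-pairs {R} K ρ s V Vs st nz z e 2≤K t rs ne ds r k =
    subst (Advanced G (⋃ (V ∷ Vs) ∷ st) (length st) s) (sym run-≡) (proj₁ merged) ,
    subst (_≤ 34 + (3 + 4 * combineCost K + 4) * pairs (map card (V ∷ Vs))) (sym cost-≡) (+-monoʳ-≤ 34 (proj₂ merged))
    where
    inner body : Cmd
    inner = when (get-reg rCD ⊟ lit 3) (combineAll K) (combinePairs K)
    body = bind 3 (lit 2) (combine K)
    f : ℕ → State → State
    f = λ i → run body (ρ [ 2 ↦ i ])
    g : ℕ → State → ℕ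
    g = λ i → cost body (ρ [ 2 ↦ i ])
    merged : Advanced G (⋃ (V ∷ Vs) ∷ st) (length st) s (iter (length Vs) f s) ×
      iterCost (length Vs) g f s ≤ (3 + 4 * combineCost K + 4) * pairs (map card (V ∷ Vs))
    merged = merge-all {R} {f} {g} {3 + 4 * combineCost K} t (merges {K} ρ 2≤K) V Vs st s rs ds ne r k
    run-≡ : run (process K) ρ s ≡ iter (length Vs) f s
    run-≡ = trans {j = run inner ρ s} (run-when-1 {process K} {get-reg rCD} {inner} {pushLeaf} {ρ} {s} refl nz)
      (trans {j = run (combinePairs K) ρ s} (run-when-0 {inner} {get-reg rCD ⊟ lit 3} {combineAll K} {combinePairs K} {ρ} {s} refl z)
        (run-loop {combinePairs K} {2} {var 1 ⊟ lit 1} {body} {ρ} {s} refl (cong (_∸ 1) e)))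
    cost-≡ : cost (process K) ρ s ≡ 34 + iterCost (length Vs) g f s
    cost-≡ = trans {j = 11 + cost inner ρ s} (cost-when-1 {process K} {get-reg rCD} {inner} {pushLeaf} {ρ} {s} refl nz)
      (cong (11 +_) (trans {j = 13 + cost (combinePairs K) ρ s} (cost-when-0 {inner} {get-reg rCD ⊟ lit 3} {combineAll K} {combinePairs K} {ρ} {s} refl z)
        (cong (13 +_) (cost-loop {combinePairs K} {2} {var 1 ⊟ lit 1} {body} {ρ} {s} refl (cong (_∸ 1) e)))))

-- Parsing the postfix form of the tree

module _ {n : ℕ} (G : BipartiteGraph n) where
  open BipartiteGraph G

  record ParsedBy (f : ℕ → State → State) (g : ℕ → State → ℕ) (i : ℕ) (s : State) (m : ℕ) (st : List (Subset n)) (d : ℕ) (rest : List ℕ) (C : ℕ) : Set where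
    constructor parsed
    field
      end      : State
      spent    : ℕ
      trace    : Trace f g i s m end spent
      ready-end : Ready G end
      stack-end : Stack G end st
      grown-end : Grown G d s end
      inp-end  : inp end ≡ rest
      spent-≤  : spent ≤ C
  open ParsedBy public

  Parsed : (K i : ℕ) (s : State) (m : ℕ) (st : List (Subset n)) (d : ℕ) (rest : List ℕ) (C : ℕ) → Set
  Parsed K = ParsedBy (tokenRun K) (tokenCost K)

  Processes : (K : ℕ) (st st′ : List (Subset n)) (d code a : ℕ) (rest : List ℕ) (C : ℕ) → Set
  Processes K st st′ d code a rest C = (j : ℕ) (s : State) → Ready G s → Stack G s st → inp s ≡ code ∷ a ∷ rest →
    Advanced G st′ d (afterRead s) (run (process K) (processEnv j s) (afterRead s)) ×
    cost (process K) (processEnv j s) (afterRead s) ≤ C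

  parse-node : ∀ {K i : ℕ} {s : State} {m : ℕ} {st st′ : List (Subset n)} {d code a : ℕ} {rest : List ℕ} {C C′ : ℕ} →
    Parsed K i s m st d (code ∷ a ∷ rest) C → Processes K st st′ d code a rest C′ →
    Parsed K i s (m + 2) st′ d rest (C + (76 + C′))
  parse-node {K} {i} {s} {m} {st} {st′} {d} {code} {a} {rest} {C} {C′} (parsed s₁ c t r k g e c≤) f =
    finish (run (process K) (processEnv (m + i) s₁) (afterRead s₁)) (cost (process K) (processEnv (m + i) s₁) (afterRead s₁))
      (read-tokens K (m + i) s₁ (phase r)) (f (m + i) s₁ r k e)
    where
    finish : ∀ s₃ x → Trace (tokenRun K) (tokenCost K) (m + i) s₁ 2 s₃ (76 + x) →
      Advanced G st′ d (afterRead s₁) s₃ × x ≤ C′ → Parsed K i s (m + 2) st′ d rest (C + (76 + C′))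
    finish s₃ x t′ (A , x≤) = parsed s₃ (c + (76 + x)) (trace-++ t t′) (ready′ A) (stack′ A)
      (grown-trans G ≤-refl g (grown-trans G ≤-refl (grown-afterRead G s₁) (grown′ A)))
      (trans (inp-≡ A) (cong (tl ∘ tl) e)) (+-mono-≤ c≤ (+-monoʳ-≤ 76 x≤))

  -- The subtrees spend κ times the squares, and the node at most κ times twice the mixed products,
  -- which by `square-sum` add up to κ times the square of the whole. The weaker bound `pairs` times
  -- κ would do for the node; doubling it fits the identity.
  node-bound : ∀ K {Vs : List (Subset n)} {S : Subset n} {C C′ : ℕ} → 2 ≤ length Vs → All Nonempty Vs → AllPairs Disjoint Vs → ⋃ Vs ≡ S →
    C ≤ treeCost K * squares (map card Vs) → C′ ≤ (41 + 4 * combineCost K) * pairs (map card Vs) →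
    C + (76 + C′) ≤ treeCost K * card S ^ 2
  node-bound K {Vs} {S} {C} {C′} l ne ds refl p q = begin
    C + (76 + C′)                       ≤⟨ +-mono-≤ p (+-monoʳ-≤ 76 q) ⟩
    κ * Q + (76 + (41 + c) * P)         ≤⟨ +-monoʳ-≤ (κ * Q) (+-monoˡ-≤ _ (*-monoʳ-≤ 76 (1≤pairs l′ (cards-positive ne)))) ⟩
    κ * Q + (76 * P + (41 + c) * P)     ≡⟨ cong (κ * Q +_) (sym (*-distribʳ-+ P 76 (41 + c))) ⟩
    κ * Q + (76 + (41 + c)) * P         ≤⟨ +-monoʳ-≤ (κ * Q) (*-mono-≤ (+-monoˡ-≤ c (≤ᵇ⇒≤ 117 500 tt)) (m≤m+n P (P + 0))) ⟩
    κ * Q + κ * (2 * P)                 ≡⟨ *-distribˡ-+ κ Q (2 * P) ⟨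
    κ * (Q + 2 * P)                     ≡⟨ cong (κ *_) (square-sum (map card Vs)) ⟨
    κ * sum (map card Vs) ^ 2           ≡⟨ cong (λ x → κ * x ^ 2) (card-⋃ ds) ⟨
    κ * card (⋃ Vs) ^ 2                 ∎
    where
    open ≤-Reasoning
    κ = treeCost K
    c = 4 * combineCost K
    Q = squares (map card Vs)
    P = pairs (map card Vs)
    l′ : 2 ≤ length (map card Vs)
    l′ = subst (2 ≤_) (sym (length-map card Vs)) l

  parsed-≤ : ∀ {K i s m st d rest C C′} → C ≤ C′ → Parsed K i s m st d rest C → Parsed K i s m st d rest C′
  parsed-≤ le (parsed a b c d e f g h) = parsed a b c d e f g (≤-trans h le)

  node-input : ∀ ℓ (Ts : List (Tree n)) rest →
    postfix (node ℓ Ts) ++ rest ≡ postfixForest Ts ++ (labelCode ℓ ∷ length Ts ∷ rest)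
  node-input ℓ Ts rest = ++-assoc (postfixForest Ts) (labelCode ℓ ∷ length Ts ∷ []) rest

  node-length : ∀ ℓ (Ts : List (Tree n)) → length (postfix (node ℓ Ts)) ≡ length (postfixForest Ts) + 2
  node-length ℓ Ts = length-++ (postfixForest Ts)

  process-pairs-input : ∀ {R} K ℓ V Vs st {a rest} → labelCode ℓ ≢ 0 → labelCode ℓ ∸ 3 ≡ 0 → length (V ∷ Vs) ≡ a → 2 ≤ K →
    Tame G R → AllPairs R (V ∷ Vs) → All Nonempty (V ∷ Vs) → AllPairs Disjoint (V ∷ Vs) →
    Processes K ((V ∷ Vs) ʳ++ st) (⋃ (V ∷ Vs) ∷ st) (length st) (labelCode ℓ) a rest
      (34 + (3 + 4 * combineCost K + 4) * pairs (map card (V ∷ Vs)))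
  process-pairs-input K ℓ V Vs st nz z l 2≤K t rs ne ds j s r k e =
    process-pairs G K (processEnv j s) (afterRead s) V Vs st
      (nz ∘ trans (sym (cong hd e))) (trans (cong (λ xs → hd xs ∸ 3) e) z)
      (trans (cong (hd ∘ tl) e) (sym l)) 2≤K t rs ne ds (ready-afterRead G s r) (stack-afterRead G s ((V ∷ Vs) ʳ++ st) k)

  process-prime-input : ∀ K Vs st {a rest} → length Vs ≡ a → a ≤ K → 2 ≤ length Vs → All Nonempty Vs →
    AllPairs Disjoint Vs → AllPairs (Biuniform G) Vs →
    Processes K (Vs ʳ++ st) (⋃ Vs ∷ st) (length st) 4 a rest (39 + combineCost K * (4 * pairs (map card Vs)))
  process-prime-input K Vs st l a≤K 2≤ ne ds us j s r k e =
    process-prime G K (processEnv j s) (afterRead s) Vs st (cong hd e) (trans (cong (hd ∘ tl) e) (sym l))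
      (≤-trans (≤-reflexive l) a≤K) 2≤ ne ds us (ready-afterRead G s r) (stack-afterRead G s (Vs ʳ++ st) k)

  process-leaf-input : ∀ K v st {rest} → Processes K st (⁅ v ⁆ ∷ st) (length st) 0 (toℕ v) rest 300
  process-leaf-input K v st j s r k e =
    process-leaf G K (processEnv j s) (afterRead s) v st (cong hd e) (cong (hd ∘ tl) e)
      (ready-afterRead G s r) (stack-afterRead G s st k)

  parsed-length : ∀ {K i s m m′ st d rest C} → m ≡ m′ → Parsed K i s m st d rest C → Parsed K i s m′ st d rest C
  parsed-length refl p = p

  parse-append : ∀ {K i s m m′ st₁ st₂ d rest₁ rest C₁ C₂} → Parsed K i s m st₁ d rest₁ C₁ →
    (∀ s₁ → Ready G s₁ → Stack G s₁ st₁ → inp s₁ ≡ rest₁ → Parsed K (m + i) s₁ m′ st₂ (suc d) rest C₂) →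
    Parsed K i s (m + m′) st₂ d rest (C₁ + C₂)
  parse-append {K} {d = d} (parsed s₁ c₁ t₁ r₁ k₁ g₁ e₁ b₁) f = finish (f s₁ r₁ k₁ e₁)
    where
    finish : ∀ {m′ st₂ rest C₂} → Parsed K _ s₁ m′ st₂ (suc d) rest C₂ → Parsed K _ _ (_ + m′) st₂ d rest (_ + C₂)
    finish (parsed s₂ c₂ t₂ r₂ k₂ g₂ e₂ b₂) = parsed s₂ (c₁ + c₂) (trace-++ t₁ t₂) r₂ k₂
      (grown-trans G ≤-refl g₁ (grown-trans G (n≤1+n d) (grown-refl G {d} {s₁}) g₂)) e₂ (+-mono-≤ b₁ b₂)

  pairs-positive : ∀ {Vs : List (Subset n)} → 2 ≤ length Vs → All Nonempty Vs → 1 ≤ pairs (map card Vs)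
  pairs-positive {Vs} l ne = 1≤pairs (subst (2 ≤_) (sym (length-map card Vs)) l) (cards-positive ne)

  pairs-bound : ∀ c P → 1 ≤ P → 34 + (3 + 4 * c + 4) * P ≤ (41 + 4 * c) * P
  pairs-bound c P 1≤P = begin
    34 + (3 + 4 * c + 4) * P     ≤⟨ +-monoˡ-≤ _ (*-monoʳ-≤ 34 1≤P) ⟩
    34 * P + (3 + 4 * c + 4) * P ≡⟨ solve 2 (λ c P → con 34 :* P :+ (con 3 :+ con 4 :* c :+ con 4) :* P := (con 41 :+ con 4 :* c) :* P) refl c P ⟩
    (41 + 4 * c) * P             ∎
    where
    open ≤-Reasoning
    open +-*-Solver

  prime-bound : ∀ c P → 1 ≤ P → 39 + c * (4 * P) ≤ (41 + 4 * c) * P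
  prime-bound c P 1≤P = begin
    39 + c * (4 * P)     ≤⟨ +-monoˡ-≤ _ (*-mono-≤ (≤ᵇ⇒≤ 39 41 tt) 1≤P) ⟩
    41 * P + c * (4 * P) ≡⟨ solve 2 (λ c P → con 41 :* P :+ c :* (con 4 :* P) := (con 41 :+ con 4 :* c) :* P) refl c P ⟩
    (41 + 4 * c) * P     ∎
    where
    open ≤-Reasoning
    open +-*-Solver

  parse-inner : ∀ {K i s ℓ} {Vs : List (Subset n)} {Ts : List (Tree n)} {st rest C} → 2 ≤ length Vs → All Nonempty Vs → AllPairs Disjoint Vs →
    C ≤ (41 + 4 * combineCost K) * pairs (map card Vs) →
    Parsed K i s (length (postfixForest Ts)) (Vs ʳ++ st) (length st) (labelCode ℓ ∷ length Ts ∷ rest) (treeCost K * squares (map card Vs)) →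
    Processes K (Vs ʳ++ st) (⋃ Vs ∷ st) (length st) (labelCode ℓ) (length Ts) rest C →
    Parsed K i s (length (postfix (node ℓ Ts))) (⋃ Vs ∷ st) (length st) rest (treeCost K * card (⋃ Vs) ^ 2)
  parse-inner {K} {ℓ = ℓ} {Vs} {Ts} 2≤ ne ds c≤ p q =
    parsed-length {K} (sym (node-length ℓ Ts)) (parsed-≤ {K} (node-bound K {Vs} 2≤ ne ds refl ≤-refl c≤) (parse-node {K} p q))

  -- The round number, the items below and the remaining input are arbitrary, since a subtree is met
  -- in the middle of the main loop, on top of its finished siblings.
  parse-tree : ∀ {S T} K → 2 ≤ K → CanonicalOn G S T → All (_≤ K) (primeArities T) → ∀ i s st rest →
    Ready G s → Stack G s st → inp s ≡ postfix T ++ rest →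
    Parsed K i s (length (postfix T)) (S ∷ st) (length st) rest (treeCost K * card S ^ 2)
  parse-forest : ∀ {Vs Ts} K → 2 ≤ K → Pointwise (CanonicalOn G) Vs Ts → All (_≤ K) (primeAritiesForest Ts) → ∀ i s st rest →
    Ready G s → Stack G s st → inp s ≡ postfixForest Ts ++ rest →
    Parsed K i s (length (postfixForest Ts)) (Vs ʳ++ st) (length st) rest (treeCost K * squares (map card Vs))
  parse-pairs : ∀ {R S V Vs Ts} K ℓ → 2 ≤ K → Tame G R → Splits R S (V ∷ Vs) → labelCode ℓ ≢ 0 → labelCode ℓ ∸ 3 ≡ 0 →
    Pointwise (CanonicalOn G) (V ∷ Vs) Ts → All (_≤ K) (primeAritiesForest Ts) → ∀ i s st rest →
    Ready G s → Stack G s st → inp s ≡ postfix (node ℓ Ts) ++ rest →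
    Parsed K i s (length (postfix (node ℓ Ts))) (S ∷ st) (length st) rest (treeCost K * card S ^ 2)

  parse-prime : ∀ {S Vs Ts} K → 2 ≤ K → PrimeDecomposition G S Vs → Partition S Vs →
    Pointwise (CanonicalOn G) Vs Ts → length Ts ≤ K → All (_≤ K) (primeAritiesForest Ts) → ∀ i s st rest →
    Ready G s → Stack G s st → inp s ≡ postfix (node prime Ts) ++ rest →
    Parsed K i s (length (postfix (node prime Ts))) (S ∷ st) (length st) rest (treeCost K * card S ^ 2)

  parse-pairs {R} {V = V} {Vs} {Ts} K ℓ 2≤K t ((ne , ds , refl) , 2≤ , rs) nz z pw ar i s st rest r k e =
    parse-inner {K} {ℓ = ℓ} {V ∷ Vs} {Ts} 2≤ ne ds (pairs-bound (combineCost K) (pairs (map card (V ∷ Vs))) (pairs-positive {V ∷ Vs} 2≤ ne))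
      (parse-forest K 2≤K pw ar i s st (labelCode ℓ ∷ length Ts ∷ rest) r k (trans e (node-input ℓ Ts rest)))
      (process-pairs-input {R} K ℓ V Vs st nz z (Pointwise-length pw) 2≤K t rs ne ds)

  parse-prime {Vs = Vs} {Ts} K 2≤K dec (ne , ds , refl) pw a≤K ar i s st rest r k e =
    parse-inner {K} {ℓ = prime} {Vs} {Ts} 2≤ ne ds (prime-bound (combineCost K) (pairs (map card Vs)) (pairs-positive {Vs} 2≤ ne))
      (parse-forest K 2≤K pw ar i s st (4 ∷ length Ts ∷ rest) r k (trans e (node-input prime Ts rest)))
      (process-prime-input K Vs st (Pointwise-length pw) a≤K 2≤ ne ds (prime-uniform G dec))
    where
    2≤ : 2 ≤ length Vs
    2≤ = prime-length G dec

  parse-tree K 2≤K (leaf v) ar i s st rest r k e =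
    parsed-≤ {K} (≤-trans (≤ᵇ⇒≤ 376 500 tt) (≤-trans (m≤m+n 500 (4 * combineCost K)) (≤-trans (≤-reflexive (sym (*-identityʳ _)))
      (*-monoʳ-≤ (treeCost K) (≤-reflexive (cong (_^ 2) (sym (weigh-⁅⁆ (λ _ → 1) v))))))))
    (parse-node {K} {C = 0} {300} (parsed s 0 none r k (grown-refl G) e z≤n) (process-leaf-input K v st))
  parse-tree K 2≤K (node {parallel} {Vs = []} (((_ , () , _) , _) , _) _) ar i s st rest r k e
  parse-tree K 2≤K (node {series} {Vs = []} (((_ , () , _) , _) , _) _) ar i s st rest r k e
  parse-tree K 2≤K (node {k+s} {Vs = []} ((_ , () , _) , _) _) ar i s st rest r k e
  parse-tree K 2≤K (node {parallel} {Vs = V ∷ Vs} ((sp , _) , _) pw) ar i s st rest r k e =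
    parse-pairs K parallel 2≤K (tame-nonadjacent G) sp (λ ()) refl pw ar i s st rest r k e
  parse-tree K 2≤K (node {series} {Vs = V ∷ Vs} ((sp , _) , _) pw) ar i s st rest r k e =
    parse-pairs K series 2≤K (tame-fully G) sp (λ ()) refl pw ar i s st rest r k e
  parse-tree K 2≤K (node {k+s} {Vs = V ∷ Vs} (sp , _) pw) ar i s st rest r k e =
    parse-pairs K k+s 2≤K (tame-left G) sp (λ ()) refl pw ar i s st rest r k e
  parse-tree K 2≤K (node {prime} dec pw) (a ∷ ar) i s st rest r k e =
    parse-prime K 2≤K dec (proj₁ (proj₂ (proj₂ (proj₂ (proj₂ dec))))) pw a ar i s st rest r k e

  parse-forest K 2≤K [] ar i s st rest r k e = parsed s 0 none r k (grown-refl G) e z≤n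
  parse-forest {V ∷ Vs} {T ∷ Ts} K 2≤K (p ∷ pw) ar i s st rest r k e =
    parsed-length {K} (sym (length-++ (postfix T)))
      (parsed-≤ {K} (≤-reflexive (sym (*-distribˡ-+ (treeCost K) (card V ^ 2) (squares (map card Vs)))))
        (parse-append {K}
          (parse-tree K 2≤K p (proj₁ (++⁻ (primeArities T) ar)) i s st (postfixForest Ts ++ rest) r k
            (trans e (++-assoc (postfix T) (postfixForest Ts) rest)))
          λ s₁ → parse-forest K 2≤K pw (proj₂ (++⁻ (primeArities T) ar)) (length (postfix T) + i) s₁ (V ∷ st) rest))

-- Reading the graph

seq-rule : ∀ c₁ c₂ ρ s {P Q : State → Set} {b₁ b₂} → P (run c₁ ρ s) × cost c₁ ρ s ≤ b₁ →
  (∀ s₁ → Preserved c₁ s s₁ → P s₁ → Q (run c₂ ρ s₁) × cost c₂ ρ s₁ ≤ b₂) →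
  Q (run (c₁ ⨟ c₂) ρ s) × cost (c₁ ⨟ c₂) ρ s ≤ b₁ + b₂
seq-rule c₁ c₂ ρ s (p , b) f =
  let q , b′ = f (run c₁ ρ s) (record { fixed = λ a k e → frame c₁ a k e ρ s ; keep = keeps-static c₁ ρ s }) p
  in q , +-mono-≤ b b′

drop-nth : ∀ (xs : List ℕ) {i} → i < length xs → drop i xs ≡ nth 0 xs i ∷ drop (suc i) xs
drop-nth (x ∷ xs) {zero}  _        = refl
drop-nth (x ∷ xs) {suc i} (s≤s i<) = drop-nth xs i<

drop-all : ∀ (xs : List ℕ) {k} → length xs ≡ k → drop k xs ≡ []
drop-all []       refl = refl
drop-all (x ∷ xs) refl = drop-all xs refl

-- The first k numbers of xs are stored in H, and the others are still to be read.
record Loaded (xs rest : List ℕ) (k : ℕ) (H : ℕ → ℕ) (is : List ℕ) : Set where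
  field
    content   : ∀ {j} → j < k → H j ≡ nth 0 xs j
    remaining : is ≡ drop k xs ++ rest
open Loaded public

loaded-step : ∀ {xs rest H is k k′} → k ≡ k′ → k < length xs → Loaded xs rest k H is →
  Loaded xs rest (suc k) (H [ k′ ↦ hd is ]) (tl is)
loaded-step {xs} {rest} {H} {is} {k} refl k< l = record { content = content′ ; remaining = cong tl is-≡ }
  where
  is-≡ : is ≡ nth 0 xs k ∷ drop (suc k) xs ++ rest
  is-≡ = trans (remaining l) (cong (_++ rest) (drop-nth xs k<))
  content′ : ∀ {j} → j < suc k → (H [ k ↦ hd is ]) j ≡ nth 0 xs j
  content′ {j} (s≤s j≤) with m≤n⇒m<n∨m≡n j≤
  ... | inj₂ refl = trans (↦-same H k) (cong hd is-≡)
  ... | inj₁ j<k  = trans (↦-other H (λ e → <-irrefl (sym e) j<k)) (content l j<k)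

loaded-finished : ∀ {xs rest k H is} → length xs ≡ k → Loaded xs rest k H is → is ≡ rest
loaded-finished {xs} {rest} l p = trans (remaining p) (cong (_++ rest) (drop-all xs l))

record Loading (a : ℕ) (xs rest : List ℕ) (k : ℕ) (s : State) : Set where
  constructor loading
  field
    loaded : Loaded xs rest k (arr s a) (inp s)
    no-out : out s ≡ []
open Loading public

loading-same : ∀ {a xs rest k k′ s s′} → k ≡ k′ → (∀ j → arr s′ a j ≡ arr s a j) → inp s′ ≡ inp s → out s′ ≡ out s →
  Loading a xs rest k s → Loading a xs rest k′ s′
loading-same refl h i o (loading l q) = loading
  (record { content = λ j< → trans (h _) (content l j<) ; remaining = trans i (remaining l) }) (trans o q)

readBlack-correct : ∀ {xs rest n} s → length xs ≡ n → arr s reg rN ≡ n → inp s ≡ xs ++ rest → out s ≡ [] →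
  Loading blk xs rest n (run readBlack (λ _ → 0) s) × cost readBlack (λ _ → 0) s ≤ 14 + n * 14
readBlack-correct {xs} {rest} {n} s l n≡ in≡ o≡ =
  loop-rule⁺ (Loading blk xs rest) 0 (get-reg rN) (get blk (var 0)) (λ _ → 0) s n 10 n≡
    (loading (record { content = λ () ; remaining = in≡ }) o≡)
    (λ i s′ i< p I → loading (loaded-step {H = arr s′ blk} refl (subst (i <_) (sym l) i<) (loaded I)) (no-out I) , ≤-refl)

record RowsRead (ys rest : List ℕ) (n u : ℕ) (s : State) : Set where
  field
    rows    : Loading adj ys rest (u * n) s
    offset  : arr s reg rACC ≡ u * n
    offsets : ∀ {v} → v < u → arr s row v ≡ v * n
open RowsRead public

readRow-correct : ∀ {ys rest n} u s → length ys ≡ n * n → u < n → arr s reg rN ≡ n → RowsRead ys rest n u s →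
  RowsRead ys rest n (suc u) (run readRow ((λ _ → 0) [ 0 ↦ u ]) s) × cost readRow ((λ _ → 0) [ 0 ↦ u ]) s ≤ 56 + n * 24
readRow-correct {ys} {rest} {n} u s l u<n n≡ R =
  ≤-bound (seq-rule (assign row (var 0) (get-reg rACC)) (c₂ ⨟ c₃) ρ s
    {λ s₁ → Loading adj ys rest (u * n) s₁ × arr s₁ reg rACC ≡ u * n × (∀ {v} → v < suc u → arr s₁ row v ≡ v * n)}
    {RowsRead ys rest n (suc u)} {17}
    ((loading-same refl (λ _ → refl) refl refl (rows R) , offset R , offsets′) , ≤-refl)
    λ s₁ p₁ (l₁ , a₁ , o₁) → seq-rule c₂ c₃ ρ s₁ {Loading adj ys rest (u * n + n)} {RowsRead ys rest n (suc u)}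
      (loop-rule⁺ (λ v → Loading adj ys rest (u * n + v)) 1 (get-reg rN) (get adj (row at var 0 ⊞ var 1)) ρ s₁ n 20
        (trans (fixed p₁ reg rN refl) n≡)
        (loading-same (sym (+-identityʳ (u * n))) (λ _ → refl) refl refl l₁)
        (λ v s′ v< p I → loading-suc v s′
           (cong (_+ v) (trans (fixed p row u refl) (o₁ ≤-refl))) v< I , ≤-refl))
      (λ s₂ p₂ l₂ → record
        { rows    = loading-same (+-comm (u * n) n) (λ _ → refl) refl refl l₂
        ; offset  = trans (cong₂ _+_ (trans (fixed p₂ reg rACC refl) a₁) (trans (fixed p₂ reg rN refl) (trans (fixed p₁ reg rN refl) n≡))) (+-comm (u * n) n)
        ; offsets = λ v< → trans (fixed p₂ row _ refl) (o₁ v<) } , ≤-refl))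
  where
  ρ = (λ _ → 0) [ 0 ↦ u ]
  c₂ c₃ : Cmd
  c₂ = loop 1 (get-reg rN) (get adj (row at var 0 ⊞ var 1))
  c₃ = set-reg rACC (get-reg rACC ⊞ get-reg rN)
  offsets′ : ∀ {v} → v < suc u → (arr s row [ u ↦ arr s reg rACC ]) v ≡ v * n
  offsets′ {v} (s≤s v≤) with m≤n⇒m<n∨m≡n v≤
  ... | inj₂ refl = trans (↦-same (arr s row) u) (offset R)
  ... | inj₁ v<u  = trans (↦-other (arr s row) (λ e → <-irrefl (sym e) v<u)) (offsets R v<u)
  in-range : ∀ {v} → v < n → u * n + v < length ys
  in-range {v} v<n = subst (u * n + v <_) (sym l) (<-≤-trans (+-monoʳ-< (u * n) v<n)
    (≤-trans (≤-reflexive (+-comm (u * n) n)) (*-monoˡ-≤ n u<n)))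
  loading-suc : ∀ v s′ → arr s′ row u + v ≡ u * n + v → v < n → Loading adj ys rest (u * n + v) s′ →
    Loading adj ys rest (u * n + suc v) (run (get adj (row at var 0 ⊞ var 1)) (ρ [ 1 ↦ v ]) s′)
  loading-suc v s′ e v< I = loading
    (subst (λ k → Loaded ys rest k (arr s′ adj [ arr s′ row u + v ↦ hd (inp s′) ]) (tl (inp s′))) (sym (+-suc (u * n) v))
      (loaded-step {H = arr s′ adj} (sym e) (in-range v<) (loaded I))) (no-out I)
  ≤-bound : ∀ {A : Set} {x} → A × x ≤ 17 + (14 + n * 24 + 25) → A × x ≤ 56 + n * 24
  ≤-bound (a , p) = a , ≤-trans p (≤-reflexive (solve 1 (λ n → con 17 :+ (con 14 :+ n :* con 24 :+ con 25) := con 56 :+ n :* con 24) refl n))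
    where open +-*-Solver

readRows-correct : ∀ {ys rest n} s → length ys ≡ n * n → arr s reg rN ≡ n → inp s ≡ ys ++ rest → out s ≡ [] →
  RowsRead ys rest n n (run readRows (λ _ → 0) s) × cost readRows (λ _ → 0) s ≤ 9 + (14 + n * (56 + n * 24 + 4))
readRows-correct {ys} {rest} {n} s l n≡ in≡ o≡ =
  seq-rule (set-reg rACC (lit 0)) (loop 0 (get-reg rN) readRow) (λ _ → 0) s {RowsRead ys rest n 0} {RowsRead ys rest n n}
    (record { rows = loading (record { content = λ () ; remaining = in≡ }) o≡ ; offset = refl ; offsets = λ () } , ≤-refl)
    λ s₁ p₁ R → loop-rule⁺ (RowsRead ys rest n) 0 (get-reg rN) readRow (λ _ → 0) s₁ n (56 + n * 24)
      (trans (fixed p₁ reg rN refl) n≡) R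
      (λ u s′ u< p R → readRow-correct u s′ l u< (trans (fixed p reg rN refl) (trans (fixed p₁ reg rN refl) n≡)) R)

record Powers (n i : ℕ) (s : State) : Set where
  field
    big-power : arr s reg rBIG ≡ 2 ^ i
    pow-power : ∀ {j} → j < i → arr s pow (n ∸ 1 ∸ j) ≡ 2 ^ j
open Powers public

powers-correct : ∀ {n} s → arr s reg rN ≡ n →
  Powers n n (run powers (λ _ → 0) s) × cost powers (λ _ → 0) s ≤ 9 + (14 + n * 57)
powers-correct {n} s n≡ =
  seq-rule (set-reg rBIG (lit 1)) (loop 0 (get-reg rN) body) (λ _ → 0) s {Powers n 0} {Powers n n}
    (record { big-power = refl ; pow-power = λ () } , ≤-refl)
    λ s₁ p₁ P → loop-rule⁺ (Powers n) 0 (get-reg rN) body (λ _ → 0) s₁ n 53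
      (trans (fixed p₁ reg rN refl) n≡) P
      (λ i s′ i< p P → powers-step i s′ i< (trans (fixed p reg rN refl) (trans (fixed p₁ reg rN refl) n≡)) P , ≤-refl)
  where
  body : Cmd
  body = assign pow (get-reg rN ⊟ lit 1 ⊟ var 0) (get-reg rBIG) ⨟ set-reg rBIG (get-reg rBIG ⊞ get-reg rBIG)
  -- The powers are stored backwards, so that the writes of two rounds miss each other only within
  -- the range where the truncated subtraction is injective.
  apart : ∀ {i j} → i < n → j < i → n ∸ 1 ∸ i ≢ n ∸ 1 ∸ j
  apart {i} {j} i<n j<i e = <-irrefl (sym (∸-cancelˡ-≡ (≤-pred′ i<n) (≤-pred′ (<-trans j<i i<n)) e)) j<i
    where
    ≤-pred′ : ∀ {i} → i < n → i ≤ n ∸ 1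
    ≤-pred′ (s≤s p) = p
  powers-step : ∀ i s′ → i < n → arr s′ reg rN ≡ n → Powers n i s′ → Powers n (suc i) (run body ((λ _ → 0) [ 0 ↦ i ]) s′)
  powers-step i s′ i<n e P = record
    { big-power = trans (cong₂ _+_ (big-power P) (big-power P)) (cong (2 ^ i +_) (sym (+-identityʳ (2 ^ i))))
    ; pow-power = λ j< → stored-power j< }
    where
    stored-power : ∀ {j} → j < suc i → (arr s′ pow [ arr s′ reg rN ∸ 1 ∸ i ↦ arr s′ reg rBIG ]) (n ∸ 1 ∸ j) ≡ 2 ^ j
    stored-power {j} (s≤s j≤) with m≤n⇒m<n∨m≡n j≤
    ... | inj₂ refl rewrite e = trans (↦-same (arr s′ pow) (n ∸ 1 ∸ i)) (big-power P)
    ... | inj₁ j<i rewrite e = trans (↦-other (arr s′ pow) (apart i<n j<i)) (pow-power P j<i)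

bitList : ∀ {n} → Subset n → List ℕ
bitList []      = []
bitList (b ∷ S) = (if b then 1 else 0) ∷ bitList S

-- The translation of bits inside `encodeSubset` is a local function without an accessible name;
-- `from-map` lets unification find it and only uses its two values.
encodeSubset-≡ : ∀ {n} (S : Subset n) → encodeSubset S ≡ bitList S
encodeSubset-≡ S = from-map refl refl refl
  where
  map-bits : ∀ (f : Bool → ℕ) → f true ≡ 1 → f false ≡ 0 → ∀ {n} (S : Subset n) → map f (toList S) ≡ bitList S
  map-bits f p q []          = refl
  map-bits f p q (true ∷ S)  = cong₂ _∷_ p (map-bits f p q S)
  map-bits f p q (false ∷ S) = cong₂ _∷_ q (map-bits f p q S)
  from-map : ∀ {f} → encodeSubset S ≡ map f (toList S) → f true ≡ 1 → f false ≡ 0 → encodeSubset S ≡ bitList S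
  from-map {f} e p q = trans e (map-bits f p q S)

length-bitList : ∀ {n} (S : Subset n) → length (bitList S) ≡ n
length-bitList []      = refl
length-bitList (b ∷ S) = cong suc (length-bitList S)

length-encodeSubset : ∀ {n} (S : Subset n) → length (encodeSubset S) ≡ n
length-encodeSubset S = trans (cong length (encodeSubset-≡ S)) (length-bitList S)

nth-bitList : ∀ {n} (S : Subset n) v → nth 0 (bitList S) (toℕ v) ≡ indicator S v
nth-bitList (b ∷ S) zero    = refl
nth-bitList (b ∷ S) (suc v) = nth-bitList S v

nth-encodeSubset : ∀ {n} (S : Subset n) v → nth 0 (encodeSubset S) (toℕ v) ≡ indicator S v
nth-encodeSubset S v = trans (cong (λ xs → nth 0 xs (toℕ v)) (encodeSubset-≡ S)) (nth-bitList S v)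

nth-++ : ∀ xs ys {i k} → length xs ≡ k → nth 0 (xs ++ ys) (k + i) ≡ nth 0 ys i
nth-++ []       ys refl = refl
nth-++ (x ∷ xs) ys refl = nth-++ xs ys refl

nth-++ˡ : ∀ xs ys {i} → i < length xs → nth 0 (xs ++ ys) i ≡ nth 0 xs i
nth-++ˡ (x ∷ xs) ys {zero}  _        = refl
nth-++ˡ (x ∷ xs) ys {suc i} (s≤s i<) = nth-++ˡ xs ys i<

module _ {n : ℕ} (f : Fin n → List ℕ) (l : ∀ v → length (f v) ≡ n) where

  length-rows : ∀ {m} (g : Fin m → Fin n) → length (concatMap f (tabulate g)) ≡ m * n
  length-rows {zero}  g = refl
  length-rows {suc m} g = trans (length-++ (f (g zero))) (cong₂ _+_ (l (g zero)) (length-rows (g ∘ suc)))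

  nth-rows : ∀ {m} (g : Fin m → Fin n) u {j} → j < n → nth 0 (concatMap f (tabulate g)) (toℕ u * n + j) ≡ nth 0 (f (g u)) j
  nth-rows {suc m} g zero    {j} j< = nth-++ˡ (f (g zero)) _ (subst (j <_) (sym (l (g zero))) j<)
  nth-rows {suc m} g (suc u) {j} j< =
    trans (cong (nth 0 (concatMap f (tabulate g))) (+-assoc n (toℕ u * n) j))
      (trans (nth-++ (f (g zero)) _ (l (g zero))) (nth-rows (g ∘ suc) u j<))

run-loop-env : ∀ {c x e c₁ ρ s m} (env : ℕ → Env) → c ≡ loop x e c₁ → (λ i → ρ [ x ↦ i ]) ≡ env → eval e ρ (arr s) ≡ m →
  run c ρ s ≡ iter m (λ i → run c₁ (env i)) s
run-loop-env env refl refl refl = refl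

cost-loop-env : ∀ {c x e c₁ ρ s m} (env : ℕ → Env) → c ≡ loop x e c₁ → (λ i → ρ [ x ↦ i ]) ≡ env → eval e ρ (arr s) ≡ m →
  cost c ρ s ≡ costE e + 6 + iterCost m (λ i → cost c₁ (env i)) (λ i → run c₁ (env i)) s
cost-loop-env env refl refl refl = refl

module _ {n : ℕ} (G : BipartiteGraph n) where
  open BipartiteGraph G

  rowBits : List ℕ
  rowBits = concatMap (λ v → encodeSubset (N v)) (allFin n)

  record GraphRead (rest : List ℕ) (s : State) : Set where
    field
      stored-g : Stored G s
      quiet-g  : out s ≡ []
      fp-g     : arr s reg rFP ≡ 1
      inp-g    : inp s ≡ rest
  open GraphRead public

  graph-read : ∀ {rest} s₁ s₂ s₃ → arr s₃ reg rN ≡ n →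
    Loading blk (encodeSubset B) (rowBits ++ rest) n s₁ → (∀ k → arr s₃ blk k ≡ arr s₁ blk k) →
    RowsRead rowBits rest n n s₂ → (∀ a k → (adj ≡ a ⊎ row ≡ a) → arr s₃ a k ≡ arr s₂ a k) → inp s₃ ≡ inp s₂ → out s₃ ≡ out s₂ →
    Powers n n s₃ → GraphRead rest (run (set-reg rFP (lit 1)) noVars s₃)
  graph-read {rest} s₁ s₂ s₃ n≡ L b≡ R r≡ i≡ o≡ P = record
    { stored-g = record
        { adj-≡ = λ u v → trans (r≡ adj _ (inj₁ refl)) (trans (content (loaded (rows R)) (cell< u v))
            (trans (nth-rows (λ v → encodeSubset (N v)) (λ v → length-encodeSubset (N v)) id u (toℕ<n v)) (nth-encodeSubset (N u) v)))
        ; blk-≡ = λ v → trans (b≡ _) (trans (content (loaded L) (toℕ<n v)) (nth-encodeSubset B v))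
        ; row-≡ = λ v → trans (r≡ row _ (inj₂ refl)) (offsets R (toℕ<n v))
        ; pow-≡ = λ v → trans (cong (arr s₃ pow) (sym (mirror (toℕ<n v)))) (pow-power P (∸-< (toℕ<n v)))
        ; n-≡   = n≡
        ; big-≡ = big-power P }
    ; quiet-g = trans o≡ (no-out (rows R))
    ; fp-g    = refl
    ; inp-g   = trans i≡ (loaded-finished (length-rows (λ v → encodeSubset (N v)) (λ v → length-encodeSubset (N v)) id) (loaded (rows R))) }
    where
    cell< : ∀ (u v : Fin n) → toℕ u * n + toℕ v < n * n
    cell< u v = <-≤-trans (+-monoʳ-< (toℕ u * n) (toℕ<n v)) (≤-trans (≤-reflexive (+-comm (toℕ u * n) n)) (*-monoˡ-≤ n (toℕ<n u)))
    mirror : ∀ {n v} → v < n → n ∸ 1 ∸ (n ∸ suc v) ≡ v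
    mirror {suc n} {v} (s≤s v≤) = m∸[m∸n]≡n v≤
    ∸-< : ∀ {n v} → v < n → n ∸ suc v < n
    ∸-< {suc n} {v} _ = s≤s (m∸n≤m n v)

  readGraph-correct : ∀ {rest} s → inp s ≡ encodeGraph G ++ rest → out s ≡ [] →
    GraphRead rest (run readGraph noVars s) × cost readGraph noVars s ≤ 78 + 131 * n + 24 * (n * n)
  readGraph-correct {rest} s in≡ o≡ = weaken
    (seq-rule (get reg (lit rN)) (readBlack ⨟ readRows ⨟ powers ⨟ set-reg rFP (lit 1)) noVars s
      {λ s → arr s reg rN ≡ n × inp s ≡ encodeSubset B ++ rowBits ++ rest × out s ≡ []} {GraphRead rest} {9}
      ((cong hd in≡ , trans (cong tl in≡) (++-assoc (encodeSubset B) rowBits rest) , o≡) , ≤-refl)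
      λ s₁ _ (n₁ , i₁ , o₁) → seq-rule readBlack (readRows ⨟ powers ⨟ set-reg rFP (lit 1)) noVars s₁
        {Loading blk (encodeSubset B) (rowBits ++ rest) n} {GraphRead rest} {14 + n * 14}
        (readBlack-correct s₁ (length-encodeSubset B) n₁ i₁ o₁)
        λ s₂ p₂ L → let n₂ = trans (fixed p₂ reg rN refl) n₁ in seq-rule readRows (powers ⨟ set-reg rFP (lit 1)) noVars s₂
          {λ s₃ → RowsRead rowBits rest n n s₃ × SameIO s₃ s₃} {GraphRead rest} {9 + (14 + n * (56 + n * 24 + 4))}
          (let R , c = readRows-correct s₂ rows-length n₂ (loaded-finished (length-encodeSubset B) (loaded L)) (no-out L)
           in (R , refl , refl) , c)
          λ s₃ p₃ (R , _) → seq-rule powers (set-reg rFP (lit 1)) noVars s₃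
            {λ s₄ → Powers n n s₄ × SameIO s₃ s₄} {GraphRead rest} {9 + (14 + n * 57)}
            (let P , c = powers-correct s₃ (trans (fixed p₃ reg rN refl) n₂)
             in (P , silent-io powers tt noVars s₃) , c)
            λ s₄ p₄ (P , i₄ , o₄) → graph-read s₂ s₃ s₄ (trans (fixed p₄ reg rN refl) (trans (fixed p₃ reg rN refl) n₂)) L
              (λ k → trans (fixed p₄ blk k refl) (fixed p₃ blk k refl)) R
              (λ { a k (inj₁ refl) → fixed p₄ adj k refl ; a k (inj₂ refl) → fixed p₄ row k refl }) i₄ o₄ P , ≤-refl)
    where
    rows-length : length rowBits ≡ n * n
    rows-length = length-rows (λ v → encodeSubset (N v)) (λ v → length-encodeSubset (N v)) id
    weaken : ∀ {A : Set} {x} → A × x ≤ 9 + (14 + n * 14 + (9 + (14 + n * (56 + n * 24 + 4)) + (9 + (14 + n * 57) + 9))) →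
      A × x ≤ 78 + 131 * n + 24 * (n * n)
    weaken (a , p) = a , ≤-trans p (≤-reflexive (solve 1 (λ n →
      con 9 :+ (con 14 :+ n :* con 14 :+ (con 9 :+ (con 14 :+ n :* (con 56 :+ n :* con 24 :+ con 4)) :+ (con 9 :+ (con 14 :+ n :* con 57) :+ con 9)))
        := con 78 :+ con 131 :* n :+ con 24 :* (n :* n)) refl n))
      where open +-*-Solver

  initial-ready : ∀ xs {rest} → xs ≡ encodeGraph G ++ rest → let s = run readGraph noVars (start xs) in
    Ready G s × Stack G s [] × inp s ≡ rest × cost readGraph noVars (start xs) ≤ 78 + 131 * n + 24 * (n * n)
  initial-ready xs e = build (readGraph-correct (start xs) e refl)
    (λ a → frame readGraph heap a refl noVars (start xs)) (frame readGraph reg rPH refl noVars (start xs))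
    (frame readGraph reg rSP refl noVars (start xs))
    where
    build : ∀ {s rest b x} → GraphRead rest s × x ≤ b → (∀ a → arr s heap a ≡ 0) → arr s reg rPH ≡ 0 → arr s reg rSP ≡ 0 →
      Ready G s × Stack G s [] × inp s ≡ rest × x ≤ b
    build (g , c) h p q = record
      { phase = p ; stored = stored-g g ; spare-≡ = λ _ → h _ ; unit-≡ = h 0
      ; positive = ≤-reflexive (sym (fp-g g)) ; quiet = quiet-g g } , record { height = q ; stacked = tt } , inp-g g , c

  record Prepared (rest : List ℕ) (s : State) : Set where
    field
      ready-p : Ready G s
      stack-p : Stack G s (⊤ ∷ [])
      inp-p   : inp s ≡ rest
  open Prepared public

  tree-prepared : ∀ {K m s s₃ S st d rest C} → 2 ≤ K → Parsed G K 0 s m (S ∷ st) d rest C → S ≡ ⊤ → st ≡ [] →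
    s₃ ≡ iter m (tokenRun K) s → Prepared rest s₃ × iterCost m (tokenCost K) (tokenRun K) s ≤ C
  tree-prepared {K} {m} {s} {C = C} 2≤K (parsed s′ c t r k g e b) refl refl refl = finish (trace-iter {tokenRun K} {tokenCost K} s refl t)
    where
    finish : s′ ≡ iter (m + 0) (tokenRun K) s × c ≡ iterCost (m + 0) (tokenCost K) (tokenRun K) s →
      Prepared _ (iter m (tokenRun K) s) × iterCost m (tokenCost K) (tokenRun K) s ≤ C
    finish (p , q) = subst (λ j → Prepared _ (iter j (tokenRun K) s) × iterCost j (tokenCost K) (tokenRun K) s ≤ C) (+-identityʳ m)
      (subst (Prepared _) p (record { ready-p = r ; stack-p = k ; inp-p = e }) , subst (_≤ C) q b)

  readTree-correct : ∀ K T {rest} s → 2 ≤ K → CanonicalTree G T → All (_≤ K) (primeArities T) → Ready G s → Stack G s [] →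
    inp s ≡ encodeTree T ++ rest →
    Prepared rest (run (readTree K) noVars s) × cost (readTree K) noVars s ≤ 23 + treeCost K * n ^ 2
  readTree-correct K T {rest} s 2≤K can ar r k e =
    seq-rule (get reg (lit rLB)) (loop 0 (get-reg rLB) (token K)) noVars s
      {λ s₁ → Ready G s₁ × Stack G s₁ [] × arr s₁ reg rLB ≡ length (postfix T) × inp s₁ ≡ postfix T ++ rest} {Prepared rest} {9}
      ((ready₁ , record { height = height k ; stacked = tt } , cong hd e , cong tl e) , ≤-refl)
      λ s₁ _ (r₁ , k₁ , l₁ , e₁) →
        let P , c = tree-prepared {K} {length (postfix T)} {s₁} {iter (length (postfix T)) (tokenRun K) s₁} 2≤K
                      (parse-tree G K 2≤K can ar 0 s₁ [] rest r₁ k₁ e₁) refl refl refl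
        in subst (Prepared rest) (sym (run-loop-env {loop 0 (get-reg rLB) (token K)} {0} {get-reg rLB} {token K} {noVars} {s₁} roundEnv refl refl l₁)) P ,
           subst (_≤ 14 + treeCost K * n ^ 2)
             (sym (cost-loop-env {loop 0 (get-reg rLB) (token K)} {0} {get-reg rLB} {token K} {noVars} {s₁} roundEnv refl refl l₁))
             (+-monoʳ-≤ 14 (≤-trans c (≤-reflexive (cong (λ x → treeCost K * x ^ 2) (trans (weigh-1 {n} ⊤) (∣⊤∣≡n n))))))
    where
    ready₁ : Ready G (run (get reg (lit rLB)) noVars s)
    ready₁ = record
      { phase = phase r
      ; stored = let S = stored r in record
          { adj-≡ = adj-≡ S ; blk-≡ = blk-≡ S ; row-≡ = row-≡ S ; pow-≡ = pow-≡ S ; n-≡ = n-≡ S ; big-≡ = big-≡ S }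
      ; spare-≡ = spare-≡ r ; unit-≡ = unit-≡ r ; positive = Ready.positive r ; quiet = quiet r }

-- Maxbisizes

quotient-≤ : ∀ {a b m m′ X} → m′ < X → a * X + m ≤ b * X + m′ → a ≤ b
quotient-≤ {zero}  m′< le = z≤n
quotient-≤ {suc a} {zero} {m} {m′} {X} m′< le =
  ⊥-elim (<-irrefl refl (<-≤-trans m′< (≤-trans (≤-trans (m≤m+n X (a * X)) (m≤m+n _ m)) le)))
quotient-≤ {suc a} {suc b} {m} {m′} {X} m′< le =
  s≤s (quotient-≤ m′< (+-cancelˡ-≤ X _ _ (subst₂ _≤_ (+-assoc X (a * X) m) (+-assoc X (b * X) m′) le)))

bitmask : ∀ {n} → Subset n → ℕ
bitmask {n} = weigh (λ v → 2 ^ (n ∸ suc (toℕ v)))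

bitmask-< : ∀ {n} (C : Subset n) → bitmask C < 2 ^ n
bitmask-< []              = s≤s z≤n
bitmask-< {suc n} (false ∷ C) = <-≤-trans (bitmask-< C) (m≤m+n (2 ^ n) _)
bitmask-< {suc n} (true ∷ C)  = subst (2 ^ n + bitmask C <_) (cong (2 ^ n +_) (sym (+-identityʳ (2 ^ n))))
  (+-monoʳ-< (2 ^ n) (bitmask-< C))

module _ {n : ℕ} (G : BipartiteGraph n) where
  open BipartiteGraph G

  whites : Subset n → ℕ
  whites = weigh (indicator W)

  total-split : ∀ C → total G C ≡ whites C * 2 ^ n + bitmask C
  total-split C = trans (weigh-+ (λ v → indicator W v * 2 ^ n) (λ v → 2 ^ (n ∸ suc (toℕ v))) C)
    (cong (_+ bitmask C) (weigh-* (indicator W) (2 ^ n) C))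

  size-≡ : ∀ C → size G C ≡ (blacks G C , whites C)
  size-≡ C = cong₂ _,_ (sym (weigh-indicator B C)) (sym (weigh-indicator W C))

  whites-≤ : ∀ C → whites C ≤ n
  whites-≤ C = ≤-trans (≤-reflexive (weigh-indicator W C)) (∣p∣≤n (C ∩ W))

  biclique⇒clique : ∀ {C} → Biclique G C → Clique G C
  biclique⇒clique b u∈ ub v∈ vw = b (x∈p∩q⁺ (u∈ , ub)) (x∈p∩q⁺ (v∈ , x∉p⇒x∈∁p vw))

  clique⇒biclique : ∀ {C} → Clique G C → Biclique G C
  clique⇒biclique {C} c u∈ v∈ = c (p∩q⊆p C B u∈) (p∩q⊆q C B u∈) (p∩q⊆p C W v∈) (x∈∁p⇒x∉p (p∩q⊆q C W v∈))

  clique-⊆ : ∀ {C D} → D ⊆ C → Clique G C → Clique G D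
  clique-⊆ s c u∈ ub v∈ vw = c (s u∈) ub (s v∈) vw

  -- Dropping black vertices from a biclique keeps it a biclique. This makes the best number of
  -- white vertices antitone in the number of black ones.
  fewer-blacks : ∀ C b → b ≤ blacks G C → ∃[ D ] D ⊆ C × blacks G D ≡ b × whites D ≡ whites C
  fewer-blacks C b b≤ with choose B C b b≤
  ... | E , E⊆C , E⊆B , e = E ∪ (C ∩ W) , shrinks , blacks-E , whites-E
    where
    apart : Empty (E ∩ (C ∩ W))
    apart (v , v∈) = x∈∁p⇒x∉p (p∩q⊆q C W (p∩q⊆q E (C ∩ W) v∈)) (E⊆B (p∩q⊆p E (C ∩ W) v∈))
    shrinks : E ∪ (C ∩ W) ⊆ C
    shrinks v∈ = [ E⊆C , p∩q⊆p C W ]′ (x∈p∪q⁻ E (C ∩ W) v∈)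
    vanishes : ∀ (w : Fin n → ℕ) D → (∀ {v} → v ∈ₛ D → w v ≡ 0) → weigh w D ≡ 0
    vanishes w D f with weigh w D ℕ.≟ 0
    ... | yes p = p
    ... | no p  = let v , v∈ , q = weigh-positive w D p in ⊥-elim (q (f v∈))
    blacks-E : blacks G (E ∪ (C ∩ W)) ≡ b
    blacks-E = trans (weigh-∪ (indicator B) E (C ∩ W) apart) (trans (cong₂ _+_ e
      (vanishes (indicator B) (C ∩ W) λ v∈ → indicator-∉ (x∈∁p⇒x∉p (p∩q⊆q C W v∈)))) (+-identityʳ b))
    whites-E : whites (E ∪ (C ∩ W)) ≡ whites C
    whites-E = trans (weigh-∪ (indicator W) E (C ∩ W) apart) (cong₂ _+_
      (vanishes (indicator W) E λ v∈ → indicator-∉ (λ vw → x∈∁p⇒x∉p vw (E⊆B v∈)))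
      (trans (weigh-indicator W (C ∩ W)) (trans (cong ∣_∣ (trans (∩-assoc C W W) (cong (C ∩_) (∩-idem W)))) (sym (weigh-indicator W C)))))

  module Profile {H : ℕ → ℕ} {p : ℕ} (o : Optimal H p (blacks G ⊤) (Candidate G ⊤ 1)) where

    β : ℕ
    β = blacks G ⊤

    -- Made total by the default ∅ beyond `β`, so that `w` and the listing are functions of plain
    -- numbers.
    best : ℕ → Subset n
    best b with b ≤? β
    ... | yes b≤ = set (sound o b≤)
    ... | no  _  = ∅

    record Best (b : ℕ) : Set where
      field
        best-clique : Clique G (best b)
        best-blacks : blacks G (best b) ≡ b
        best-total  : total G (best b) ≡ H (p + b)
    open Best

    best-≡ : ∀ {b} → b ≤ β → ∃[ b≤ ] best b ≡ set (sound o {b} b≤)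
    best-≡ {b} b≤ with b ≤? β
    ... | yes b≤′ = b≤′ , refl
    ... | no b≰   = ⊥-elim (b≰ b≤)

    best-spec : ∀ {b} → b ≤ β → Best b
    best-spec {b} b≤ = let b≤′ , e = best-≡ b≤ ; k = sound o {b} b≤′ in record
      { best-clique = subst (Clique G) (sym e) (clique k)
      ; best-blacks = trans (cong (blacks G) e) (blacks-≡ k)
      ; best-total  = trans (cong (total G) e) (total-≡ k) }

    w : ℕ → ℕ
    w b = whites (best b)

    value-≡ : ∀ {b} → b ≤ β → H (p + b) ≡ w b * 2 ^ n + bitmask (best b)
    value-≡ {b} b≤ = trans (sym (best-total (best-spec b≤))) (total-split (best b))

    best-bisize : ∀ {b} → b ≤ β → Bisize G (b , w b)
    best-bisize {b} b≤ = best b , clique⇒biclique (best-clique (best-spec b≤)) ,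
      trans (size-≡ (best b)) (cong (_, w b) (best-blacks (best-spec b≤)))

    -- The heaviest biclique with a given number of black vertices also has the most white ones,
    -- because the masks stay below the unit by which a white vertex is counted.
    most-white : ∀ C → Clique G C → blacks G C ≤ β × whites C ≤ w (blacks G C)
    most-white C c with complete o {blacks G C} {total G C}
      (record { set = C ; inside-S = λ _ → ∈⊤ ; clique = c ; only-black = λ () ; blacks-≡ = refl ; total-≡ = refl })
    ... | b≤ , t≤ = b≤ , quotient-≤ (bitmask-< (best (blacks G C))) (subst₂ _≤_ (total-split C) (value-≡ b≤) t≤)

    bisize-bound : ∀ {b x} → Bisize G (b , x) → b ≤ β × x ≤ w b
    bisize-bound {b} {x} (C , bi , e) =
      subst (_≤ β) b≡ (proj₁ q) , subst₂ (λ b x → x ≤ w b) b≡ x≡ (proj₂ q)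
      where
      q : blacks G C ≤ β × whites C ≤ w (blacks G C)
      q = most-white C (biclique⇒clique bi)
      b≡ : blacks G C ≡ b
      b≡ = cong proj₁ (trans (sym (size-≡ C)) e)
      x≡ : whites C ≡ x
      x≡ = cong proj₂ (trans (sym (size-≡ C)) e)

    antitone : ∀ {b b′} → b ≤ b′ → b′ ≤ β → w b′ ≤ w b
    antitone {b} {b′} b≤b′ b′≤ =
      let D , D⊆ , D-blacks , D-whites = fewer-blacks (best b′) b (≤-trans b≤b′ (≤-reflexive (sym (best-blacks (best-spec b′≤)))))
          _ , le = most-white D (clique-⊆ D⊆ (best-clique (best-spec b′≤)))
      in subst₂ (λ x b → x ≤ w b) D-whites D-blacks le

    -- By antitonicity, beating the value at `suc b` means beating those at all larger numbers of
    -- black vertices.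
    maximal⁺ : ∀ {b} → b ≤ β → (b < β → w (suc b) < w b) → MaxBisize G (b , w b)
    maximal⁺ {b} b≤ f = best-bisize b≤ , λ (b′ , x′) bi ((b≤b′ , wb≤x′) , ne) →
      let b′≤ , x′≤ = bisize-bound bi in
      [ (λ b<b′ → <-irrefl refl (<-≤-trans (f (<-≤-trans b<b′ b′≤)) (≤-trans wb≤x′ (≤-trans x′≤ (antitone b<b′ b′≤))))) ,
        (λ { refl → ne (cong (b ,_) (≤-antisym x′≤ wb≤x′)) }) ]′ (m≤n⇒m<n∨m≡n b≤b′)

    maximal⁻ : ∀ {b x} → MaxBisize G (b , x) → b ≤ β × x ≡ w b × (b < β → w (suc b) < w b)
    maximal⁻ {b} {x} (bi , m) = b≤ , x≡ , λ b<β → ≰⇒> λ le → m (suc b , w (suc b)) (best-bisize b<β)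
      ((n≤1+n b , ≤-trans (≤-reflexive x≡) le) , λ e → <-irrefl (sym (cong proj₁ e)) (n<1+n b))
      where
      b≤ : b ≤ β
      b≤ = proj₁ (bisize-bound bi)
      x≤ : x ≤ w b
      x≤ = proj₂ (bisize-bound bi)
      x≡ : x ≡ w b
      x≡ with x ℕ.≟ w b
      ... | yes e = e
      ... | no ne = ⊥-elim (m (b , w b) (best-bisize b≤) ((≤-refl , x≤) , λ e → ne (sym (cong proj₂ e))))

    v : ℕ → ℕ
    v i = w (β ∸ i)

    -- One more than the largest number of white vertices listed before round i.
    record-before : ℕ → ℕ
    record-before zero    = 0
    record-before (suc i) = suc (v i)

    -- The values `v` never decrease from one round to the next, so comparing with the previous
    -- round is comparing with the record. Round 0 always improves, even with no white vertex.
    improves : ℕ → ℕ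
    improves i = suc (v i) ∸ record-before i

    listed : ℕ → List (ℕ × ℕ)
    listed zero    = []
    listed (suc i) = branch (improves i) (listed i ++ (β ∸ i , v i) ∷ []) (listed i)

    ∈-listed⁻ : ∀ m {q} → q ∈ listed m → ∃[ i ] i < m × q ≡ (β ∸ i , v i) × improves i ≢ 0
    ∈-listed⁻ (suc m) {q} q∈ with improves m in eq
    ... | zero  = let i , i< , e = ∈-listed⁻ m q∈ in i , m<n⇒m<1+n i< , e
    ... | suc _ with ∈-++⁻ (listed m) q∈
    ...   | inj₁ q∈′ = let i , i< , e = ∈-listed⁻ m q∈′ in i , m<n⇒m<1+n i< , e
    ...   | inj₂ (here e) = m , ≤-refl , e , λ z → case trans (sym eq) z of λ ()

    ∈-listed⁺ : ∀ m {i} → i < m → improves i ≢ 0 → (β ∸ i , v i) ∈ listed m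
    ∈-listed⁺ (suc m) {i} (s≤s i≤) nz with m≤n⇒m<n∨m≡n i≤
    ... | inj₂ refl = subst ((β ∸ i , v i) ∈_) (sym (branch-1 nz)) (∈-++⁺ʳ (listed i) (here refl))
    ... | inj₁ i<m with improves m
    ...   | zero  = ∈-listed⁺ m i<m nz
    ...   | suc _ = ∈-++⁺ˡ (∈-listed⁺ m i<m nz)

    listed-unique : ∀ m → m ≤ suc β → Unique (listed m)
    listed-unique zero    _   = []
    listed-unique (suc m) m≤ with improves m
    ... | zero  = listed-unique m (<⇒≤ m≤)
    ... | suc _ = ++⁺ (listed-unique m (<⇒≤ m≤)) ([] ∷ []) λ { (q∈ , here refl) →
      let i , i< , e , _ = ∈-listed⁻ m q∈
      in <-irrefl (sym (∸-cancelˡ-≡ (≤-pred m≤) (≤-trans (<⇒≤ i<) (≤-pred m≤)) (cong proj₁ e))) i< }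

    listed-maximal : ∀ q → q ∈ listed (suc β) ⇔ MaxBisize G q
    listed-maximal q = mk⇔ to from
      where
      next-≡ : ∀ {i} → i < β → suc (β ∸ suc i) ≡ β ∸ i
      next-≡ i<β = sym (+-∸-assoc 1 i<β)
      to : q ∈ listed (suc β) → MaxBisize G q
      to q∈ with ∈-listed⁻ (suc β) q∈
      ... | zero  , _ , refl , nz = maximal⁺ ≤-refl (λ p → ⊥-elim (<-irrefl refl p))
      ... | suc i , i< , refl , nz = maximal⁺ (m∸n≤m β (suc i)) (λ _ → ≰⇒> λ le →
        nz (m≤n⇒m∸n≡0 (s≤s (≤-trans le (≤-reflexive (cong w (next-≡ (≤-pred i<))))))))
      from : MaxBisize G q → q ∈ listed (suc β)
      from mx with maximal⁻ mx
      ... | b≤ , refl , f = subst (_∈ listed (suc β)) (cong₂ _,_ back (cong w back)) (∈-listed⁺ (suc β) {i} (s≤s (m∸n≤m β b)) nz)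
        where
        b = proj₁ q
        i = β ∸ b
        back : β ∸ (β ∸ b) ≡ b
        back = m∸[m∸n]≡n b≤
        nz : improves i ≢ 0
        nz with β ∸ b in eq
        ... | zero  = λ ()
        ... | suc j = λ z → <-irrefl refl (<-≤-trans (f b<β) (≤-trans (≤-reflexive (cong w (sym b≡)))
                (≤-trans (≤-pred (m∸n≡0⇒m≤n z)) (≤-reflexive (cong w (trans (sym (next-≡ j<β)) (cong suc b≡)))))))
          where
          b≡ : β ∸ suc j ≡ b
          b≡ = trans (cong (β ∸_) (sym eq)) back
          j<β : j < β
          j<β = ≤-trans (≤-reflexive (sym eq)) (m∸n≤m β b)
          b<β : b < β
          b<β = m∸n≢0⇒n<m (λ z′ → case trans (sym eq) z′ of λ ())

-- Reading off the results

-- The truncated `w ∸ i` accounts for idle rounds: after w subtractions the remainder m is below X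
-- and the test fails. So n rounds suffice for every w up to n.
record Dividing (w m X : ℕ) (i : ℕ) (s : State) : Set where
  field
    quotient  : arr s reg rLA + (w ∸ i) ≡ w
    remainder : arr s reg rACC ≡ (w ∸ i) * X + m
open Dividing

divideStep-correct : ∀ {w m X} ρ i s → m < X → arr s reg rBIG ≡ X → Dividing w m X i s →
  Dividing w m X (suc i) (run divideStep ρ s) × cost divideStep ρ s ≤ 65
divideStep-correct {w} {m} {X} ρ i s m< big D = cases (w ∸ i) refl
  where
  subtract : Cmd
  subtract = set-reg rACC (get-reg rACC ⊟ get-reg rBIG) ⨟ set-reg rLA (get-reg rLA ⊞ lit 1)
  test : Expr
  test = get-reg rACC ⊞ lit 1 ⊟ get-reg rBIG
  next-∸ : w ∸ suc i ≡ w ∸ i ∸ 1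
  next-∸ = trans (cong (w ∸_) (+-comm 1 i)) (sym (∸-+-assoc w i 1))
  cases : ∀ k → w ∸ i ≡ k → Dividing w m X (suc i) (run divideStep ρ s) × cost divideStep ρ s ≤ 65
  cases zero e = subst (Dividing w m X (suc i)) (sym (run-when-0 {divideStep} {test} {subtract} {skip} {ρ} {s} refl z)) (record
      { quotient = trans (cong (arr s reg rLA +_) (trans next-∸ (trans (cong (_∸ 1) e) (sym e)))) (quotient D)
      ; remainder = trans (remainder D) (cong (λ k → k * X + m) (trans e (sym (trans next-∸ (cong (_∸ 1) e))))) }) ,
    subst (_≤ 65) (sym (cost-when-0 {divideStep} {test} {subtract} {skip} {ρ} {s} refl z)) (≤ᵇ⇒≤ 22 65 tt)
    where
    z : arr s reg rACC + 1 ∸ arr s reg rBIG ≡ 0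
    z = m≤n⇒m∸n≡0 (≤-trans (≤-reflexive (trans (+-comm _ 1) (cong suc (trans (remainder D) (cong (λ k → k * X + m) e)))))
      (≤-trans m< (≤-reflexive (sym big))))
  cases (suc k) e = subst (Dividing w m X (suc i)) (sym (run-when-1 {divideStep} {test} {subtract} {skip} {ρ} {s} refl nz)) (record
      { quotient = trans (cong (arr s reg rLA + 1 +_) w≡) (trans (trans (+-assoc _ 1 k) (cong (arr s reg rLA +_) (sym e))) (quotient D))
      ; remainder = trans (cong₂ _∸_ acc≡ big) (trans (trans (cong (_∸ X) (+-assoc X (k * X) m)) (m+n∸m≡n X _)) (cong (λ j → j * X + m) (sym w≡))) }) ,
    subst (_≤ 65) (sym (cost-when-1 {divideStep} {test} {subtract} {skip} {ρ} {s} refl nz)) ≤-refl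
    where
    w≡ : w ∸ suc i ≡ k
    w≡ = trans next-∸ (cong (_∸ 1) e)
    acc≡ : arr s reg rACC ≡ X + k * X + m
    acc≡ = trans (remainder D) (cong (λ k → k * X + m) e)
    nz : arr s reg rACC + 1 ∸ arr s reg rBIG ≢ 0
    nz z = <-irrefl refl (<-≤-trans (≤-trans (s≤s (≤-trans (≤-trans (m≤m+n X (k * X)) (m≤m+n _ m)) (≤-reflexive (sym acc≡))))
      (≤-reflexive (+-comm 1 _))) (≤-trans (m∸n≡0⇒m≤n z) (≤-reflexive big)))

divide-correct : ∀ {w m n} d ρ s → m < 2 ^ n → w ≤ n → arr s reg rN ≡ n → arr s reg rBIG ≡ 2 ^ n →
  arr s reg rACC ≡ w * 2 ^ n + m →
  (arr (run (divide d) ρ s) reg rLA ≡ w × arr (run (divide d) ρ s) reg rACC ≡ m) × cost (divide d) ρ s ≤ 23 + n * 69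
divide-correct {w} {m} {n} d ρ s m< w≤ n≡ big acc≡ =
  seq-rule (set-reg rLA (lit 0)) (loop d (get-reg rN) divideStep) ρ s {Dividing w m (2 ^ n) 0}
    {λ s → arr s reg rLA ≡ w × arr s reg rACC ≡ m} {9}
    (record { quotient = refl ; remainder = acc≡ } , ≤-refl)
    λ s₁ p₁ D → let D′ , c = loop-rule⁺ (Dividing w m (2 ^ n)) d (get-reg rN) divideStep ρ s₁ n 65
                      (trans (fixed p₁ reg rN refl) n≡) D
                      (λ i s′ _ p D → divideStep-correct (ρ [ d ↦ i ]) i s′ m< (trans (fixed p reg rBIG refl) (trans (fixed p₁ reg rBIG refl) big)) D)
                in finished D′ , c
  where
  finished : ∀ {s} → Dividing w m (2 ^ n) n s → arr s reg rLA ≡ w × arr s reg rACC ≡ m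
  finished {s} D = trans (sym (+-identityʳ _)) (trans (cong (arr s reg rLA +_) (sym (m≤n⇒m∸n≡0 w≤))) (quotient D)) ,
    trans (remainder D) (cong (λ k → k * 2 ^ n + m) (m≤n⇒m∸n≡0 w≤))

-- The contribution of the vertices from i on. A vertex is weighed by its distance from the end, so
-- the tail of a set weighs the same when taken as a set of its own.
tailmask : ∀ {n} → Subset n → ℕ → ℕ
tailmask C       zero    = bitmask C
tailmask []      (suc i) = 0
tailmask (x ∷ C) (suc i) = tailmask C i

-- All vertices after i together weigh less than vertex i, so comparing with its power decides
-- whether it belongs to the set.
tailmask-step : ∀ {n} (C : Subset n) {i} → i < n →
  tailmask C (suc i) < 2 ^ (n ∸ suc i) ×
  ((nth 0 (bitList C) i ≡ 1 × tailmask C i ≡ 2 ^ (n ∸ suc i) + tailmask C (suc i)) ⊎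
   (nth 0 (bitList C) i ≡ 0 × tailmask C i ≡ tailmask C (suc i)))
tailmask-step (true ∷ C)  {zero}  _        = bitmask-< C , inj₁ (refl , refl)
tailmask-step (false ∷ C) {zero}  _        = bitmask-< C , inj₂ (refl , refl)
tailmask-step (x ∷ C)     {suc i} (s≤s i<) = tailmask-step C i<

take-suc : ∀ (xs : List ℕ) {i} → i < length xs → take (suc i) xs ≡ take i xs ∷ʳ nth 0 xs i
take-suc (x ∷ xs) {zero}  _        = refl
take-suc (x ∷ xs) {suc i} (s≤s i<) = cong (x ∷_) (take-suc xs i<)

take-all : ∀ (xs : List ℕ) {k} → length xs ≡ k → take k xs ≡ xs
take-all []       refl = refl
take-all (x ∷ xs) refl = cong (x ∷_) (take-all xs refl)

module _ {n : ℕ} (G : BipartiteGraph n) where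
  open BipartiteGraph G

  record Showing (C : Subset n) (i : ℕ) (s : State) : Set where
    field
      left  : arr s reg rACC ≡ tailmask C i
      shown : out s ≡ take i (bitList C)
  open Showing

  showVertex-correct : ∀ {C} i s → i < n → arr s pow i ≡ 2 ^ (n ∸ suc i) → Showing C i s →
    Showing C (suc i) (run showVertex (noVars [ 0 ↦ i ]) s) × cost showVertex (noVars [ 0 ↦ i ]) s ≤ 51
  showVertex-correct {C} i s i<n pow≡ S = [ marked , unmarked ]′ (proj₂ (tailmask-step C i<n))
    where
    ρ : Env
    ρ = noVars [ 0 ↦ i ]
    test : Expr
    test = get-reg rACC ⊞ lit 1 ⊟ pow at var 0
    mark : Cmd
    mark = put (lit 1) ⨟ set-reg rACC (get-reg rACC ⊟ pow at var 0)
    t : ℕ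
    t = tailmask C (suc i)
    printed : ∀ {x} → nth 0 (bitList C) i ≡ x → out s ∷ʳ x ≡ take (suc i) (bitList C)
    printed e = trans (cong₂ _∷ʳ_ (shown S) (sym e)) (sym (take-suc (bitList C) (subst (i <_) (sym (length-bitList C)) i<n)))
    marked : nth 0 (bitList C) i ≡ 1 × tailmask C i ≡ 2 ^ (n ∸ suc i) + t →
      Showing C (suc i) (run showVertex ρ s) × cost showVertex ρ s ≤ 51
    marked (b , e) = subst (Showing C (suc i)) (sym (run-when-1 {showVertex} {test} {mark} {put (lit 0)} {ρ} {s} refl nz)) (record
        { left = trans (cong₂ _∸_ (trans (left S) e) pow≡) (m+n∸m≡n (2 ^ (n ∸ suc i)) t) ; shown = printed b }) ,
      subst (_≤ 51) (sym (cost-when-1 {showVertex} {test} {mark} {put (lit 0)} {ρ} {s} refl nz)) (≤ᵇ⇒≤ _ 51 tt)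
      where
      nz : arr s reg rACC + 1 ∸ arr s pow i ≢ 0
      nz z = <-irrefl refl (<-≤-trans (≤-trans (s≤s (≤-trans (m≤m+n _ t) (≤-reflexive (sym (trans (left S) e)))))
        (≤-reflexive (+-comm 1 _))) (≤-trans (m∸n≡0⇒m≤n z) (≤-reflexive pow≡)))
    unmarked : nth 0 (bitList C) i ≡ 0 × tailmask C i ≡ t →
      Showing C (suc i) (run showVertex ρ s) × cost showVertex ρ s ≤ 51
    unmarked (b , e) = subst (Showing C (suc i)) (sym (run-when-0 {showVertex} {test} {mark} {put (lit 0)} {ρ} {s} refl z)) (record
        { left = trans (left S) e ; shown = printed b }) ,
      subst (_≤ 51) (sym (cost-when-0 {showVertex} {test} {mark} {put (lit 0)} {ρ} {s} refl z)) (≤ᵇ⇒≤ _ 51 tt)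
      where
      z : arr s reg rACC + 1 ∸ arr s pow i ≡ 0
      z = m≤n⇒m∸n≡0 (≤-trans (≤-reflexive (trans (+-comm _ 1) (cong suc (trans (left S) e))))
        (≤-trans (proj₁ (tailmask-step C i<n)) (≤-reflexive (sym pow≡))))

  prepared-item : ∀ {rest s} → Prepared G rest s → Item G s (arr s reg rFP) 0 ⊤
  prepared-item P = proj₁ (stacked (stack-p P))

  prepared-optimal : ∀ {rest s} → Prepared G rest s →
    Optimal (arr s heap) (arr s ptr 1) (blacks G ⊤) (Candidate G ⊤ 1)
  prepared-optimal P = optimal (prepared-item P) (s≤s (s≤s z≤n))

  pow-stored : ∀ {s i} → Stored G s → i < n → arr s pow i ≡ 2 ^ (n ∸ suc i)
  pow-stored {s} {i} S i<n = subst (λ j → arr s pow j ≡ 2 ^ (n ∸ suc j)) (toℕ-fromℕ< i<n) (pow-≡ S (fromℕ< i<n))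
    where
    open import Data.Fin using (fromℕ<)
    open import Data.Fin.Properties using (toℕ-fromℕ<)

  module Listing {rest s₀} (P : Prepared G rest s₀) where

    private
      S = stored (ready-p P)
      module R = Profile G (prepared-optimal P)

    record Listed (i : ℕ) (s : State) : Set where
      field
        highest : arr s reg rLB ≡ R.record-before i
        printed : out s ≡ concatMap encodePair (R.listed i)
    open Listed

    emit-correct : ∀ ρ i s → i ≤ R.β → ρ 1 ≡ R.β ∸ i → arr s reg rLA ≡ R.v i → Listed i s →
      Listed (suc i) (run emit ρ s) × cost emit ρ s ≤ 52
    emit-correct ρ i s i≤ e la L = [ flat , up ]′ (zero-or-pos (R.improves i))
      where
      test : Expr
      test = get-reg rLA ⊞ lit 1 ⊟ get-reg rLB
      say : Cmd
      say = put (var 1) ⨟ put (get-reg rLA) ⨟ set-reg rLB (get-reg rLA ⊞ lit 1)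
      test-≡ : arr s reg rLA + 1 ∸ arr s reg rLB ≡ R.improves i
      test-≡ = cong₂ _∸_ (trans (+-comm _ 1) (cong suc la)) (highest L)
      flat : R.improves i ≡ 0 → Listed (suc i) (run emit ρ s) × cost emit ρ s ≤ 52
      flat z = subst (Listed (suc i)) (sym (run-when-0 {emit} {test} {say} {skip} {ρ} {s} refl (trans test-≡ z))) (record
          -- Nothing is written, yet `rLB` is already right: the value did not increase, and by
          -- antitonicity it did not decrease either.
          { highest = trans (highest L) (≤-antisym (before i i≤) (m∸n≡0⇒m≤n z))
          ; printed = trans (printed L) (cong (concatMap encodePair) (sym (branch-0 z))) }) ,
        subst (_≤ 52) (sym (cost-when-0 {emit} {test} {say} {skip} {ρ} {s} refl (trans test-≡ z))) (≤ᵇ⇒≤ _ 52 tt)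
        where
        before : ∀ i → i ≤ R.β → R.record-before i ≤ suc (R.v i)
        before zero    _  = z≤n
        before (suc i) i≤ = s≤s (R.antitone (∸-monoʳ-≤ R.β (n≤1+n i)) (m∸n≤m R.β i))
      up : R.improves i ≢ 0 → Listed (suc i) (run emit ρ s) × cost emit ρ s ≤ 52
      up nz = subst (Listed (suc i)) (sym (run-when-1 {emit} {test} {say} {skip} {ρ} {s} refl (nz ∘ trans (sym test-≡)))) (record
          { highest = trans (+-comm _ 1) (cong suc la)
          ; printed = trans (++-assoc (out s) (ρ 1 ∷ []) (arr s reg rLA ∷ [])) (trans
              (cong₂ _++_ (printed L) (cong₂ (λ x y → x ∷ y ∷ []) e la))
              (trans (sym (concatMap-++ encodePair (R.listed i) ((R.β ∸ i , R.v i) ∷ [])))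
                (cong (concatMap encodePair) (sym (branch-1 nz))))) }) ,
        subst (_≤ 52) (sym (cost-when-1 {emit} {test} {say} {skip} {ρ} {s} refl (nz ∘ trans (sym test-≡)))) (≤ᵇ⇒≤ _ 52 tt)

    record Intact (s : State) : Set where
      field
        same-value : ∀ b → arr s heap (arr s ptr 1 + b) ≡ arr s₀ heap (arr s₀ ptr 1 + b)
        same-len   : arr s len 0 ≡ R.β
        same-n     : arr s reg rN ≡ n
        same-big   : arr s reg rBIG ≡ 2 ^ n
    open Intact

    listStep-correct : ∀ i s → i ≤ R.β → Intact s → Listed i s →
      Listed (suc i) (run listStep (noVars [ 0 ↦ i ]) s) × cost listStep (noVars [ 0 ↦ i ]) s ≤ 114 + n * 69
    listStep-correct i s i≤ I L = weaken (seq-rule fetchValue (divide 2 ⨟ emit) ρ s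
      {λ s₁ → arr s₁ reg rACC ≡ R.v i * 2 ^ n + bitmask (R.best (R.β ∸ i)) × SameIO s s₁} {Listed (suc i)} {26}
      ((trans (same-value I (arr s len 0 ∸ i)) (trans (cong (λ b → arr s₀ heap (arr s₀ ptr 1 + (b ∸ i))) (same-len I)) (R.value-≡ (m∸n≤m R.β i))) ,
        refl , refl) , ≤-refl)
      λ s₁ p₁ (acc≡ , _ , o₁) → seq-rule (divide 2) emit ρ s₁
        {λ s₂ → (arr s₂ reg rLA ≡ R.v i × arr s₂ reg rACC ≡ bitmask (R.best (R.β ∸ i))) × SameIO s₁ s₂} {Listed (suc i)} {23 + n * 69}
        (let D , c = divide-correct 2 ρ s₁ (bitmask-< (R.best (R.β ∸ i))) (whites-≤ G (R.best (R.β ∸ i)))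
                       (trans (fixed p₁ reg rN refl) (same-n I)) (trans (fixed p₁ reg rBIG refl) (same-big I)) acc≡
         in (D , silent-io (divide 2) tt ρ s₁) , c)
        λ s₂ p₂ ((la , _) , _ , o₂) → emit-correct ρ i s₂ i≤ (cong (_∸ i) (same-len I)) la
          (record { highest = trans (fixed p₂ reg rLB refl) (trans (fixed p₁ reg rLB refl) (highest L)) ; printed = trans o₂ (trans o₁ (printed L)) }))
      where
      ρ : Env
      ρ = noVars [ 0 ↦ i ] [ 1 ↦ arr s len 0 ∸ i ]
      fetchValue : Cmd
      fetchValue = set-reg rACC (heap at (ptr at lit 1 ⊞ var 1))
      weaken : ∀ {A : Set} {x} → A × x ≤ 26 + (23 + n * 69 + 52) → A × 13 + x ≤ 114 + n * 69
      weaken (a , p) = a , ≤-trans (+-monoʳ-≤ 13 p) (≤-reflexive (cong (62 +_) (+-comm (n * 69) 52)))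

    listSizes-correct : Listed (suc R.β) (run listSizes noVars s₀) ×
      cost listSizes noVars s₀ ≤ 9 + (16 + suc R.β * (114 + n * 69 + 4))
    listSizes-correct = seq-rule (set-reg rLB (lit 0)) (loop 0 (len at lit 0 ⊞ lit 1) listStep) noVars s₀ {Listed 0} {Listed (suc R.β)} {9}
      (record { highest = refl ; printed = quiet (ready-p P) } , ≤-refl)
      λ s₁ p₁ L → loop-rule⁺ Listed 0 (len at lit 0 ⊞ lit 1) listStep noVars s₁ (suc R.β) (114 + n * 69)
        (trans (+-comm _ 1) (cong suc (trans (fixed p₁ len 0 refl) (len-≡ (prepared-item P))))) L
        λ i s′ i< p L → listStep-correct i s′ (≤-pred i<) (record
          { same-value = λ b → trans (fixed p heap _ refl) (trans (fixed p₁ heap _ refl)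
              (cong (λ a → arr s₀ heap (a + b)) (trans (fixed p ptr 1 refl) (fixed p₁ ptr 1 refl))))
          ; same-len = trans (fixed p len 0 refl) (trans (fixed p₁ len 0 refl) (len-≡ (prepared-item P)))
          ; same-n   = trans (fixed p reg rN refl) (trans (fixed p₁ reg rN refl) (n-≡ S))
          ; same-big = trans (fixed p reg rBIG refl) (trans (fixed p₁ reg rBIG refl) (big-≡ S)) }) L

  module Exhibiting {b x s₀} (P : Prepared G (encodePair (b , x)) s₀) (b≤ : b ≤ blacks G ⊤) where

    private
      S = stored (ready-p P)
      module R = Profile G (prepared-optimal P)

    showBiclique-correct : out (run showBiclique noVars s₀) ≡ bitList (R.best b) ×
      cost showBiclique noVars s₀ ≤ 9 + (32 + (23 + n * 69 + (14 + n * 55)))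
    showBiclique-correct = seq-rule (get reg (lit rLB)) (fetchValue ⨟ divide 0 ⨟ loop 0 (get-reg rN) showVertex) noVars s₀
      {λ s → arr s reg rLB ≡ b × out s ≡ []} {λ s → out s ≡ bitList (R.best b)} {9}
      ((cong hd (inp-p P) , quiet (ready-p P)) , ≤-refl)
      λ s₁ p₁ (lb≡ , o₁) → seq-rule fetchValue (divide 0 ⨟ loop 0 (get-reg rN) showVertex) noVars s₁
        {λ s → arr s reg rACC ≡ R.w b * 2 ^ n + bitmask (R.best b) × out s ≡ []} {λ s → out s ≡ bitList (R.best b)} {32}
        ((trans (fixed p₁ heap _ refl) (trans (cong₂ (λ a c → arr s₀ heap (a + c)) (fixed p₁ ptr 1 refl) lb≡) (R.value-≡ b≤)) , o₁) , ≤-refl)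
        λ s₂ p₂ (acc≡ , o₂) → seq-rule (divide 0) (loop 0 (get-reg rN) showVertex) noVars s₂
          {λ s → (arr s reg rLA ≡ R.w b × arr s reg rACC ≡ bitmask (R.best b)) × SameIO s₂ s} {λ s → out s ≡ bitList (R.best b)} {23 + n * 69}
          (let D , c = divide-correct 0 noVars s₂ (bitmask-< (R.best b)) (whites-≤ G (R.best b))
                         (trans (fixed p₂ reg rN refl) (trans (fixed p₁ reg rN refl) (n-≡ S)))
                         (trans (fixed p₂ reg rBIG refl) (trans (fixed p₁ reg rBIG refl) (big-≡ S))) acc≡
           in (D , silent-io (divide 0) tt noVars s₂) , c)
          λ s₃ p₃ ((_ , acc₃) , _ , o₃) →
            let T , c = loop-rule⁺ (Showing (R.best b)) 0 (get-reg rN) showVertex noVars s₃ n 51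
                          (trans (fixed p₃ reg rN refl) (trans (fixed p₂ reg rN refl) (trans (fixed p₁ reg rN refl) (n-≡ S))))
                          (record { left = acc₃ ; shown = trans o₃ o₂ })
                          (λ i s′ i< p T → showVertex-correct i s′ i<
                            (trans (fixed p pow i refl) (trans (fixed p₃ pow i refl) (trans (fixed p₂ pow i refl) (trans (fixed p₁ pow i refl) (pow-stored S i<))))) T)
            in trans (shown T) (take-all (bitList (R.best b)) (length-bitList (R.best b))) , c
      where
      fetchValue : Cmd
      fetchValue = set-reg rACC (heap at (ptr at lit 1 ⊞ get-reg rLB))

-- The two programs and their running times

prepare-correct : ∀ {n} (G : BipartiteGraph n) T K {rest xs} → 2 ≤ K → CanonicalTree G T → All (_≤ K) (primeArities T) →
  xs ≡ encodeGraph G ++ encodeTree T ++ rest →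
  Prepared G rest (run (prepare K) noVars (start xs)) ×
  cost (prepare K) noVars (start xs) ≤ 78 + 131 * n + 24 * (n * n) + (23 + treeCost K * n ^ 2)
prepare-correct {n} G T K {rest} {xs} 2≤K can ar e = seq-rule readGraph (readTree K) noVars (start xs)
  {λ s → Ready G s × Stack G s [] × inp s ≡ encodeTree T ++ rest} {Prepared G rest} {78 + 131 * n + 24 * (n * n)}
  (let r , k , i , c = initial-ready G xs e in (r , k , i) , c)
  λ s₁ _ (r , k , i) → readTree-correct G K T s₁ 2≤K can ar r k i

canonical-nonempty : ∀ {n} {G : BipartiteGraph n} {S T} → CanonicalOn G S T → Nonempty S
canonical-nonempty (leaf v) = v , x∈⁅x⁆ v
canonical-nonempty {n} {G} {S} (node {ℓ} {Vs = Vs} dec _) = part (partition ℓ dec)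
  where
  partition : ∀ ℓ → Decomposition G ℓ S Vs → Partition S Vs × 2 ≤ length Vs
  partition parallel (((p , l , _) , _) , _) = p , l
  partition series   (((p , l , _) , _) , _) = p , l
  partition k+s      ((p , l , _) , _)       = p , l
  partition prime    d = proj₁ (proj₂ (proj₂ (proj₂ (proj₂ d)))) , prime-length G d
  part : Partition S Vs × 2 ≤ length Vs → Nonempty S
  part (((v , v∈) ∷ _ , _ , refl) , _) = v , x∈p∪q⁺ (inj₁ v∈)

-- With n = 0 the time bound would be 0 while the programs always take some steps; but parts are
-- nonempty, so a canonical tree has a vertex.
canonical-positive : ∀ {n} {G : BipartiteGraph n} {T} → CanonicalTree G T → 1 ≤ n
canonical-positive can = ≤-trans (s≤s z≤n) (toℕ<n (proj₁ (canonical-nonempty can)))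

quadratic : ∀ {n} a b c → 1 ≤ n → a + b * n + c * (n * n) ≤ (a + b + c) * n ^ 2
quadratic {n} a b c 1≤n = begin
  a + b * n + c * (n * n)
    ≤⟨ +-monoˡ-≤ (c * (n * n)) (+-mono-≤
         (≤-trans (≤-reflexive (sym (*-identityʳ a))) (*-monoʳ-≤ a (*-mono-≤ 1≤n 1≤n)))
         (*-monoʳ-≤ b (≤-trans (≤-reflexive (sym (*-identityʳ n))) (*-monoʳ-≤ n 1≤n)))) ⟩
  a * (n * n) + b * (n * n) + c * (n * n)
    ≡⟨ solve 4 (λ a b c n → a :* (n :* n) :+ b :* (n :* n) :+ c :* (n :* n) := (a :+ b :+ c) :* n :^ 2) refl a b c n ⟩
  (a + b + c) * n ^ 2 ∎
  where
  open ≤-Reasoning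
  open +-*-Solver

-- 700 exceeds the sums 655 and 458 of the fixed coefficients in the two time bounds that follow.
timeFactor : ℕ → ℕ
timeFactor K = 700 + treeCost K

listing-time : ∀ {n β} K → 1 ≤ n → β ≤ n →
  78 + 131 * n + 24 * (n * n) + (23 + treeCost K * n ^ 2) + (9 + (16 + suc β * (114 + n * 69 + 4))) ≤ timeFactor K * n ^ 2
listing-time {n} {β} K 1≤n β≤n = begin
  78 + 131 * n + 24 * (n * n) + (23 + κ * n ^ 2) + (9 + (16 + suc β * (114 + n * 69 + 4)))
    ≤⟨ +-monoʳ-≤ (78 + 131 * n + 24 * (n * n) + (23 + κ * n ^ 2)) (+-monoʳ-≤ 25 (*-monoˡ-≤ (114 + n * 69 + 4) (s≤s β≤n))) ⟩
  78 + 131 * n + 24 * (n * n) + (23 + κ * n ^ 2) + (9 + (16 + suc n * (114 + n * 69 + 4)))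
    ≡⟨ solve 2 (λ n k → con 78 :+ con 131 :* n :+ con 24 :* (n :* n) :+ (con 23 :+ k :* n :^ 2) :+
          (con 9 :+ (con 16 :+ (con 1 :+ n) :* (con 114 :+ n :* con 69 :+ con 4)))
         := con 244 :+ con 318 :* n :+ con 93 :* (n :* n) :+ k :* n :^ 2) refl n κ ⟩
  244 + 318 * n + 93 * (n * n) + κ * n ^ 2 ≤⟨ +-monoˡ-≤ (κ * n ^ 2) (quadratic 244 318 93 1≤n) ⟩
  655 * n ^ 2 + κ * n ^ 2                  ≤⟨ +-monoˡ-≤ (κ * n ^ 2) (*-monoˡ-≤ (n ^ 2) (≤ᵇ⇒≤ 655 700 tt)) ⟩
  700 * n ^ 2 + κ * n ^ 2                  ≡⟨ *-distribʳ-+ (n ^ 2) 700 κ ⟨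
  timeFactor K * n ^ 2                     ∎
  where
  open ≤-Reasoning
  open +-*-Solver
  κ = treeCost K

exhibiting-time : ∀ {n} K → 1 ≤ n →
  78 + 131 * n + 24 * (n * n) + (23 + treeCost K * n ^ 2) + (9 + (32 + (23 + n * 69 + (14 + n * 55)))) ≤ timeFactor K * n ^ 2
exhibiting-time {n} K 1≤n = begin
  78 + 131 * n + 24 * (n * n) + (23 + κ * n ^ 2) + (9 + (32 + (23 + n * 69 + (14 + n * 55))))
    ≡⟨ solve 2 (λ n k → con 78 :+ con 131 :* n :+ con 24 :* (n :* n) :+ (con 23 :+ k :* n :^ 2) :+
          (con 9 :+ (con 32 :+ (con 23 :+ n :* con 69 :+ (con 14 :+ n :* con 55))))
         := con 179 :+ con 255 :* n :+ con 24 :* (n :* n) :+ k :* n :^ 2) refl n κ ⟩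
  179 + 255 * n + 24 * (n * n) + κ * n ^ 2 ≤⟨ +-monoˡ-≤ (κ * n ^ 2) (quadratic 179 255 24 1≤n) ⟩
  458 * n ^ 2 + κ * n ^ 2                  ≤⟨ +-monoˡ-≤ (κ * n ^ 2) (*-monoˡ-≤ (n ^ 2) (≤ᵇ⇒≤ 458 700 tt)) ⟩
  700 * n ^ 2 + κ * n ^ 2                  ≡⟨ *-distribʳ-+ (n ^ 2) 700 κ ⟨
  timeFactor K * n ^ 2                     ∎
  where
  open ≤-Reasoning
  open +-*-Solver
  κ = treeCost K

scoped-prepare : ∀ k c → T (scoped 0 c) → T (scoped 0 (prepare k ⨟ c))
scoped-prepare k c sc with scoped 7 (tryPatterns k) | scoped-tryPatterns k
... | true | _ = sc

module _ (K : ℕ) (2≤K : 2 ≤ K) {n : ℕ} (G : BipartiteGraph n) (T : Tree n) (can : CanonicalTree G T) (width : bimodularwidth T ≤ K) where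

  private
    arities : All (_≤ K) (primeArities T)
    arities = primeArities-bounded T width

    1≤n : 1 ≤ n
    1≤n = canonical-positive can

  ListsSizes : State → Set
  ListsSizes s = ∃[ L ] Unique L × (∀ q → q ∈ L ⇔ MaxBisize G q) × out s ≡ concatMap encodePair L

  listing-correct : ListsSizes (run (prepare K ⨟ listSizes) noVars (start (encodeGraph G ++ encodeTree T))) ×
    cost (prepare K ⨟ listSizes) noVars (start (encodeGraph G ++ encodeTree T)) ≤ timeFactor K * n ^ 2
  listing-correct = weaken (seq-rule (prepare K) listSizes noVars (start (encodeGraph G ++ encodeTree T)) {Prepared G []} {ListsSizes}
    (prepare-correct G T K 2≤K can arities (cong (encodeGraph G ++_) (sym (++-identityʳ (encodeTree T)))))
    λ s₀ _ P → let L , c = Listing.listSizes-correct G P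
                   module R = Profile G (prepared-optimal G P)
               in (R.listed (suc R.β) , R.listed-unique (suc R.β) ≤-refl , R.listed-maximal , Listing.Listed.printed L) , c)
    where
    β≤n : blacks G ⊤ ≤ n
    β≤n = ≤-trans (≤-reflexive (weigh-indicator (BipartiteGraph.B G) ⊤)) (∣p∣≤n (⊤ ∩ BipartiteGraph.B G))
    weaken : ∀ {A : Set} {x} → A × x ≤ 78 + 131 * n + 24 * (n * n) + (23 + treeCost K * n ^ 2) + (9 + (16 + suc (blacks G ⊤) * (114 + n * 69 + 4))) →
      A × x ≤ timeFactor K * n ^ 2
    weaken (a , p) = a , ≤-trans p (listing-time {n} {blacks G ⊤} K 1≤n β≤n)

  ShowsBiclique : ℕ × ℕ → State → Set
  ShowsBiclique q s = ∃[ C ] Biclique G C × size G C ≡ q × out s ≡ encodeSubset C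

  exhibiting-correct : ∀ q → MaxBisize G q →
    ShowsBiclique q (run (prepare K ⨟ showBiclique) noVars (start (encodeGraph G ++ encodeTree T ++ encodePair q))) ×
    cost (prepare K ⨟ showBiclique) noVars (start (encodeGraph G ++ encodeTree T ++ encodePair q)) ≤ timeFactor K * n ^ 2
  exhibiting-correct q mx = weaken (seq-rule (prepare K) showBiclique noVars (start (encodeGraph G ++ encodeTree T ++ encodePair q))
    {Prepared G (encodePair q)} {ShowsBiclique q}
    (prepare-correct G T K 2≤K can arities refl)
    λ s₀ _ P → show P)
    where
    show : ∀ {s₀} → Prepared G (encodePair q) s₀ → ShowsBiclique q (run showBiclique noVars s₀) ×
      cost showBiclique noVars s₀ ≤ 9 + (32 + (23 + n * 69 + (14 + n * 55)))
    show P = let b≤ , x≡ , _ = R.maximal⁻ mx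
                 o , c = Exhibiting.showBiclique-correct G P b≤
                 C , bi , e = R.best-bisize b≤
             in (C , bi , trans e (cong (proj₁ q ,_) (sym x≡)) , trans o (sym (encodeSubset-≡ C))) , c
      where module R = Profile G (prepared-optimal G P)
    weaken : ∀ {A : Set} {x} → A × x ≤ 78 + 131 * n + 24 * (n * n) + (23 + treeCost K * n ^ 2) + (9 + (32 + (23 + n * 69 + (14 + n * 55)))) →
      A × x ≤ timeFactor K * n ^ 2
    weaken (a , p) = a , ≤-trans p (exhibiting-time {n} K 1≤n)

theorem11 : (k : ℕ) →
    (∃[ P ] ∃[ c ]
    (∀ {n} (G : BipartiteGraph n) (T : Tree n) →
    TwinFree G → CanonicalTree G T → bimodularwidth T ≤ k →
    ∃[ L ] Unique L × (∀ p → p ∈ L ⇔ MaxBisize G p) ×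
    Computes P (c * n ^ 2) (encodeGraph G ++ encodeTree T) (concatMap encodePair L)))
    ×
    (∃[ P ] ∃[ c ]
    (∀ {n} (G : BipartiteGraph n) (T : Tree n) →
    TwinFree G → CanonicalTree G T → bimodularwidth T ≤ k →
    ∀ p → MaxBisize G p →
    ∃[ C ] Biclique G C × size G C ≡ p ×
    Computes P (c * n ^ 2) (encodeGraph G ++ encodeTree T ++ encodePair p) (encodeSubset C)))
-- The enumeration runs over 2 + k positions: k are enough for Prime nodes, and two are required for
-- merging pairs even if k is smaller.
theorem11 k =
  (compile (prepare (2 + k) ⨟ listSizes) 0 , timeFactor (2 + k) , λ G T _ can width →
    let (L , unique , maximal , out≡) , time = listing-correct (2 + k) (m≤m+n 2 k) G T can (≤-trans width (m≤n+m k 2))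
    in L , unique , maximal ,
       compiled-computes (prepare (2 + k) ⨟ listSizes) (encodeGraph G ++ encodeTree T)
         (scoped-prepare (2 + k) listSizes tt) time out≡) ,
  (compile (prepare (2 + k) ⨟ showBiclique) 0 , timeFactor (2 + k) , λ G T _ can width p max →
    let (C , biclique , size≡ , out≡) , time = exhibiting-correct (2 + k) (m≤m+n 2 k) G T can (≤-trans width (m≤n+m k 2)) p max
    in C , biclique , size≡ ,
       compiled-computes (prepare (2 + k) ⨟ showBiclique) (encodeGraph G ++ encodeTree T ++ encodePair p)
         (scoped-prepare (2 + k) showBiclique tt) time out≡)
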